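{- Let $0\le m'\le m\le n$ and let $C\subseteq\Delta_n^{m',m}$ be a weakly separated collection of maximum cardinality among weakly separated collections contained in $\Delta_n^{m',m}$. Then $\mathcal{IS}_n^{m',m}$ can be obtained from $C$ by a finite sequence of lowering 3-flips followed by a finite sequence of lowering 4-flips in level $m'$. Consequently, the set $\mathcal B_n^{m',m}$ coincides with the set of maximum-cardinality weakly separated collections in $\Delta_n^{m',m}$.
   Context: Notation: $[n]=\{1,\dots,n\}$, $[p..q]=\{p,\dots,q\}$; $Xi=X\cup\{i\}$, $Xij=X\cup\{i,j\}$ etc. $\Delta_n^{m',m}=\{S\subseteq[n]:m'\le|S|\le m\}$. $\mathcal I_n^h$ is the set of $h$-element intervals $[p..q]$ of $[n]$ ($\mathcal I_n^0=\{\emptyset\}$); $\mathcal S_n^{h}$ is the set of $h$-element sets $[1..p]\cup[q..r]$ with $p\ge1$, $q\le r$, $q>p+1$. $\mathcal{IS}_n^{m',m}=\mathcal S_n^{m'}\cup\mathcal I_n^{m'}\cup\mathcal I_n^{m'+1}\cup\dots\cup\mathcal I_n^m$. TP-functions on $\Delta_n^{m',m}$: functions $f:\Delta_n^{m',m}\to\mathbb R$ satisfying $f(Xik)+f(Xj)=\max\{f(Xij)+f(Xk),f(Xi)+f(Xjk)\}$ for all $i<j<k$, $X\subseteq[n]\setminus\{i,j,k\}$ for which all six arguments lie in $\Delta_n^{m',m}$, and $f(Xik)+f(Xj\ell)=\max\{f(Xij)+f(Xk\ell),f(Xi\ell)+f(Xjk)\}$ for all $i<j<k<\ell$, $X\subseteq[n]\setminus\{i,j,k,\ell\}$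 for which all six arguments lie in $\Delta_n^{m',m}$. A TP-basis is a $B\subseteq\Delta_n^{m',m}$ for which restriction from TP-functions to $\mathbb R^B$ is bijective; $\mathcal{IS}_n^{m',m}$ is one. Flips on collections in $\Delta_n^{m',m}$: a 3-flip applies when the collection contains $Xi,Xk,Xij,Xjk$ ($i<j<k$, all sets in $\Delta_n^{m',m}$) and exactly one $Y\in\{Xj,Xik\}$, replacing $Y$ by the other member; it is lowering if $Y=Xik$. A 4-flip applies when the collection contains $Xij,Xk\ell,Xi\ell,Xjk$ ($i<j<k<\ell$, all in $\Delta_n^{m',m}$) and exactly one $Y\in\{Xik,Xj\ell\}$, replacing $Y$ by the other; it is lowering if $Y=Xj\ell$, and it is in level $m'$ if $|X|=m'-2$. $\mathcal B_n^{m',m}$ is the set of TP-bases obtained from $\mathcal{IS}_n^{m',m}$ by finite sequences of 3-flips and 4-flips (each of which yields again a TP-basis). Weak separation. $X\prec Y$ means $Y\setminus X\ne\emptyset$ and $i<j$ for all $i\in X\setminus Y$, $j\in Y\setminus X$. $X\rhd Y$ means $Y\setminus X$ has a bipartition $\{Y_1,Y_2\}$ with $Y_1,Y_2,X\setminus Y$ nonempty and $Y_1\prec X\setminus Y\prec Y_2$. $X,Y$ are weakly separated if $X\prec Y$, or $Y\prec X$, or ($X\rhd Y$ and $|X|\ge|Y|$), or ($Y\rhd X$ and $|Y|\ge|X|$). A collection is weakly separated if any two members are. -}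

module Defs where

open import Data.Nat as ℕ using (ℕ; zero; suc)
open import Data.Fin as Fin using (Fin)
open import Data.Fin.Subset
  using (Subset; _∈_; _∉_; _∪_; _∩_; _─_; ⁅_⁆; ∣_∣; Nonempty; inside; outside)
  renaming (⊥ to ∅)
open import Data.Bool using (Bool; true; false)
open import Data.Vec using (_∷_; [])
open import Data.List using (List; []; _∷_; map; _++_; length; filterᵇ)
open import Data.Product using (Σ; ∃; ∃-syntax; _×_; _,_)
open import Data.Sum using (_⊎_)
open import Relation.Binary.PropositionalEquality using (_≡_; _≢_)
open import Relation.Binary.Construct.Closure.ReflexiveTransitive using (Star)
open import Function.Bundles using (_⇔_)

-- Ground set [n] is modelled by Fin n = {0,…,n-1} (element i ↔ i+1), same order.

InΔ : {n : ℕ} → ℕ → ℕ → Subset n → Set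
InΔ m' m S = (m' ℕ.≤ ∣ S ∣) × (∣ S ∣ ℕ.≤ m)

-- S is an interval [p..q] (p ≤ q) of [n], or S = ∅ (the unique 0-element interval)
IsInterval : {n : ℕ} → Subset n → Set
IsInterval {n} S =
  (S ≡ ∅) ⊎
  (Σ (Fin n) λ p → Σ (Fin n) λ q → (p Fin.≤ q) ×
     ((i : Fin n) → (i ∈ S) ⇔ ((p Fin.≤ i) × (i Fin.≤ q))))

-- S = [1..p] ∪ [q..r] with p ≥ 1, q ≤ r, q > p+1 (0-indexed: {i ≤ p} ∪ [q..r], q > p+1)
IsSsplit : {n : ℕ} → Subset n → Set
IsSsplit {n} S =
  Σ (Fin n) λ p → Σ (Fin n) λ q → Σ (Fin n) λ r →
    (q Fin.≤ r) × (suc (suc (Fin.toℕ p)) ℕ.≤ Fin.toℕ q) ×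
    ((i : Fin n) → (i ∈ S) ⇔ ((i Fin.≤ p) ⊎ ((q Fin.≤ i) × (i Fin.≤ r))))

InIS : {n : ℕ} → ℕ → ℕ → Subset n → Set
InIS m' m S =
  (IsSsplit S × ∣ S ∣ ≡ m') ⊎ (IsInterval S × InΔ m' m S)

Collection : ℕ → Set
Collection n = Subset n → Bool

allSubsets : (n : ℕ) → List (Subset n)
allSubsets zero = [] ∷ []
allSubsets (suc n) =
  map (inside ∷_) (allSubsets n) ++ map (outside ∷_) (allSubsets n)

card : {n : ℕ} → Collection n → ℕ
card {n} C = length (filterᵇ C (allSubsets n))

InsideΔ : {n : ℕ} → ℕ → ℕ → Collection n → Set
InsideΔ m' m C = ∀ S → C S ≡ true → InΔ m' m S

IsIS : {n : ℕ} → ℕ → ℕ → Collection n → Set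
IsIS m' m C = ∀ S → (C S ≡ true) ⇔ InIS m' m S

_≺_ : {n : ℕ} → Subset n → Subset n → Set
_≺_ {n} X Y =
  Nonempty (Y ─ X) ×
  ((i j : Fin n) → i ∈ (X ─ Y) → j ∈ (Y ─ X) → i Fin.< j)

_▷_ : {n : ℕ} → Subset n → Subset n → Set
_▷_ {n} X Y =
  Σ (Subset n) λ Y₁ → Σ (Subset n) λ Y₂ →
    (Y₁ ∪ Y₂ ≡ Y ─ X) × (Y₁ ∩ Y₂ ≡ ∅) ×
    Nonempty Y₁ × Nonempty Y₂ × Nonempty (X ─ Y) ×
    (Y₁ ≺ (X ─ Y)) × ((X ─ Y) ≺ Y₂)

WeaklySeparated : {n : ℕ} → Subset n → Subset n → Set
WeaklySeparated X Y =
  (X ≺ Y) ⊎ (Y ≺ X) ⊎ ((X ▷ Y) × (∣ Y ∣ ℕ.≤ ∣ X ∣)) ⊎ ((Y ▷ X) × (∣ X ∣ ℕ.≤ ∣ Y ∣))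

WSCollection : {n : ℕ} → Collection n → Set
WSCollection C =
  ∀ X Y → C X ≡ true → C Y ≡ true → X ≢ Y → WeaklySeparated X Y

MaxWS : {n : ℕ} → ℕ → ℕ → Collection n → Set
MaxWS {n} m' m C =
  InsideΔ m' m C × WSCollection C ×
  ((D : Collection n) → InsideΔ m' m D → WSCollection D → card D ℕ.≤ card C)

Swap : {n : ℕ} → Collection n → Collection n → Subset n → Subset n → Set
Swap C D Y Y' =
  (C Y ≡ true) × (C Y' ≡ false) × (D Y ≡ false) × (D Y' ≡ true) ×
  (∀ S → S ≢ Y → S ≢ Y' → D S ≡ C S)

Lower3 : {n : ℕ} → ℕ → ℕ → Collection n → Collection n → Set
Lower3 {n} m' m C D =
  Σ (Fin n) λ i → Σ (Fin n) λ j → Σ (Fin n) λ k → Σ (Subset n) λ X →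
    (i Fin.< j) × (j Fin.< k) × (i ∉ X) × (j ∉ X) × (k ∉ X) ×
    let Xi = X ∪ ⁅ i ⁆ ; Xj = X ∪ ⁅ j ⁆ ; Xk = X ∪ ⁅ k ⁆
        Xij = Xi ∪ ⁅ j ⁆ ; Xjk = Xj ∪ ⁅ k ⁆ ; Xik = Xi ∪ ⁅ k ⁆ in
    InΔ m' m Xi × InΔ m' m Xj × InΔ m' m Xk ×
    InΔ m' m Xij × InΔ m' m Xjk × InΔ m' m Xik ×
    (C Xi ≡ true) × (C Xk ≡ true) × (C Xij ≡ true) × (C Xjk ≡ true) ×
    Swap C D Xik Xj

Lower4With : {n : ℕ} → ℕ → ℕ → (ℕ → Set) → Collection n → Collection n → Set
Lower4With {n} m' m Lvl C D =
  Σ (Fin n) λ i → Σ (Fin n) λ j → Σ (Fin n) λ k → Σ (Fin n) λ l → Σ (Subset n) λ X →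
    (i Fin.< j) × (j Fin.< k) × (k Fin.< l) ×
    (i ∉ X) × (j ∉ X) × (k ∉ X) × (l ∉ X) × Lvl ∣ X ∣ ×
    let Xij = X ∪ ⁅ i ⁆ ∪ ⁅ j ⁆ ; Xkl = X ∪ ⁅ k ⁆ ∪ ⁅ l ⁆
        Xil = X ∪ ⁅ i ⁆ ∪ ⁅ l ⁆ ; Xjk = X ∪ ⁅ j ⁆ ∪ ⁅ k ⁆
        Xik = X ∪ ⁅ i ⁆ ∪ ⁅ k ⁆ ; Xjl = X ∪ ⁅ j ⁆ ∪ ⁅ l ⁆ in
    InΔ m' m Xij × InΔ m' m Xkl × InΔ m' m Xil ×
    InΔ m' m Xjk × InΔ m' m Xik × InΔ m' m Xjl ×
    (C Xij ≡ true) × (C Xkl ≡ true) × (C Xil ≡ true) × (C Xjk ≡ true) ×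
    Swap C D Xjl Xik

Lower4 : {n : ℕ} → ℕ → ℕ → Collection n → Collection n → Set
Lower4 m' m = Lower4With m' m (λ _ → Data.Unit.⊤)
  where import Data.Unit

Lower4Level : {n : ℕ} → ℕ → ℕ → Collection n → Collection n → Set
Lower4Level m' m = Lower4With m' m (λ x → suc (suc x) ≡ m')

Flip : {n : ℕ} → ℕ → ℕ → Collection n → Collection n → Set
Flip m' m C D =
  Lower3 m' m C D ⊎ Lower3 m' m D C ⊎ Lower4 m' m C D ⊎ Lower4 m' m D C

InB : {n : ℕ} → ℕ → ℕ → Collection n → Set
InB {n} m' m C =
  Σ (Collection n) λ C₀ → IsIS m' m C₀ × Star (Flip m' m) C₀ C

{-# OPTIONS --safe #-}
module Submission where

-- Contract the first element of a weakly separated C: with L, R the members without and with that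
-- element (the latter stripped of it), L ∪ R is again weakly separated, and L ∩ R has at most one set
-- of each size, because a set of R precedes every set of L that is not larger.  Hence
-- |C| ≤ N n = n(n+1)/2 + 1, and if equality holds ("full"), then L ∪ R is full and L ∩ R is a path
-- with one vertex of each size.  By induction along contractions a full collection has the local
-- structure of a planar tiling; the fact needed is `horizontal`: if Xa, Xb ∈ C, then below that edge
-- lies the apex X or a polygon with a further vertex.
--
-- A maximum C in Δ becomes full on adding the intervals above level m and the cointervals below
-- level m′.  Let h > m′ be the top level with a non-interval.  Walking to the right along the lower
-- boundary of level h, `horizontal` turns every corner Wi, Wij, Wik, Wjk that lacks Wk into a corner
-- further to the right, so some corner has Wk and is a lowering 3-flip.  When the levels above m′
-- consist of intervals, dropping the first element identifies level m′ of [n] with levels m′ - 1, m′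
-- of [n - 1] and 4-flips with 3-flips, and one recurses.
--
-- Padding a set by elements beyond n turns weak separation into noncrossing of equicardinal sets, and
-- a 3-flip into a 4-flip whose largest element is padding; so both kinds preserve separation.

open import Defs
open import Data.Bool using (Bool; true; false; _∧_; _∨_; not; if_then_else_) renaming (_≟_ to _≟ᵇ_)
open import Data.Bool.Properties using (T-≡; ∨-zeroʳ; ∨-identityʳ)
open import Data.Empty using (⊥; ⊥-elim)
open import Data.Fin using (Fin; zero; suc; toℕ; _<_; fromℕ<)
open import Data.Fin.Properties using (<-trans; <-irrefl; <-asym; <-cmp; <⇒≢; toℕ-injective; toℕ-fromℕ<; toℕ<n) renaming (_≟_ to _≟ᶠ_)
open import Data.Fin.Subset using (Subset; ∣_∣; inside; outside; _∈_; _∉_; _─_; _∪_; _∩_; ⁅_⁆) renaming (⊥ to ∅)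
open import Data.Fin.Subset.Properties using (∣p∣≤n; ∉⊥; x∈p∪q⁻; x∈p∪q⁺; x∈p∩q⁻; x∈p∩q⁺; ∪-assoc; ∪-identityʳ)
open import Data.List using (length; filterᵇ; map; _++_) renaming ([] to []ˡ; _∷_ to _∷ˡ_)
import Data.Nat as ℕ
open import Data.Nat using (ℕ; zero; suc; _+_; _≤_; z≤n; s≤s; _≤ᵇ_; _≡ᵇ_; _<ᵇ_)
import Data.Nat.Properties as ℕₚ
open import Data.Nat.Solver using (module +-*-Solver)
open import Data.Product using (Σ; ∃; _×_; _,_; proj₁; proj₂)
open import Data.Sum using (_⊎_; inj₁; inj₂)
open import Data.Vec using ([]; _∷_; here; there; lookup; _[_]=_; _[_]≔_)
open import Data.Vec.Properties using (≡-dec; []≔-updates; []≔-minimal; []=-injective; []=⇒lookup; lookup⇒[]=; lookup∘updateAt′)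
open import Function using (_∘_; case_of_)
open import Function.Bundles using (_⇔_; mk⇔; Equivalence)
open import Relation.Binary.Construct.Closure.ReflexiveTransitive using (Star; ε; _◅_; _◅◅_; gmap) renaming (map to map*; reverse to reverse*)
open import Relation.Binary.Definitions using (tri<; tri≈; tri>)
open import Relation.Binary.PropositionalEquality using (_≡_; _≢_; refl; sym; trans; cong; cong₂; subst; subst₂; ≢-sym)
open import Relation.Nullary using (Dec; yes; no)

-- In a full collection the path is a cut: on each level the sets of `R` stand before those of `L`
-- in the order `⊴`, and the path vertex of that size stands between them. An answer found in the
-- contraction can fail to lift only because the set it names lies on the wrong side of this cut.
-- Then a path vertex is squeezed between two known neighbouring sets, which leaves few shapes for
-- it, and each of them leads to an answer or contradicts separation. The bound N is useful because
-- it is attained: `J k` is full for every k. Comparing C with the part of `J m′` inside Δ shows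
-- that a maximum C has a full completion, so the theory of full collections covers all bounds m′
-- and m at once. Two measures end the search: the sum of positions of a corner grows along a walk,
-- and the sum of all sizes drops with each lowering 3-flip.

private
  variable
    n m′ m : ℕ
    S T U V W X Y Z q r : Subset n
    a b c d i j k l x y : Fin n

-- Elements, sizes and exchange in finite sets

infix 4 _∋_ _∌_ _∈ᶜ_ _⊴_ _⊑_
infixl 8 _⊕_ _⊖_

_∋_ _∌_ : Subset n → Fin n → Set
S ∋ i = S [ i ]= true
S ∌ i = S [ i ]= false

_⊕_ _⊖_ : Subset n → Fin n → Subset n
S ⊕ i = S [ i ]≔ true
S ⊖ i = S [ i ]≔ false

_∈ᶜ_ : Subset n → Collection n → Set
S ∈ᶜ C = C S ≡ true

Diff : Subset n → Subset n → Fin n → Set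
Diff X Y i = X ∋ i × Y ∌ i

_⊑_ : Subset n → Subset n → Set
A ⊑ B = ∀ {i} → A ∋ i → B ∋ i

_⊴_ : Subset n → Subset n → Set
W ⊴ Z = ∀ {i j} → Diff W Z i → Diff Z W j → i < j

∋∌ : S ∋ i → S ∌ i → ⊥
∋∌ p q = case []=-injective p q of λ ()

mem? : (S : Subset n) (i : Fin n) → S ∋ i ⊎ S ∌ i
mem? (true ∷ S) zero = inj₁ here
mem? (false ∷ S) zero = inj₂ here
mem? (x ∷ S) (suc i) with mem? S i
... | inj₁ p = inj₁ (there p)
... | inj₂ p = inj₂ (there p)

⊕-here : (S : Subset n) (i : Fin n) → S ⊕ i ∋ i
⊕-here S i = []≔-updates S i

⊖-here : (S : Subset n) (i : Fin n) → S ⊖ i ∌ i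
⊖-here S i = []≔-updates S i

⊕-∋ : ∀ i → S ∋ j → S ⊕ i ∋ j
⊕-∋ {S = S} {j} i p with j ≟ᶠ i
... | yes refl = ⊕-here S i
... | no j≢i   = []≔-minimal S j i j≢i p

⊖-∌ : ∀ i → S ∌ j → S ⊖ i ∌ j
⊖-∌ {S = S} {j} i p with j ≟ᶠ i
... | yes refl = ⊖-here S i
... | no j≢i   = []≔-minimal S j i j≢i p

⊕-∌ : j ≢ i → S ∌ j → S ⊕ i ∌ j
⊕-∌ {S = S} j≢i p = []≔-minimal S _ _ j≢i p

⊖-∋ : j ≢ i → S ∋ j → S ⊖ i ∋ j
⊖-∋ {S = S} j≢i p = []≔-minimal S _ _ j≢i p

∋-≢ : S ∋ i → S ∌ j → i ≢ j
∋-≢ p q refl = ∋∌ p q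

∌-≢ : S ∌ i → S ∋ j → i ≢ j
∌-≢ p q refl = ∋∌ q p

⊕-∋⁻ : S ⊕ i ∋ j → j ≡ i ⊎ S ∋ j
⊕-∋⁻ {S = S} {i} {j} p with j ≟ᶠ i
... | yes e  = inj₁ e
... | no j≢i with mem? S j
...   | inj₁ q = inj₂ q
...   | inj₂ q = ⊥-elim (∋∌ p (⊕-∌ j≢i q))

⊕-∌⁻ : S ⊕ i ∌ j → S ∌ j
⊕-∌⁻ {S = S} {i} {j} p with mem? S j
... | inj₁ q = ⊥-elim (∋∌ (⊕-∋ i q) p)
... | inj₂ q = q

⊖-∋⁻ : S ⊖ i ∋ j → S ∋ j
⊖-∋⁻ {S = S} {i} {j} p with mem? S j
... | inj₁ q = q
... | inj₂ q = ⊥-elim (∋∌ p (⊖-∌ i q))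

⊑-tail : ∀ {a b} → (a ∷ X) ⊑ (b ∷ Y) → X ⊑ Y
⊑-tail f p = case f (there p) of λ { (there q) → q }

⊑-antisym : X ⊑ Y → Y ⊑ X → X ≡ Y
⊑-antisym {X = []} {[]} f g = refl
⊑-antisym {X = a ∷ A} {b ∷ B} f g = cong₂ _∷_ (hd a b f g) (⊑-antisym (⊑-tail f) (⊑-tail g))
  where
  hd : ∀ a b → (a ∷ A) ⊑ (b ∷ B) → (b ∷ B) ⊑ (a ∷ A) → a ≡ b
  hd true true f g = refl
  hd false false f g = refl
  hd true false f g = case f here of λ ()
  hd false true f g = case g here of λ ()

⊖-⊕ : S ∋ i → S ⊖ i ⊕ i ≡ S
⊖-⊕ here = refl
⊖-⊕ (there p) = cong (_ ∷_) (⊖-⊕ p)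

⊕-⊖ : S ∌ i → S ⊕ i ⊖ i ≡ S
⊕-⊖ here = refl
⊕-⊖ (there p) = cong (_ ∷_) (⊕-⊖ p)

⊕-comm : ∀ (S : Subset n) i j → S ⊕ i ⊕ j ≡ S ⊕ j ⊕ i
⊕-comm (x ∷ S) zero zero = refl
⊕-comm (x ∷ S) zero (suc j) = refl
⊕-comm (x ∷ S) (suc i) zero = refl
⊕-comm (x ∷ S) (suc i) (suc j) = cong (x ∷_) (⊕-comm S i j)

⊖-⊕-comm : ∀ (S : Subset n) {i j} → i ≢ j → S ⊖ i ⊕ j ≡ S ⊕ j ⊖ i
⊖-⊕-comm (x ∷ S) {zero} {zero} i≢j = ⊥-elim (i≢j refl)
⊖-⊕-comm (x ∷ S) {zero} {suc j} i≢j = refl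
⊖-⊕-comm (x ∷ S) {suc i} {zero} i≢j = refl
⊖-⊕-comm (x ∷ S) {suc i} {suc j} i≢j = cong (x ∷_) (⊖-⊕-comm S (i≢j ∘ cong suc))

size-⊕ : S ∌ i → ∣ S ⊕ i ∣ ≡ suc ∣ S ∣
size-⊕ here = refl
size-⊕ {S = true ∷ S} (there p) = cong suc (size-⊕ p)
size-⊕ {S = false ∷ S} (there p) = size-⊕ p

size-⊖ : S ∋ i → suc ∣ S ⊖ i ∣ ≡ ∣ S ∣
size-⊖ here = refl
size-⊖ {S = true ∷ S} (there p) = cong suc (size-⊖ p)
size-⊖ {S = false ∷ S} (there p) = size-⊖ p

diff? : (A B : Subset n) → ∃ (Diff A B) ⊎ A ⊑ B
diff? [] [] = inj₂ λ ()
diff? (a ∷ A) (b ∷ B) with diff? A B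
... | inj₁ (i , p , q) = inj₁ (suc i , there p , there q)
diff? (true ∷ A) (true ∷ B)   | inj₂ f = inj₂ λ { here → here ; (there p) → there (f p) }
diff? (true ∷ A) (false ∷ B)  | inj₂ f = inj₁ (zero , here , here)
diff? (false ∷ A) (b ∷ B)     | inj₂ f = inj₂ λ { (there p) → there (f p) }

⊑-size : X ⊑ Y → ∣ X ∣ ≤ ∣ Y ∣
⊑-size {X = []} {[]} f = z≤n
⊑-size {X = true ∷ A} {true ∷ B} f = s≤s (⊑-size (⊑-tail f))
⊑-size {X = true ∷ A} {false ∷ B} f = case f here of λ ()
⊑-size {X = false ∷ A} {true ∷ B} f = ℕₚ.m≤n⇒m≤1+n (⊑-size (⊑-tail f))
⊑-size {X = false ∷ A} {false ∷ B} f = ⊑-size (⊑-tail f)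

⊑-size-≡ : X ⊑ Y → ∣ Y ∣ ≤ ∣ X ∣ → X ≡ Y
⊑-size-≡ {X = []} {[]} f le = refl
⊑-size-≡ {X = true ∷ A} {true ∷ B} f (s≤s le) = cong (true ∷_) (⊑-size-≡ (⊑-tail f) le)
⊑-size-≡ {X = true ∷ A} {false ∷ B} f le = case f here of λ ()
⊑-size-≡ {X = false ∷ A} {true ∷ B} f le = ⊥-elim (ℕₚ.<⇒≱ le (⊑-size (⊑-tail f)))
⊑-size-≡ {X = false ∷ A} {false ∷ B} f le = cong (false ∷_) (⊑-size-≡ (⊑-tail f) le)

larger-diff : (A B : Subset n) → ∣ A ∣ ℕ.< ∣ B ∣ → ∃ (Diff B A)
larger-diff A B lt with diff? B A
... | inj₁ d = d
... | inj₂ f = ⊥-elim (ℕₚ.<⇒≱ lt (⊑-size f))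

exchange : ∣ X ∣ ≤ ∣ Y ∣ → Diff X Y i → ∃ (Diff Y X)
exchange {X = A} {B} le (p , q) with diff? B A
... | inj₁ d = d
... | inj₂ f with ⊑-size-≡ f le
... | refl = ⊥-elim (∋∌ p q)

⊑-⊕ : X ⊑ Y → Y ∋ i → X ⊕ i ⊑ Y
⊑-⊕ f p q with ⊕-∋⁻ q
... | inj₁ refl = p
... | inj₂ r = f r

cover : X ⊑ Y → ∣ Y ∣ ≡ suc ∣ X ∣ → ∃ λ b → X ∌ b × Y ≡ X ⊕ b
cover {X = A} {B} f e with larger-diff A B (ℕₚ.≤-reflexive (sym e))
... | b , p , q = b , q , sym (⊑-size-≡ (⊑-⊕ f p) (ℕₚ.≤-reflexive (trans e (sym (size-⊕ q)))))

cocover : X ⊑ Y → ∣ Y ∣ ≡ suc ∣ X ∣ → ∃ λ b → Y ∋ b × X ≡ Y ⊖ b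
cocover {X = A} f e with cover f e
... | b , q , refl = b , ⊕-here A b , sym (⊕-⊖ q)

size0 : ∣ X ∣ ≡ 0 → ∣ Y ∣ ≡ 0 → X ≡ Y
size0 {X = []} {[]} p q = refl
size0 {X = false ∷ A} {false ∷ B} p q = cong (false ∷_) (size0 p q)

full-∋ : ∀ {A : Subset n} → ∣ A ∣ ≡ n → ∀ i → A ∋ i
full-∋ {A = true ∷ A} e zero = here
full-∋ {A = true ∷ A} e (suc i) = there (full-∋ (ℕₚ.suc-injective e) i)
full-∋ {A = false ∷ A} e i = ⊥-elim (ℕₚ.<-irrefl e (s≤s (∣p∣≤n A)))

-- Weak separation, stated through the alternating patterns it forbids.

NoAlt3 NoAlt4 : Subset n → Subset n → Set
NoAlt3 X Y = ∀ {a b c} → a < b → b < c → Diff X Y a → Diff Y X b → Diff X Y c → ⊥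
NoAlt4 X Y = ∀ {a b c d} → a < b → b < c → c < d →
  Diff X Y a → Diff Y X b → Diff X Y c → Diff Y X d → ⊥

-- This form, unlike the definition by bipartitions, passes at once to sets with a common first
-- element removed or added (`Sep-tail`, `Sep-cons`), and it holds between a set and itself. For
-- equal sizes only the two four-term conditions remain.
record Sep (X Y : Subset n) : Set where
  constructor sep
  field
    no4  : NoAlt4 X Y
    no4′ : NoAlt4 Y X
    no3  : ∣ Y ∣ ℕ.< ∣ X ∣ → NoAlt3 X Y
    no3′ : ∣ X ∣ ℕ.< ∣ Y ∣ → NoAlt3 Y X
open Sep public

Sep-sym : Sep X Y → Sep Y X
Sep-sym (sep a b c d) = sep b a d c

-- Every four-term pattern, whichever set it starts with, contains the excluded three-term one; the
-- size condition makes the opposite three-term requirement vacuous.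
noAlt3⇒sep : NoAlt3 X Y → ∣ Y ∣ ≤ ∣ X ∣ → Sep X Y
noAlt3⇒sep f le = sep (λ a b _ p q r _ → f a b p q r) (λ _ b c _ q r s → f b c q r s)
                      (λ _ → f) (λ lt → ⊥-elim (ℕₚ.<⇒≱ lt le))

Sep-refl : Sep X X
Sep-refl = noAlt3⇒sep (λ _ _ p _ _ → ∋∌ (proj₁ p) (proj₂ p)) ℕₚ.≤-refl

Separated : Collection n → Set
Separated C = ∀ {X Y} → X ∈ᶜ C → Y ∈ᶜ C → Sep X Y

infix 4 _≐_
_≐_ : Collection n → Collection n → Set
C ≐ D = ∀ S → C S ≡ D S

_≟ˢ_ : (S T : Subset n) → Dec (S ≡ T)
_≟ˢ_ = ≡-dec _≟ᵇ_

∧-true : ∀ {a b} → a ∧ b ≡ true → a ≡ true × b ≡ true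
∧-true {true} {true} p = refl , refl

∧-intro : ∀ {a b} → a ≡ true → b ≡ true → a ∧ b ≡ true
∧-intro refl refl = refl

∨-true : ∀ {a b} → a ∨ b ≡ true → a ≡ true ⊎ b ≡ true
∨-true {true} p = inj₁ refl
∨-true {false} p = inj₂ p

∨-introˡ : ∀ {a} b → a ≡ true → a ∨ b ≡ true
∨-introˡ b refl = refl

∨-introʳ : ∀ a {b} → b ≡ true → a ∨ b ≡ true
∨-introʳ true refl = refl
∨-introʳ false refl = refl

≡true⇔ : ∀ {a b} → (a ≡ true → b ≡ true) → (b ≡ true → a ≡ true) → a ≡ b
≡true⇔ {true} {true} f g = refl
≡true⇔ {false} {false} f g = refl
≡true⇔ {true} {false} f g = sym (f refl)
≡true⇔ {false} {true} f g = g refl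

¬true⇒false : ∀ {a} → (a ≡ true → ⊥) → a ≡ false
¬true⇒false {false} f = refl
¬true⇒false {true} f = ⊥-elim (f refl)

true≢false : ∀ {b} → b ≡ true → b ≡ false → ⊥
true≢false refl ()

-- Counting

-- Recursion over the first element, instead of the list behind `card`, makes counts split the way
-- contraction does. With `∣_∣` as the weight it is the measure that a lowering 3-flip decreases.
weight : (Subset n → ℕ) → Collection n → ℕ
weight {zero} f C = if C [] then f [] else 0
weight {suc n} f C = weight (f ∘ (inside ∷_)) (C ∘ (inside ∷_)) + weight (f ∘ (outside ∷_)) (C ∘ (outside ∷_))

# : Collection n → ℕ
# = weight (λ _ → 1)

weight-cong : ∀ {n} (f : Subset n → ℕ) {C D : Collection n} → C ≐ D → weight f C ≡ weight f D
weight-cong {zero} f e rewrite e [] = refl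
weight-cong {suc n} f e = cong₂ _+_ (weight-cong _ (e ∘ (inside ∷_))) (weight-cong _ (e ∘ (outside ∷_)))

card≡# : (C : Collection n) → card C ≡ # C
card≡# {n} C = go n C
  where
  filter-map : ∀ {A B : Set} (p : B → Bool) (g : A → B) xs →
    length (filterᵇ p (map g xs)) ≡ length (filterᵇ (p ∘ g) xs)
  filter-map p g []ˡ = refl
  filter-map p g (x ∷ˡ xs) with p (g x)
  ... | true = cong suc (filter-map p g xs)
  ... | false = filter-map p g xs
  filter-++ : ∀ {A : Set} (p : A → Bool) xs ys →
    length (filterᵇ p (xs ++ ys)) ≡ length (filterᵇ p xs) + length (filterᵇ p ys)
  filter-++ p []ˡ ys = refl
  filter-++ p (x ∷ˡ xs) ys with p x
  ... | true = cong suc (filter-++ p xs ys)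
  ... | false = filter-++ p xs ys
  go : ∀ n (C : Collection n) → length (filterᵇ C (allSubsets n)) ≡ # C
  go zero C with C []
  ... | true = refl
  ... | false = refl
  go (suc n) C = trans (filter-++ C (map (inside ∷_) (allSubsets n)) (map (outside ∷_) (allSubsets n)))
    (cong₂ _+_ (trans (filter-map C (inside ∷_) (allSubsets n)) (go n _))
               (trans (filter-map C (outside ∷_) (allSubsets n)) (go n _)))

private
  interchange : ∀ a b c d → (a + b) + (c + d) ≡ (a + c) + (b + d)
  interchange = solve 4 (λ a b c d → (a :+ b) :+ (c :+ d) := (a :+ c) :+ (b :+ d)) refl
    where open +-*-Solver

#-∨-∧ : (A B : Collection n) → # A + # B ≡ # (λ S → A S ∨ B S) + # (λ S → A S ∧ B S)
#-∨-∧ {zero} A B with A [] | B []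
... | true | true = refl
... | true | false = refl
... | false | true = refl
... | false | false = refl
#-∨-∧ {suc n} A B = trans (interchange (# Aᵢ) (# Aₒ) (# Bᵢ) (# Bₒ))
  (trans (cong₂ _+_ (#-∨-∧ Aᵢ Bᵢ) (#-∨-∧ Aₒ Bₒ))
         (interchange (# (λ S → Aᵢ S ∨ Bᵢ S)) (# (λ S → Aᵢ S ∧ Bᵢ S)) (# (λ S → Aₒ S ∨ Bₒ S)) (# (λ S → Aₒ S ∧ Bₒ S))))
  where
  Aᵢ = A ∘ (inside ∷_)
  Aₒ = A ∘ (outside ∷_)
  Bᵢ = B ∘ (inside ∷_)
  Bₒ = B ∘ (outside ∷_)

#-mono : {A B : Collection n} → (∀ S → S ∈ᶜ A → S ∈ᶜ B) → # A ≤ # B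
#-mono {zero} {A} {B} f with A [] | B [] | f []
... | true | true | _ = s≤s z≤n
... | true | false | g = case g refl of λ ()
... | false | _ | _ = z≤n
#-mono {suc n} f = ℕₚ.+-mono-≤ (#-mono (f ∘ (inside ∷_))) (#-mono (f ∘ (outside ∷_)))

find : (C : Collection n) → (∃ λ S → S ∈ᶜ C) ⊎ (∀ S → C S ≡ false)
find {zero} C with C [] in eq
... | true = inj₁ ([] , eq)
... | false = inj₂ λ { [] → eq }
find {suc n} C with find (C ∘ (inside ∷_))
... | inj₁ (S , p) = inj₁ (inside ∷ S , p)
... | inj₂ f with find (C ∘ (outside ∷_))
...   | inj₁ (S , p) = inj₁ (outside ∷ S , p)
...   | inj₂ g = inj₂ λ { (true ∷ S) → f S ; (false ∷ S) → g S }

#-none : {C : Collection n} → (∀ S → C S ≡ false) → # C ≡ 0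
#-none {zero} e rewrite e [] = refl
#-none {suc n} e = cong₂ _+_ (#-none (e ∘ (inside ∷_))) (#-none (e ∘ (outside ∷_)))

#-some : (C : Collection n) → S ∈ᶜ C → 1 ≤ # C
#-some {zero} {[]} C p rewrite p = s≤s z≤n
#-some {suc n} {true ∷ S} C p = ℕₚ.≤-trans (#-some (C ∘ (inside ∷_)) p) (ℕₚ.m≤m+n _ _)
#-some {suc n} {false ∷ S} C p = ℕₚ.≤-trans (#-some (C ∘ (outside ∷_)) p) (ℕₚ.m≤n+m _ _)

#-unique : (C : Collection n) → (∀ {S T} → S ∈ᶜ C → T ∈ᶜ C → S ≡ T) → # C ≤ 1
#-unique {zero} C u with C []
... | true = s≤s z≤n
... | false = z≤n
#-unique {suc n} C u with find (C ∘ (inside ∷_))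
... | inj₁ (S , p) = subst (_≤ 1)
      (trans (sym (ℕₚ.+-identityʳ _)) (cong (# (C ∘ (inside ∷_)) +_)
        (sym (#-none {C = C ∘ (outside ∷_)} λ T → ¬true⇒false λ q → case u p q of λ ()))))
      (#-unique (C ∘ (inside ∷_)) λ q r → case u q r of λ { refl → refl })
... | inj₂ f rewrite #-none {C = C ∘ (inside ∷_)} f =
      #-unique (C ∘ (outside ∷_)) λ q r → case u q r of λ { refl → refl }

#-restrict : (C P : Collection n) → # C ≡ # (λ S → C S ∧ P S) + # (λ S → C S ∧ not (P S))
#-restrict {zero} C P with C [] | P []
... | true | true = refl
... | true | false = refl
... | false | _ = refl
#-restrict {suc n} C P = trans (cong₂ _+_ (#-restrict (C ∘ (inside ∷_)) (P ∘ (inside ∷_))) (#-restrict (C ∘ (outside ∷_)) (P ∘ (outside ∷_))))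
  (interchange (# (λ S → C (inside ∷ S) ∧ P (inside ∷ S))) _ (# (λ S → C (outside ∷ S) ∧ P (outside ∷ S))) _)

weight-remove : ∀ {n} (f : Subset n → ℕ) {C D : Collection n} (Y : Subset n) →
  Y ∈ᶜ C → D Y ≡ false → (∀ S → S ≢ Y → D S ≡ C S) → weight f C ≡ f Y + weight f D
weight-remove {zero} f [] p q e rewrite p | q = sym (ℕₚ.+-identityʳ _)
weight-remove {suc n} f {C} {D} (true ∷ Y) p q e = trans
  (cong₂ _+_ (weight-remove (f ∘ (inside ∷_)) Y p q λ S S≢Y → e (inside ∷ S) λ { refl → S≢Y refl })
             (weight-cong (f ∘ (outside ∷_)) {C ∘ (outside ∷_)} λ S → sym (e (outside ∷ S) λ ())))
  (ℕₚ.+-assoc (f (true ∷ Y)) _ _)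
weight-remove {suc n} f {C} {D} (false ∷ Y) p q e = trans
  (cong₂ _+_ (weight-cong (f ∘ (inside ∷_)) {C ∘ (inside ∷_)} λ S → sym (e (inside ∷ S) λ ()))
             (weight-remove (f ∘ (outside ∷_)) Y p q λ S S≢Y → e (outside ∷ S) λ { refl → S≢Y refl }))
  (lemma (weight (f ∘ (inside ∷_)) (D ∘ (inside ∷_))) (f (false ∷ Y)) _)
  where
  lemma : ∀ a b c → a + (b + c) ≡ b + (a + c)
  lemma = solve 3 (λ a b c → a :+ (b :+ c) := b :+ (a :+ c)) refl
    where open +-*-Solver

remove : Subset n → Collection n → Collection n
remove Y C S with S ≟ˢ Y
... | yes _ = false
... | no _ = C S

remove-here : (Y : Subset n) (C : Collection n) → remove Y C Y ≡ false
remove-here Y C with Y ≟ˢ Y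
... | yes _ = refl
... | no ne = ⊥-elim (ne refl)

remove-there : (Y : Subset n) (C : Collection n) → S ≢ Y → remove Y C S ≡ C S
remove-there {S = S} Y C ne with S ≟ˢ Y
... | yes e = ⊥-elim (ne e)
... | no _ = refl

-- Both collections arise from a common one by adding a single set, `Y` or `Y′`. Constant weight 1
-- gives equal cardinalities, weight `∣_∣` the drop in total size.
weight-swap : ∀ {n} (f : Subset n → ℕ) {C D : Collection n} {Y Y′} → Swap C D Y Y′ →
  weight f C + f Y′ ≡ weight f D + f Y
weight-swap f {C} {D} {Y} {Y′} (CY , CY′ , DY , DY′ , e) = trans
  (cong (_+ f Y′) (weight-remove f {C} {E} Y CY (remove-here Y C) λ S → remove-there Y C))
  (trans (lemma (f Y) (weight f E) (f Y′))
    (cong (_+ f Y) (sym (weight-remove f {D} {E} Y′ DY′ (trans (remove-there Y C λ { refl → true≢false CY CY′ }) CY′) off))))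
  where
  E = remove Y C
  lemma : ∀ a b c → a + b + c ≡ c + b + a
  lemma = solve 3 (λ a b c → a :+ b :+ c := c :+ b :+ a) refl
    where open +-*-Solver
  off : ∀ S → S ≢ Y′ → E S ≡ D S
  off S S≢Y′ with S ≟ˢ Y
  ... | yes refl = sym DY
  ... | no S≢Y = sym (e S S≢Y S≢Y′)

level below : Collection n → ℕ → Collection n
level D k S = D S ∧ (∣ S ∣ ≡ᵇ k)
below D k S = D S ∧ (∣ S ∣ <ᵇ k)

≡ᵇ-true : ∀ {a b} → (a ≡ᵇ b) ≡ true → a ≡ b
≡ᵇ-true {a} {b} p = ℕₚ.≡ᵇ⇒≡ a b (Equivalence.from T-≡ p)

≡ᵇ-refl : ∀ a → (a ≡ᵇ a) ≡ true
≡ᵇ-refl a = Equivalence.to T-≡ (ℕₚ.≡⇒≡ᵇ a a refl)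

<ᵇ-true : ∀ {a b} → (a <ᵇ b) ≡ true → a ℕ.< b
<ᵇ-true {a} {b} p = ℕₚ.<ᵇ⇒< a b (Equivalence.from T-≡ p)

true-<ᵇ : ∀ {a b} → a ℕ.< b → (a <ᵇ b) ≡ true
true-<ᵇ p = Equivalence.to T-≡ (ℕₚ.<⇒<ᵇ p)

level-∈ : (D : Collection n) → S ∈ᶜ D → S ∈ᶜ level D ∣ S ∣
level-∈ {S = S} D p = ∧-intro p (≡ᵇ-refl ∣ S ∣)

#-below-suc : (D : Collection n) (k : ℕ) → # (below D (suc k)) ≡ # (below D k) + # (level D k)
#-below-suc D k = trans (#-restrict (below D (suc k)) (λ S → ∣ S ∣ <ᵇ k))
  (cong₂ _+_ (weight-cong _ e₁) (weight-cong _ e₂))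
  where
  e₁ : (λ S → below D (suc k) S ∧ (∣ S ∣ <ᵇ k)) ≐ below D k
  e₁ S with D S | ∣ S ∣ <ᵇ suc k in eq₁ | ∣ S ∣ <ᵇ k in eq₂
  ... | false | _ | _ = refl
  ... | true | true | _ = refl
  ... | true | false | false = refl
  ... | true | false | true = ⊥-elim (true≢false (true-<ᵇ {∣ S ∣} (ℕₚ.m≤n⇒m≤1+n (<ᵇ-true {∣ S ∣} {k} eq₂))) eq₁)
  e₂ : (λ S → below D (suc k) S ∧ not (∣ S ∣ <ᵇ k)) ≐ level D k
  e₂ S with D S | ∣ S ∣ <ᵇ suc k in eq₁ | ∣ S ∣ <ᵇ k in eq₂ | ∣ S ∣ ≡ᵇ k in eq₃
  ... | false | _ | _ | _ = refl
  ... | true | true | true | false = refl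
  ... | true | false | _ | false = refl
  ... | true | true | false | true = refl
  ... | true | true | true | true = ⊥-elim (ℕₚ.<-irrefl (≡ᵇ-true {∣ S ∣} {k} eq₃) (<ᵇ-true {∣ S ∣} {k} eq₂))
  ... | true | false | _ | true = ⊥-elim (true≢false (true-<ᵇ {∣ S ∣} (s≤s (ℕₚ.≤-reflexive (≡ᵇ-true {∣ S ∣} {k} eq₃)))) eq₁)
  ... | true | true | false | false with ℕₚ.m≤n⇒m<n∨m≡n (ℕₚ.≤-pred (<ᵇ-true {∣ S ∣} {suc k} eq₁))
  ...   | inj₁ lt = ⊥-elim (true≢false (true-<ᵇ lt) eq₂)
  ...   | inj₂ e = ⊥-elim (true≢false (trans (cong (∣ S ∣ ≡ᵇ_) (sym e)) (≡ᵇ-refl ∣ S ∣)) eq₃)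

#-below-all : (D : Collection n) → # (below D (suc n)) ≡ # D
#-below-all {n} D = weight-cong _ {below D (suc n)} {D} λ S → ≡true⇔ (λ p → proj₁ (∧-true {D S} p)) λ p → ∧-intro p (true-<ᵇ (s≤s (∣p∣≤n S)))

module _ (D : Collection n) (≤1 : ∀ k → # (level D k) ≤ 1) where

  #-below-≤ : ∀ k → # (below D k) ≤ k
  #-below-≤ zero = ℕₚ.≤-reflexive (#-none {C = below D 0} λ S → ¬true⇒false λ p → case <ᵇ-true {∣ S ∣} {0} (proj₂ (∧-true {D S} p)) of λ ())
  #-below-≤ (suc k) = subst₂ _≤_ (sym (#-below-suc D k)) (ℕₚ.+-comm k 1) (ℕₚ.+-mono-≤ (#-below-≤ k) (≤1 k))

  -- Each of the K levels contributes at most one set, so a total of K leaves no level empty.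
  #-below-tight : ∀ K → K ≤ # (below D K) → ∀ {k} → k ℕ.< K → ∃ λ S → S ∈ᶜ D × ∣ S ∣ ≡ k
  #-below-tight (suc K) le {k} (s≤s k≤K) with ℕₚ.m≤n⇒m<n∨m≡n k≤K
  ... | inj₁ k<K = #-below-tight K (ℕₚ.+-cancelʳ-≤ 1 K _ (ℕₚ.≤-trans (subst₂ _≤_ (ℕₚ.+-comm 1 K) (#-below-suc D K) le)
                     (ℕₚ.+-monoʳ-≤ (# (below D K)) (≤1 K)))) k<K
  ... | inj₂ refl with find (level D K)
  ...   | inj₁ (S , p) = S , proj₁ (∧-true p) , ≡ᵇ-true (proj₂ (∧-true {D S} p))
  ...   | inj₂ f = ⊥-elim (ℕₚ.<⇒≱ (s≤s (#-below-≤ K)) (subst (suc K ≤_)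
                     (trans (#-below-suc D K) (trans (cong (# (below D K) +_) (#-none {C = level D K} f)) (ℕₚ.+-identityʳ _))) le))

#-below-≥ : (D : Collection n) → ∀ K → (∀ {k} → k ℕ.< K → ∃ λ S → S ∈ᶜ D × ∣ S ∣ ≡ k) → K ≤ # (below D K)
#-below-≥ D zero f = z≤n
#-below-≥ D (suc K) f with f (ℕₚ.n<1+n K)
... | S , p , refl = subst₂ _≤_ (ℕₚ.+-comm K 1) (sym (#-below-suc D K))
  (ℕₚ.+-mono-≤ (#-below-≥ D K (f ∘ ℕₚ.m<n⇒m<1+n)) (#-some (level D K) (level-∈ D p)))

⊴-antisym : ∣ X ∣ ≡ ∣ Y ∣ → X ⊴ Y → Y ⊴ X → X ≡ Y
⊴-antisym {X = X} {Y} e f g with diff? X Y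
... | inj₂ sub = ⊑-size-≡ sub (ℕₚ.≤-reflexive (sym e))
... | inj₁ (_ , d) with exchange (ℕₚ.≤-reflexive e) d
...   | _ , d′ = ⊥-elim (<-asym (f d d′) (g d′ d))

⊴⇒NoAlt3 : X ⊴ Y → NoAlt3 X Y
⊴⇒NoAlt3 f _ b<c _ q r = <-asym b<c (f r q)

Sep-tail : ∀ {b} → Sep (b ∷ X) (b ∷ Y) → Sep X Y
Sep-tail {X = X} {Y} {b} s = sep
  (λ p q r w x y z → no4 s (s≤s p) (s≤s q) (s≤s r) (th w) (th x) (th y) (th z))
  (λ p q r w x y z → no4′ s (s≤s p) (s≤s q) (s≤s r) (th w) (th x) (th y) (th z))
  (λ lt p q x y z → no3 s (sz {A = Y} {X} b lt) (s≤s p) (s≤s q) (th x) (th y) (th z))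
  (λ lt p q x y z → no3′ s (sz {A = X} {Y} b lt) (s≤s p) (s≤s q) (th x) (th y) (th z))
  where
  th : ∀ {n} {A B : Subset n} {i b b′} → Diff A B i → Diff (b ∷ A) (b′ ∷ B) (suc i)
  th (p , q) = there p , there q
  sz : ∀ {n} {A B : Subset n} b → ∣ A ∣ ℕ.< ∣ B ∣ → ∣ b ∷ A ∣ ℕ.< ∣ b ∷ B ∣
  sz true lt = s≤s lt
  sz false lt = lt

-- Contraction of the first element

L R contract : Collection (suc n) → Collection n
L C S = C (outside ∷ S)
R C S = C (inside ∷ S)
contract C S = R C S ∨ L C S

doubled : Collection (suc n) → Collection n
doubled C S = R C S ∧ L C S

#-contract : (C : Collection (suc n)) → # C ≡ # (contract C) + # (doubled C)
#-contract C = #-∨-∧ (R C) (L C)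

module _ {C : Collection (suc n)} (sC : Separated C) where

  -- Restoring the first element makes the left set the strictly larger one. An element j of Z alone
  -- before an element i of W alone would give the pattern first element, j, i, which `no3` forbids.
  R⊴L : W ∈ᶜ R C → Z ∈ᶜ L C → ∣ Z ∣ ≤ ∣ W ∣ → W ⊴ Z
  R⊴L {W} {Z} w z le {i} {j} p@(pi , qi) q@(pj , qj) with <-cmp i j
  ... | tri< lt _ _ = lt
  ... | tri≈ _ refl _ = ⊥-elim (∋∌ pi qj)
  ... | tri> _ _ gt = ⊥-elim (no3 (sC {inside ∷ W} {outside ∷ Z} w z) (s≤s le) (s≤s z≤n) (s≤s gt)
      (here , here) (there pj , there qj) (there pi , there qi))

  RL-sep : W ∈ᶜ R C → Z ∈ᶜ L C → Sep W Z
  RL-sep {W} {Z} w z with ℕₚ.≤-total ∣ Z ∣ ∣ W ∣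
  ... | inj₁ le = noAlt3⇒sep (⊴⇒NoAlt3 (R⊴L w z le)) le
  -- When `W` is not the larger set, the restored first element turns a pattern Z, W, Z into a
  -- four-term one.
  ... | inj₂ le = Sep-sym (noAlt3⇒sep (λ p q x y t → no4 (sC {inside ∷ W} {outside ∷ Z} w z) (s≤s z≤n) (s≤s p) (s≤s q)
      (here , here) (there (proj₁ x) , there (proj₂ x)) (there (proj₁ y) , there (proj₂ y)) (there (proj₁ t) , there (proj₂ t))) le)

  contract-separated : Separated (contract C)
  contract-separated {X} {Y} p q with ∨-true {R C X} p | ∨-true {R C Y} q
  ... | inj₁ x | inj₁ y = Sep-tail (sC {inside ∷ X} {inside ∷ Y} x y)
  ... | inj₂ x | inj₂ y = Sep-tail (sC {outside ∷ X} {outside ∷ Y} x y)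
  ... | inj₁ x | inj₂ y = RL-sep x y
  ... | inj₂ x | inj₁ y = Sep-sym (RL-sep y x)

  doubled-unique : ∀ k → # (level (doubled C) k) ≤ 1
  doubled-unique k = #-unique (level (doubled C) k) λ {S} {T} p q →
    let s , eS = ∧-true {doubled C S} p ; t , eT = ∧-true {doubled C T} q
        sR , sL = ∧-true {R C S} s ; tR , tL = ∧-true {R C T} t
        e = trans (≡ᵇ-true eS) (sym (≡ᵇ-true eT))
    in ⊴-antisym e (R⊴L sR tL (ℕₚ.≤-reflexive (sym e))) (R⊴L tR sL (ℕₚ.≤-reflexive e))

  #-doubled-≤ : # (doubled C) ≤ suc n
  #-doubled-≤ = subst (_≤ suc n) (#-below-all (doubled C)) (#-below-≤ (doubled C) doubled-unique (suc n))

N : ℕ → ℕ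
N zero = 1
N (suc n) = N n + suc n

#-≤-N : {C : Collection n} → Separated C → # C ≤ N n
#-≤-N {zero} {C} s with C []
... | true = s≤s z≤n
... | false = z≤n
#-≤-N {suc n} {C} s = subst (_≤ N (suc n)) (sym (#-contract C))
  (ℕₚ.+-mono-≤ (#-≤-N (contract-separated s)) (#-doubled-≤ s))

record Full (C : Collection n) : Set where
  constructor full
  field
    separated : Separated C
    large : N n ≤ # C
open Full public

contract-full : {C : Collection (suc n)} → Full C → Full (contract C)
contract-full {n} {C} (full s l) = full (contract-separated s)
  (ℕₚ.+-cancelʳ-≤ (suc n) (N n) (# (contract C)) (ℕₚ.≤-trans (subst (N n + suc n ≤_) (#-contract C) l)
    (ℕₚ.+-monoʳ-≤ (# (contract C)) (#-doubled-≤ s))))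

-- The two summands of the count, `contract C` and `doubled C`, are at most N n and n + 1, which add
-- up to N (n + 1); so both bounds are attained, and `doubled C` meets each of the n + 1 sizes.
path : {C : Collection (suc n)} → Full C → ∀ {g} → g ≤ n → ∃ λ X → X ∈ᶜ R C × X ∈ᶜ L C × ∣ X ∣ ≡ g
path {n} {C} (full s l) g≤n with #-below-tight (doubled C) (doubled-unique s) (suc n)
    (subst (suc n ≤_) (sym (#-below-all (doubled C)))
      (ℕₚ.+-cancelˡ-≤ (N n) _ _ (ℕₚ.≤-trans (subst (N n + suc n ≤_) (#-contract C) l)
        (ℕₚ.+-monoˡ-≤ (# (doubled C)) (#-≤-N (contract-separated s)))))) (s≤s g≤n)
... | X , p , e = X , proj₁ (∧-true {R C X} p) , proj₂ (∧-true {R C X} p) , e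

-- Sets squeezed between neighbours

⊖-∌⁻ : j ≢ i → S ⊖ i ∌ j → S ∌ j
⊖-∌⁻ {j = j} {S = S} j≢i p with mem? S j
... | inj₁ q = ⊥-elim (∋∌ (⊖-∋ j≢i q) p)
... | inj₂ q = q

∌-⊑ : X ⊑ Y → Y ∌ i → X ∌ i
∌-⊑ {X = X} {i = i} f p with mem? X i
... | inj₁ q = ⊥-elim (∋∌ (f q) p)
... | inj₂ q = q

⊴-tail : ∀ {b b′} → (b ∷ X) ⊴ (b′ ∷ Y) → X ⊴ Y
⊴-tail f (p , q) (p′ , q′) = case f (there p , there q) (there p′ , there q′) of λ { (s≤s lt) → lt }

-- An element x of V missing from q is matched, by equal size, with some y of q outside W and hence
-- outside V. The two relations `⊴` then order x and y in opposite ways.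
sandwich-⊑ : V ⊑ W → ∣ W ∣ ≡ ∣ q ∣ → (W ⊴ q × q ⊴ V) ⊎ (V ⊴ q × q ⊴ W) → V ⊑ q
sandwich-⊑ {V = V} {W} {q} sub e h with diff? V q
... | inj₂ f = f
... | inj₁ (x , p , p′) with exchange (ℕₚ.≤-reflexive e) (sub p , p′)
...   | y , u , u′ with h
...     | inj₁ (f , g) = ⊥-elim (<-asym (f (sub p , p′) (u , u′)) (g (u , ∌-⊑ sub u′) (p , p′)))
...     | inj₂ (f , g) = ⊥-elim (<-asym (f (p , p′) (u , ∌-⊑ sub u′)) (g (u , u′) (sub p , p′)))

sandwich-⊒ : V ⊑ W → ∣ V ∣ ≡ ∣ r ∣ → (W ⊴ r × r ⊴ V) ⊎ (V ⊴ r × r ⊴ W) → r ⊑ W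
sandwich-⊒ {V = V} {W} {r} sub e h with diff? r W
... | inj₂ f = f
... | inj₁ (y , p , p′) with exchange (ℕₚ.≤-reflexive (sym e)) (p , ∌-⊑ sub p′)
...   | x , u , u′ with h
...     | inj₁ (f , g) = ⊥-elim (<-asym (f (sub u , u′) (p , p′)) (g (p , ∌-⊑ sub p′) (u , u′)))
...     | inj₂ (f , g) = ⊥-elim (<-asym (f (u , u′) (p , ∌-⊑ sub p′)) (g (p , p′) (sub u , u′)))

-- On the way from `V ⊕ x` to `V ⊕ y` in the order `⊴`, a set of the same size has either exchanged
-- x for an element before y, or has exchanged some d for y and still has to exchange x for d.
-- Nothing else fits (`between`).
data Between (V : Subset n) (x y : Fin n) (q : Subset n) : Set where
  lower : q ≡ V ⊕ x → Between V x y q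
  upper : q ≡ V ⊕ y → Between V x y q
  inner : ∀ m → x < m → m < y → V ∌ m → q ≡ V ⊕ m → Between V x y q
  outer : ∀ d → x < d → d < y → V ∋ d → q ≡ V ⊕ x ⊕ y ⊖ d → Between V x y q

between : V ∌ x → V ∌ y → x < y → ∣ q ∣ ≡ suc ∣ V ∣ → V ⊕ x ⊴ q → q ⊴ V ⊕ y → Between V x y q
between {V = V} {x} {y} {q} Vx Vy x<y e f g with mem? q x | mem? q y
... | inj₂ qx | inj₂ qy with exchange {X = V ⊕ x} {q} (ℕₚ.≤-reflexive (trans (size-⊕ Vx) (sym e))) (⊕-here V x , qx)
...   | z , qz , z∉ = inner z (f (⊕-here V x , qx) (qz , z∉)) (g (qz , ⊕-∌ (∋-≢ qz qy) (⊕-∌⁻ z∉)) (⊕-here V y , qy)) (⊕-∌⁻ z∉)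
        (sym (⊑-size-≡ (⊑-⊕ sub qz) (ℕₚ.≤-reflexive (trans e (sym (size-⊕ (⊕-∌⁻ z∉)))))))
  where
  sub : V ⊑ q
  sub {v} Vv with mem? q v
  ... | inj₁ p = p
  ... | inj₂ p = ⊥-elim (<-asym (f (⊕-∋ x Vv , p) (qz , z∉)) (g (qz , ⊕-∌ (∋-≢ qz qy) (⊕-∌⁻ z∉)) (⊕-∋ y Vv , p)))
between {V = V} {x} {y} {q} Vx Vy x<y e f g | inj₁ qx | inj₁ qy
  with diff? (V ⊕ x) q
... | inj₂ sub = ⊥-elim (∋∌ qy (subst (_∌ y) (⊑-size-≡ sub (ℕₚ.≤-reflexive (trans e (sym (size-⊕ Vx))))) (⊕-∌ (λ eq → <-irrefl (sym eq) x<y) Vy)))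
... | inj₁ (d , d∈ , qd) = outer d
        (g (qx , ⊕-∌ (λ eq → <-irrefl eq x<y) Vx) (⊕-∋ y Vd , qd))
        (f (d∈ , qd) (qy , ⊕-∌ (λ eq → <-irrefl (sym eq) x<y) Vy)) Vd
        (⊑-size-≡ sub (ℕₚ.≤-reflexive (ℕₚ.suc-injective (trans (size-⊖ (⊕-∋ y d∈))
          (trans (size-⊕ (⊕-∌ (λ eq → <-irrefl (sym eq) x<y) Vy)) (cong suc (trans (size-⊕ Vx) (sym e))))))))
  where
  Vd : V ∋ d
  Vd with ⊕-∋⁻ d∈
  ... | inj₁ refl = ⊥-elim (∋∌ qx qd)
  ... | inj₂ p = p
  sub : q ⊑ V ⊕ x ⊕ y ⊖ d
  sub {z} qz with mem? (V ⊕ x ⊕ y) z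
  ... | inj₁ p = ⊖-∋ (∋-≢ qz qd) p
  ... | inj₂ p = ⊥-elim (<-asym (f (d∈ , qd) (qz , ⊕-∌⁻ p)) (g (qz , ⊕-∌ (∌-≢ p (⊕-here _ y)) (⊕-∌⁻ (⊕-∌⁻ p))) (⊕-∋ y Vd , qd)))
between {V = V} {x} {y} {q} Vx Vy x<y e f g | inj₁ qx | inj₂ qy with diff? (V ⊕ x) q
... | inj₂ sub = lower (sym (⊑-size-≡ sub (ℕₚ.≤-reflexive (trans e (sym (size-⊕ Vx))))))
... | inj₁ (v , v∈ , qv) with ⊕-∋⁻ v∈ | exchange {X = V ⊕ x} {q} (ℕₚ.≤-reflexive (trans (size-⊕ Vx) (sym e))) (v∈ , qv)
...   | inj₁ refl | _ = ⊥-elim (∋∌ qx qv)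
...   | inj₂ Vv | z , qz , z∉ = ⊥-elim (<-asym (f (v∈ , qv) (qz , z∉)) (g (qz , ⊕-∌ (∋-≢ qz qy) (⊕-∌⁻ z∉)) (⊕-∋ y Vv , qv)))
between {V = V} {x} {y} {q} Vx Vy x<y e f g | inj₂ qx | inj₁ qy with diff? (V ⊕ y) q
... | inj₂ sub = upper (sym (⊑-size-≡ sub (ℕₚ.≤-reflexive (trans e (sym (size-⊕ Vy))))))
... | inj₁ (v , v∈ , qv) with ⊕-∋⁻ v∈ | exchange {X = V ⊕ y} {q} (ℕₚ.≤-reflexive (trans (size-⊕ Vy) (sym e))) (v∈ , qv)
...   | inj₁ refl | _ = ⊥-elim (∋∌ qy qv)
...   | inj₂ Vv | z , qz , z∉ = ⊥-elim (<-asym (f (⊕-∋ x Vv , qv) (qz , ⊕-∌ (∋-≢ qz qx) (⊕-∌⁻ z∉))) (g (qz , z∉) (v∈ , qv)))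

-- This is `between` for V = W ⊖ c. The shape `inner`, W with c replaced by an m between c and a, is
-- excluded because it alternates with the larger set W ⊕ a at c, m, a.
swap-between : W ∋ c → W ∌ a → c < a → ∣ r ∣ ≡ ∣ W ∣ → W ⊴ r → r ⊴ W ⊕ a ⊖ c → Sep r (W ⊕ a) →
  r ≡ W ⊎ (∃ λ d → d < a × W ∋ d × r ≡ W ⊕ a ⊖ d)
swap-between {W = W} {c} {a} {r} Wc Wa c<a e f g s
  with between {V = W ⊖ c} {c} {a} {r} (⊖-here W c) (⊖-∌ c Wa) c<a (trans e (sym (size-⊖ Wc)))
         (subst (_⊴ r) (sym (⊖-⊕ Wc)) f) (subst (r ⊴_) (sym (⊖-⊕-comm W (∋-≢ Wc Wa))) g)
... | lower eq = inj₁ (trans eq (⊖-⊕ Wc))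
... | upper eq = inj₂ (c , c<a , Wc , trans eq (⊖-⊕-comm W (∋-≢ Wc Wa)))
... | outer d c<d d<a Vd eq = inj₂ (d , d<a , ⊖-∋⁻ Vd , trans eq (cong (λ U → U ⊕ a ⊖ d) (⊖-⊕ Wc)))
... | inner m c<m m<a Vm refl = ⊥-elim (no3′ s (ℕₚ.≤-reflexive (trans (cong suc e) (sym (size-⊕ Wa)))) c<m m<a
      (⊕-∋ a Wc , ⊕-∌ (<⇒≢ c<m) (⊖-here W c))
      (⊕-here _ m , ⊕-∌ (<⇒≢ m<a) (⊖-∌⁻ (λ eq → <-irrefl (sym eq) c<m) Vm))
      (⊕-here W a , ⊕-∌ (λ eq → <-irrefl (sym eq) m<a) (⊖-∌ c Wa)))

-- Local structure of full collections

>⇒≢ : a < b → b ≢ a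
>⇒≢ lt eq = <-irrefl (sym eq) lt

-- Comparability with a whole level is the invariant that lets the search for neighbours descend: it
-- survives contraction (`strong-outside`, `strong-inside`), and path vertices have it in the
-- contraction (`path-strong`).
Strong : Collection n → Subset n → Set
Strong C S = ∀ {T} → T ∈ᶜ C → ∣ T ∣ ≡ ∣ S ∣ → S ⊴ T ⊎ T ⊴ S

R-∈ : (C : Collection (suc n)) → S ∈ᶜ R C → S ∈ᶜ contract C
R-∈ {S = S} C p = ∨-introˡ (L C S) p

L-∈ : (C : Collection (suc n)) → S ∈ᶜ L C → S ∈ᶜ contract C
L-∈ {S = S} C p = ∨-introʳ (R C S) p

side : (C : Collection (suc n)) → S ∈ᶜ contract C → S ∈ᶜ R C ⊎ S ∈ᶜ L C
side {S = S} C p = ∨-true {R C S} p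

strong-outside : {C : Collection (suc n)} → Separated C → S ∈ᶜ L C → Strong C (outside ∷ S) → Strong (contract C) S
strong-outside {S = S} {C} sC p st {T} q e with side {S = T} C q
... | inj₁ t = inj₂ (R⊴L sC t p (ℕₚ.≤-reflexive (sym e)))
... | inj₂ t with st {outside ∷ T} t e
...   | inj₁ f = inj₁ (⊴-tail f)
...   | inj₂ f = inj₂ (⊴-tail f)

strong-inside : {C : Collection (suc n)} → Separated C → S ∈ᶜ R C → Strong C (inside ∷ S) → Strong (contract C) S
strong-inside {S = S} {C} sC p st {T} q e with side {S = T} C q
... | inj₂ t = inj₁ (R⊴L sC p t (ℕₚ.≤-reflexive e))
... | inj₁ t with st {inside ∷ T} t (cong suc e)
...   | inj₁ f = inj₁ (⊴-tail f)
...   | inj₂ f = inj₂ (⊴-tail f)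

-- The first element, lying in the left set only, decides which of the two ⊴ can hold.
inside-⊴ : ∃ (Diff T S) → (inside ∷ S) ⊴ (outside ∷ T) ⊎ (outside ∷ T) ⊴ (inside ∷ S) → S ⊴ T
inside-⊴ _ (inj₁ f) = ⊴-tail f
inside-⊴ (_ , p , q) (inj₂ f) = case f (there p , there q) (here , here) of λ ()

module _ {C : Collection (suc n)} (F : Full C) where
  private
    sC = separated F

  -- The path vertex q of size ∣S∣ + 1 satisfies S ⊕ l ⊴ q ⊴ S, both by `R⊴L`, so it contains S and
  -- has the form S ⊕ b; the first relation gives l ≤ b. Thus an upper neighbour in `R` yields one
  -- on both sides.
  path-cover : S ∈ᶜ L C → S ∌ l → S ⊕ l ∈ᶜ R C →
    ∃ λ b → S ∌ b × S ⊕ b ∈ᶜ R C × S ⊕ b ∈ᶜ L C × (b ≡ l ⊎ l < b)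
  path-cover {S} {m} Sl Sm Smr
    with path F (subst (_≤ n) (size-⊕ Sm) (∣p∣≤n (S ⊕ m)))
  ... | q , qr , ql , e
    with cover (sandwich-⊑ {V = S} {S ⊕ m} {q} (⊕-∋ m) (trans (size-⊕ Sm) (sym e))
           (inj₁ (R⊴L sC Smr ql (ℕₚ.≤-reflexive (trans e (sym (size-⊕ Sm)))) , R⊴L sC qr Sl (ℕₚ.≤-trans (ℕₚ.n≤1+n _) (ℕₚ.≤-reflexive (sym e)))))) e
  ... | b , Sb , refl = b , Sb , qr , ql , cmp
    where
    cmp : b ≡ m ⊎ m < b
    cmp with b ≟ᶠ m
    ... | yes eq = inj₁ eq
    ... | no b≢m = inj₂ (R⊴L sC Smr ql (ℕₚ.≤-reflexive (trans e (sym (size-⊕ Sm))))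
                     (⊕-here S m , ⊕-∌ (λ eq → b≢m (sym eq)) Sm) (⊕-here S b , ⊕-∌ b≢m Sb))

up-neighbour : {C : Collection n} → Full C → S ∈ᶜ C → ∣ S ∣ ℕ.< n → Strong C S → ∃ λ m → S ∌ m × S ⊕ m ∈ᶜ C
up-neighbour {suc n} {outside ∷ S} {C} F p lt st with R C S in eq
... | true = zero , here , eq
... | false with ℕₚ.m≤n⇒m<n∨m≡n (∣p∣≤n S)
-- Here S has all n elements and coincides with the top vertex of the path, which lies in `R`.
...   | inj₂ e with path F ℕₚ.≤-refl
...     | q , qr , ql , e′ = ⊥-elim (true≢false (subst (_∈ᶜ R C) (⊑-size-≡ (λ {i} _ → full-∋ e i) (ℕₚ.≤-reflexive (trans e (sym e′)))) qr) eq)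
up-neighbour {suc n} {outside ∷ S} {C} F p lt st | false | inj₁ lt′
  with up-neighbour (contract-full F) (L-∈ {S = S} C p) lt′ (strong-outside (separated F) p st)
... | m , Sm , q with side {S = S ⊕ m} C q
...   | inj₂ l = suc m , there Sm , l
...   | inj₁ r with path-cover F p Sm r
...     | b , Sb , _ , l , _ = suc b , there Sb , l
up-neighbour {suc n} {inside ∷ S} {C} F p (s≤s lt) st
  with up-neighbour (contract-full F) (R-∈ {S = S} C p) lt (strong-inside (separated F) p st)
... | m , Sm , q with side {S = S ⊕ m} C q
...   | inj₁ r = suc m , there Sm , r
-- The upper neighbour lies on the side `L`. The path vertex of its size is squeezed between the
-- strong set S and S ⊕ m, so it is an upper neighbour of S too, and it lies in `R`.
...   | inj₂ l with path F lt
...     | q , qr , ql , e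
  with cover (sandwich-⊑ {V = S} {S ⊕ m} {q} (⊕-∋ m) (trans (size-⊕ Sm) (sym e))
         (inj₂ (inside-⊴ (larger-diff S q (ℕₚ.≤-reflexive (sym e))) (st {outside ∷ q} ql e)
              , R⊴L (separated F) qr l (ℕₚ.≤-reflexive (trans (size-⊕ Sm) (sym e)))))) e
...       | b , Sb , refl = suc b , there Sb , qr

-- The mirror image of `up-neighbour`: removal of the first element is tried first, and the bottom
-- vertex of the path, the empty set, replaces the top one.
down-neighbour : {C : Collection n} → Full C → S ∈ᶜ C → 0 ℕ.< ∣ S ∣ → Strong C S → ∃ λ d → S ∋ d × S ⊖ d ∈ᶜ C
down-neighbour {suc n} {inside ∷ S} {C} F p lt st with L C S in eq
... | true = zero , here , eq
... | false with path F z≤n | ℕₚ.m≤n⇒m<n∨m≡n (z≤n {∣ S ∣})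
...   | q , qr , ql , e | inj₂ e′ = ⊥-elim (true≢false (subst (_∈ᶜ L C) (size0 e (sym e′)) ql) eq)
...   | _ | inj₁ lt′
  with down-neighbour (contract-full F) (R-∈ {S = S} C p) lt′ (strong-inside (separated F) p st)
...     | d , Sd , q with side {S = S ⊖ d} C q
...       | inj₁ r = suc d , there Sd , r
...       | inj₂ l with path F (∣p∣≤n (S ⊖ d))
...         | r , rr , rl , e
  with cocover (sandwich-⊒ {V = S ⊖ d} {S} {r} ⊖-∋⁻ (sym e)
         (inj₁ (R⊴L (separated F) p rl (ℕₚ.≤-trans (ℕₚ.≤-reflexive e) (ℕₚ.≤-trans (ℕₚ.n≤1+n _) (ℕₚ.≤-reflexive (size-⊖ Sd))))
              , R⊴L (separated F) rr l (ℕₚ.≤-reflexive (sym e))))) (trans (sym (size-⊖ Sd)) (cong suc (sym e)))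
...           | b , Sb , refl = suc b , there Sb , rr
down-neighbour {suc n} {outside ∷ S} {C} F p lt st
  with down-neighbour (contract-full F) (L-∈ {S = S} C p) lt (strong-outside (separated F) p st)
... | d , Sd , q with side {S = S ⊖ d} C q
...   | inj₂ l = suc d , there Sd , l
...   | inj₁ r′ with path F (∣p∣≤n (S ⊖ d))
...     | r , rr , rl , e
  with cocover (sandwich-⊒ {V = S ⊖ d} {S} {r} ⊖-∋⁻ (sym e)
         (inj₂ (R⊴L (separated F) r′ rl (ℕₚ.≤-reflexive e)
              , inside-⊴ (larger-diff r S lt′) (swap⊎ (st {inside ∷ r} rr (trans (cong suc e) (size-⊖ Sd)))))))
         (trans (sym (size-⊖ Sd)) (cong suc (sym e)))
  where
  lt′ = ℕₚ.≤-reflexive (trans (cong suc e) (size-⊖ Sd))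
  swap⊎ : ∀ {A B : Set} → A ⊎ B → B ⊎ A
  swap⊎ (inj₁ x) = inj₂ x
  swap⊎ (inj₂ x) = inj₁ x
...       | b , Sb , refl = suc b , there Sb , rl

module _ {C : Collection (suc n)} (F : Full C) where
  private
    sC = separated F

  path-strong : S ∈ᶜ R C → S ∈ᶜ L C → Strong (contract C) S
  path-strong {S} r l {T} t e with side {S = T} C t
  ... | inj₁ t′ = inj₂ (R⊴L sC t′ l (ℕₚ.≤-reflexive (sym e)))
  ... | inj₂ t′ = inj₁ (R⊴L sC r t′ (ℕₚ.≤-reflexive e))

  path-up : S ∈ᶜ R C → S ∈ᶜ L C → ∣ S ∣ ℕ.< n → ∃ λ m → S ∌ m × S ⊕ m ∈ᶜ L C
  path-up {S} r l lt with up-neighbour (contract-full F) (R-∈ {S = S} C r) lt (path-strong r l)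
  ... | m , Sm , q with side {S = S ⊕ m} C q
  ...   | inj₂ l′ = m , Sm , l′
  ...   | inj₁ r′ with path-cover F l Sm r′
  ...     | b , Sb , _ , l′ , _ = b , Sb , l′

  path-down : S ∈ᶜ R C → S ∈ᶜ L C → 0 ℕ.< ∣ S ∣ → ∃ λ d → S ∋ d × S ⊖ d ∈ᶜ R C
  path-down {S} r l lt with down-neighbour (contract-full F) (R-∈ {S = S} C r) lt (path-strong r l)
  ... | d , Sd , q with side {S = S ⊖ d} C q
  ...   | inj₁ r′ = d , Sd , r′
  ...   | inj₂ l′ with path F (∣p∣≤n (S ⊖ d))
  ...     | p , pr , pl , e
    with cocover (sandwich-⊒ {V = S ⊖ d} {S} {p} ⊖-∋⁻ (sym e)
         (inj₁ (R⊴L sC r pl (ℕₚ.≤-trans (ℕₚ.≤-reflexive e) (ℕₚ.≤-trans (ℕₚ.n≤1+n _) (ℕₚ.≤-reflexive (size-⊖ Sd))))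
              , R⊴L sC pr l′ (ℕₚ.≤-reflexive (sym e))))) (trans (sym (size-⊖ Sd)) (cong suc (sym e)))
  ...       | b , Sb , refl = b , Sb , pr

-- The larger set alone contains k and l, the smaller one alone contains c, so c cannot lie between
-- k and l.
replace-crossing : Z ∋ k → Z ∋ c → Z ∌ l → Sep (Z ⊖ k) (Z ⊖ c ⊕ l) →
  (k < c → c < l → ⊥) × (l < c → c < k → ⊥)
replace-crossing {Z = Z} {k} {c} {m} Zk Zc Zm s =
  (λ k<c c<m → no3′ s lt k<c c<m (dk (<⇒≢ k<c)) (dc (>⇒≢ k<c)) dm) ,
  (λ m<c c<k → no3′ s lt m<c c<k dm (dc (<⇒≢ c<k)) (dk (>⇒≢ c<k)))
  where
  lt : ∣ Z ⊖ k ∣ ℕ.< ∣ Z ⊖ c ⊕ m ∣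
  lt = ℕₚ.≤-reflexive (trans (size-⊖ Zk) (sym (trans (size-⊕ (⊖-∌ c Zm)) (size-⊖ Zc))))
  dk : k ≢ c → Diff (Z ⊖ c ⊕ m) (Z ⊖ k) k
  dk ne = ⊕-∋ m (⊖-∋ ne Zk) , ⊖-here Z k
  dc : c ≢ k → Diff (Z ⊖ k) (Z ⊖ c ⊕ m) c
  dc ne = ⊖-∋ ne Zc , ⊕-∌ (∋-≢ Zc Zm) (⊖-here Z c)
  dm : Diff (Z ⊖ c ⊕ m) (Z ⊖ k) m
  dm = ⊕-here _ m , ⊖-∌ k Zm

-- This is `replace-crossing` for Z = X ⊕ b: the element b cannot lie between d and a.
trade-crossing : X ∌ a → X ∌ b → X ∋ d → a ≢ b → Sep (X ⊕ b ⊖ d) (X ⊕ a) → (d < b → b < a → ⊥) × (a < b → b < d → ⊥)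
trade-crossing {X = X} {a} {b} {d} Xa Xb Xd a≢b s = replace-crossing (⊕-∋ b Xd) (⊕-here X b) (⊕-∌ a≢b Xa)
  (subst (Sep (X ⊕ b ⊖ d)) (cong (_⊕ a) (sym (⊕-⊖ Xb))) s)

-- What follows the edge X – X ⊕ a in the strip between two levels, read from left to right.
data After (C : Collection n) (X : Subset n) (a : Fin n) : Set where
  raise : ∀ m → a < m → X ∌ m → X ⊕ m ∈ᶜ C → After C X a
  trade : ∀ c → c < a → X ∋ c → X ⊕ a ⊖ c ∈ᶜ C → After C X a
  final : (∀ {i} → X ∋ i → a < i) → (∀ {i} → a < i → X ∋ i) → After C X a

-- What lies below the edge from X ⊕ a to X ⊕ b.
data Below (C : Collection n) (X : Subset n) (a b : Fin n) : Set where
  apex  : X ∈ᶜ C → Below C X a b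
  mid   : ∀ c → a < c → c < b → X ∋ c → X ⊕ a ⊕ b ⊖ c ∈ᶜ C → Below C X a b
  left  : ∀ m → m < a → X ∌ m → X ⊕ m ∈ᶜ C → Below C X a b
  right : ∀ m → b < m → X ∌ m → X ⊕ m ∈ᶜ C → Below C X a b

-- The two conditions say that X consists of all elements after a, and this is the last set of its
-- size in the order `⊴`.
final-⊴ : ∀ {X q : Subset n} {a} → (∀ {i} → a < i → X ∋ i) → (∀ {i} → X ∋ i → a < i) → ∣ X ∣ ≡ ∣ q ∣ → X ⊴ q → X ≡ q
final-⊴ {X = X} {q} above below e f with diff? X q
... | inj₂ sub = ⊑-size-≡ sub (ℕₚ.≤-reflexive (sym e))
... | inj₁ (i , p , p′) with exchange (ℕₚ.≤-reflexive e) (p , p′)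
...   | j , u , u′ = ⊥-elim (∋∌ (above (<-trans (below p) (f (p , p′) (u , u′)))) u′)

module _ {C : Collection (suc n)} (F : Full C) where
  private
    sC = separated F
    sC′ = contract-separated sC

  -- On each level the sets of `R` come before those of `L`, so a step to the right from `L` stays
  -- in `L`; the next lemma is the mirror image.
  L-closed-raise : X ∌ b → X ∌ a → a < b → X ⊕ a ∈ᶜ L C → X ⊕ b ∈ᶜ contract C → X ⊕ b ∈ᶜ L C
  L-closed-raise {X} {m} {a} Xm Xa lt l p with side {S = X ⊕ m} C p
  ... | inj₂ l′ = l′
  ... | inj₁ r = ⊥-elim (<-asym lt (R⊴L sC r l (ℕₚ.≤-reflexive (trans (size-⊕ Xa) (sym (size-⊕ Xm))))
        (⊕-here X m , ⊕-∌ (>⇒≢ lt) Xm) (⊕-here X a , ⊕-∌ (<⇒≢ lt) Xa)))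

  R-closed-lower : X ∌ b → X ∌ a → b < a → X ⊕ a ∈ᶜ R C → X ⊕ b ∈ᶜ contract C → X ⊕ b ∈ᶜ R C
  R-closed-lower {X} {m} {a} Xm Xa lt r p with side {S = X ⊕ m} C p
  ... | inj₁ r′ = r′
  ... | inj₂ l = ⊥-elim (<-asym lt (R⊴L sC r l (ℕₚ.≤-reflexive (trans (size-⊕ Xm) (sym (size-⊕ Xa))))
        (⊕-here X a , ⊕-∌ (>⇒≢ lt) Xa) (⊕-here X m , ⊕-∌ (<⇒≢ lt) Xm)))

  -- By `R⊴L` the path vertex of size ∣V∣ + 1 comes after every set of `R` and before every set of
  -- `L` of that size.
  path-between : V ∌ x → V ∌ y → x < y → V ⊕ x ∈ᶜ R C → V ⊕ y ∈ᶜ L C →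
    ∃ λ q → q ∈ᶜ R C × q ∈ᶜ L C × ∣ q ∣ ≡ suc ∣ V ∣ × Between V x y q
  path-between {V} {x} {y} Vx Vy lt r l with path F (∣p∣≤n (V ⊕ x))
  ... | q , qr , ql , e = q , qr , ql , trans e (size-⊕ Vx) ,
    between Vx Vy lt (trans e (size-⊕ Vx)) (R⊴L sC r ql (ℕₚ.≤-reflexive e))
      (R⊴L sC qr l (ℕₚ.≤-reflexive (trans (size-⊕ Vy) (sym (trans e (size-⊕ Vx))))))

  trade-between : W ∋ c → W ∌ a → c < a → W ∈ᶜ R C → W ⊕ a ∈ᶜ contract C → W ⊕ a ⊖ c ∈ᶜ L C →
    (W ∈ᶜ L C) ⊎ (∃ λ d → d < a × W ∋ d × W ⊕ a ⊖ d ∈ᶜ R C)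
  trade-between {W} {c} {a} Wc Wa lt r p l with path F (∣p∣≤n W)
  ... | q , qr , ql , e with swap-between Wc Wa lt e (R⊴L sC r ql (ℕₚ.≤-reflexive e))
        (R⊴L sC qr l (ℕₚ.≤-reflexive (trans (ℕₚ.suc-injective (trans (size-⊖ (⊕-∋ a Wc)) (size-⊕ Wa))) (sym e))))
        (sC′ (R-∈ {S = q} C qr) p)
  ...   | inj₁ refl = inj₁ ql
  ...   | inj₂ (d , d<a , Wd , refl) = inj₂ (d , d<a , Wd , qr)

-- Induction along contractions. The edge lies in `L` or in `R`, unless a is the first element; then
-- X is a path vertex, and its upper neighbour in `L` is the successor. A successor found on the
-- wrong side of the cut is replaced by a path vertex or excluded.
after : {C : Collection n} → Full C → X ∌ a → X ∈ᶜ C → X ⊕ a ∈ᶜ C → After C X a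
after {suc n} {outside ∷ X} {suc a} {C} F (there Xa) p q
  with after (contract-full F) Xa (L-∈ {S = X} C p) (L-∈ {S = X ⊕ a} C q)
... | raise m lt Xm r = raise (suc m) (s≤s lt) (there Xm) (L-closed-raise F Xm Xa lt q r)
... | final f g = final (λ { (there u) → s≤s (f u) }) λ { {suc i} (s≤s lt) → there (g lt) }
... | trade c lt Xc r with side {S = X ⊕ a ⊖ c} C r
...   | inj₂ l = trade (suc c) (s≤s lt) (there Xc) l
...   | inj₁ r′ = ⊥-elim (<-asym lt (R⊴L (separated F) r′ p
        (ℕₚ.≤-reflexive (sym (ℕₚ.suc-injective (trans (size-⊖ (⊕-∋ a Xc)) (size-⊕ Xa)))))
        (⊖-∋ (>⇒≢ lt) (⊕-here X a) , Xa) (Xc , ⊖-here _ c)))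
after {suc n} {outside ∷ X} {zero} {C} F here p q with ℕₚ.m≤n⇒m<n∨m≡n (∣p∣≤n X)
... | inj₁ lt with path-up F q p lt
...   | m , Xm , l = raise (suc m) (s≤s z≤n) (there Xm) l
after {suc n} {outside ∷ X} {zero} {C} F here p q | inj₂ e =
  final (λ { (there u) → s≤s z≤n }) λ { {suc i} _ → there (full-∋ e i) }
after {suc n} {inside ∷ W} {suc a} {C} F (there Wa) p q with L C (W ⊕ a) in eq
... | true = trade zero (s≤s z≤n) here eq
... | false with after (contract-full F) Wa (R-∈ {S = W} C p) (R-∈ {S = W ⊕ a} C q)
...   | final f g with path F (∣p∣≤n (W ⊕ a))
-- Since W consists of all elements after a, `W ⊕ a` is the last set of its size and therefore the
-- path vertex, although it is not in `L`.
...     | s , sr , sl , e = ⊥-elim (true≢false (subst (_∈ᶜ L C) (sym Wa≡s) sl) eq)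
  where
  Wa⊴s = R⊴L (separated F) q sl (ℕₚ.≤-reflexive e)
  Wa≡s : W ⊕ a ≡ s
  Wa≡s with diff? (W ⊕ a) s
  ... | inj₂ sub = ⊑-size-≡ sub (ℕₚ.≤-reflexive e)
  ... | inj₁ (i , u , u′) with exchange (ℕₚ.≤-reflexive (sym e)) (u , u′)
  ...   | j , v , v′ = ⊥-elim (∋∌ (⊕-∋ a (g (a<j (⊕-∋⁻ u)))) v′)
    where
    a<j : i ≡ a ⊎ W ∋ i → a < j
    a<j (inj₁ refl) = Wa⊴s (u , u′) (v , v′)
    a<j (inj₂ w) = <-trans (f w) (Wa⊴s (u , u′) (v , v′))
after {suc n} {inside ∷ W} {suc a} {C} F (there Wa) p q | false | raise m lt Wm r with side {S = W ⊕ m} C r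
... | inj₁ r′ = raise (suc m) (s≤s lt) (there Wm) r′
... | inj₂ l with path-between F Wa Wm lt q l
...   | s , sr , sl , e , lower refl = ⊥-elim (true≢false sl eq)
...   | s , sr , sl , e , upper refl = raise (suc m) (s≤s lt) (there Wm) sr
...   | s , sr , sl , e , inner k a<k k<m Wk refl = raise (suc k) (s≤s a<k) (there Wk) sr
-- A path vertex of this shape would alternate with the smaller member W at a, d, m.
...   | s , sr , sl , e , outer d a<d d<m Wd refl = ⊥-elim (no3 (contract-separated (separated F) {s} {W} (R-∈ {S = s} C sr) (R-∈ {S = W} C p))
        (ℕₚ.≤-reflexive (sym e)) a<d d<m
        (⊖-∋ (<⇒≢ a<d) (⊕-∋ m (⊕-here W a)) , Wa) (Wd , ⊖-here _ d) (⊖-∋ (>⇒≢ d<m) (⊕-here _ m) , Wm))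
after {suc n} {inside ∷ W} {suc a} {C} F (there Wa) p q | false | trade c lt Wc r with side {S = W ⊕ a ⊖ c} C r
... | inj₁ r′ = trade (suc c) (s≤s lt) (there Wc) r′
... | inj₂ l with trade-between F Wc Wa lt p (R-∈ {S = W ⊕ a} C q) l
...   | inj₂ (d , d<a , Wd , r″) = trade (suc d) (s≤s d<a) (there Wd) r″
-- Now W is a path vertex. The path vertex above it is some `W ⊕ b`, and b comes after a because
-- `W ⊕ a` is not in `L`.
...   | inj₁ Wl with path-cover F Wl Wa q
...     | b , Wb , br , bl , inj₁ refl = ⊥-elim (true≢false bl eq)
...     | b , Wb , br , bl , inj₂ a<b = raise (suc b) (s≤s a<b) (there Wb) br

-- If the first element is in X, the edge lies in `R`; if it is neither in X nor equal to a, the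
-- edge lies in `L`. If it is a itself, the edge contracts to the edge from X up to X ⊕ b, and what
-- `after` finds next to that edge becomes the polygon below.
horizontal : {C : Collection n} → Full C → X ∌ a → X ∌ b → a < b → X ⊕ a ∈ᶜ C → X ⊕ b ∈ᶜ C → Below C X a b
horizontal {suc n} {inside ∷ W} {suc a} {suc b} {C} F (there Wa) (there Wb) (s≤s lt) p q
  with horizontal (contract-full F) Wa Wb lt (R-∈ {S = W ⊕ a} C p) (R-∈ {S = W ⊕ b} C q)
... | left m m<a Wm r = left (suc m) (s≤s m<a) (there Wm) (R-closed-lower F Wm Wa m<a p r)
... | mid c a<c c<b Wc r with side {S = W ⊕ a ⊕ b ⊖ c} C r
...   | inj₁ r′ = mid (suc c) (s≤s a<c) (s≤s c<b) (there Wc) r′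
...   | inj₂ l = ⊥-elim (<-asym a<c (R⊴L (separated F) q l
        (ℕₚ.≤-reflexive (trans (ℕₚ.suc-injective (trans (size-⊖ (⊕-∋ b (⊕-∋ a Wc))) (trans (size-⊕ (⊕-∌ (>⇒≢ lt) Wb)) (cong suc (size-⊕ Wa))))) (sym (size-⊕ Wb))))
        (⊕-∋ b Wc , ⊖-here _ c) (⊖-∋ (<⇒≢ a<c) (⊕-∋ b (⊕-here W a)) , ⊕-∌ (<⇒≢ lt) Wa)))
horizontal {suc n} {inside ∷ W} {suc a} {suc b} {C} F (there Wa) (there Wb) (s≤s lt) p q | apex r with side {S = W} C r
... | inj₁ r′ = apex r′
-- The apex W lies on the side `L`. The path vertex above it is a further vertex to the right,
-- unless it is `W ⊕ b`; then the path enters `W ⊕ b` from below, and entering from any set other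
-- than W would cross `W ⊕ a`.
... | inj₂ l with path-cover F l Wb q
...   | e , We , er , el , inj₂ b<e = right (suc e) (s≤s b<e) (there We) er
...   | e , We , er , el , inj₁ refl with path-down F er el (subst (0 ℕ.<_) (sym (size-⊕ We)) (s≤s z≤n))
...     | d , d∈ , dr with ⊕-∋⁻ d∈
...       | inj₁ refl = apex (subst (_∈ᶜ R C) (⊕-⊖ We) dr)
...       | inj₂ Wd = ⊥-elim (proj₂ (trade-crossing Wa Wb Wd (<⇒≢ lt) (contract-separated (separated F) {W ⊕ b ⊖ d} {W ⊕ a} (R-∈ {S = W ⊕ b ⊖ d} C dr) (R-∈ {S = W ⊕ a} C p))) lt b<d)
  where
  b<d : b < d
  b<d = R⊴L (separated F) dr l (ℕₚ.≤-reflexive (sym (ℕₚ.suc-injective (trans (size-⊖ d∈) (size-⊕ Wb)))))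
          (⊖-∋ (∌-≢ Wb Wd) (⊕-here W b) , Wb) (Wd , ⊖-here _ d)
horizontal {suc n} {inside ∷ W} {suc a} {suc b} {C} F (there Wa) (there Wb) (s≤s lt) p q | right m b<m Wm r with side {S = W ⊕ m} C r
... | inj₁ r′ = right (suc m) (s≤s b<m) (there Wm) r′
... | inj₂ l with path-between F Wb Wm b<m q l
...   | s , sr , sl , e , upper refl = right (suc m) (s≤s b<m) (there Wm) sr
...   | s , sr , sl , e , inner k b<k k<m Wk refl = right (suc k) (s≤s b<k) (there Wk) sr
...   | s , sr , sl , e , outer d b<d d<m Wd refl = ⊥-elim (no4 (contract-separated (separated F) {W ⊕ a} {s} (R-∈ {S = W ⊕ a} C p) (R-∈ {S = s} C sr))
        lt b<d d<m
        (⊕-here W a , ⊖-∌ d (⊕-∌ (<⇒≢ (<-trans lt (<-trans b<d d<m))) (⊕-∌ (<⇒≢ lt) Wa)))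
        (⊖-∋ (<⇒≢ b<d) (⊕-∋ m (⊕-here W b)) , ⊕-∌ (>⇒≢ lt) Wb)
        (⊕-∋ a Wd , ⊖-here _ d)
        (⊖-∋ (>⇒≢ d<m) (⊕-here _ m) , ⊕-∌ (>⇒≢ (<-trans lt b<m)) Wm))
...   | s , sr , sl , e , lower refl with path-down F sr sl (subst (0 ℕ.<_) (sym (size-⊕ Wb)) (s≤s z≤n))
...     | d , d∈ , dr with ⊕-∋⁻ d∈
...       | inj₁ refl = apex (subst (_∈ᶜ R C) (⊕-⊖ Wb) dr)
...       | inj₂ Wd with <-cmp d b
...         | tri≈ _ refl _ = ⊥-elim (∋∌ Wd Wb)
...         | tri< d<b _ _ = ⊥-elim (proj₁ (trade-crossing Wm Wb Wd (>⇒≢ b<m) (contract-separated (separated F) {W ⊕ b ⊖ d} {W ⊕ m} (R-∈ {S = W ⊕ b ⊖ d} C dr) (L-∈ {S = W ⊕ m} C l))) d<b b<m)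
...         | tri> _ _ b<d = ⊥-elim (proj₂ (trade-crossing Wa Wb Wd (<⇒≢ lt) (contract-separated (separated F) {W ⊕ b ⊖ d} {W ⊕ a} (R-∈ {S = W ⊕ b ⊖ d} C dr) (R-∈ {S = W ⊕ a} C p))) lt b<d)
horizontal {suc n} {outside ∷ X} {zero} {suc b} {C} F here (there Xb) lt p q with L C X in eq
... | true = apex eq
... | false with after (contract-full F) Xb (R-∈ {S = X} C p) (L-∈ {S = X ⊕ b} C q)
...   | raise m b<m Xm r = right (suc m) (s≤s b<m) (there Xm) (L-closed-raise F Xm Xb b<m q r)
...   | final f g with path F (∣p∣≤n X)
...     | s , sr , sl , e = ⊥-elim (true≢false (subst (_∈ᶜ L C) (sym (final-⊴ g f (sym e) (R⊴L (separated F) p sl (ℕₚ.≤-reflexive e)))) sl) eq)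
horizontal {suc n} {outside ∷ X} {zero} {suc b} {C} F here (there Xb) lt p q | false | trade c c<b Xc r with side {S = X ⊕ b ⊖ c} C r
... | inj₁ r′ = mid (suc c) (s≤s z≤n) (s≤s c<b) (there Xc) r′
... | inj₂ l with trade-between F Xc Xb c<b p (L-∈ {S = X ⊕ b} C q) l
...   | inj₁ Xl = ⊥-elim (true≢false Xl eq)
...   | inj₂ (d , d<b , Xd , r″) = mid (suc d) (s≤s z≤n) (s≤s d<b) (there Xd) r″
horizontal {suc n} {outside ∷ X} {suc a} {suc b} {C} F (there Xa) (there Xb) (s≤s lt) p q
  with horizontal (contract-full F) Xa Xb lt (L-∈ {S = X ⊕ a} C p) (L-∈ {S = X ⊕ b} C q)
... | right m b<m Xm r = right (suc m) (s≤s b<m) (there Xm) (L-closed-raise F Xm Xb b<m q r)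
... | apex r with side {S = X} C r
-- The apex of the contraction reappears with the first element added, as a vertex to the left.
...   | inj₁ r′ = left zero (s≤s z≤n) here r′
...   | inj₂ l = apex l
horizontal {suc n} {outside ∷ X} {suc a} {suc b} {C} F (there Xa) (there Xb) (s≤s lt) p q | mid c a<c c<b Xc r with side {S = X ⊕ a ⊕ b ⊖ c} C r
... | inj₂ l = mid (suc c) (s≤s a<c) (s≤s c<b) (there Xc) l
... | inj₁ r′ = ⊥-elim (<-asym c<b (R⊴L (separated F) r′ p
        (ℕₚ.≤-reflexive (sym (ℕₚ.suc-injective (trans (size-⊖ (⊕-∋ b (⊕-∋ a Xc))) (size-⊕ (⊕-∌ (>⇒≢ lt) Xb))))))
        (⊖-∋ (>⇒≢ c<b) (⊕-here _ b) , ⊕-∌ (>⇒≢ lt) Xb) (⊕-∋ a Xc , ⊖-here _ c)))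
horizontal {suc n} {outside ∷ X} {suc a} {suc b} {C} F (there Xa) (there Xb) (s≤s lt) p q | left m m<a Xm r with side {S = X ⊕ m} C r
... | inj₂ l = left (suc m) (s≤s m<a) (there Xm) l
... | inj₁ r′ with path-between F Xm Xa m<a r′ p
...   | s , sr , sl , e , lower refl = left (suc m) (s≤s m<a) (there Xm) sl
...   | s , sr , sl , e , inner k m<k k<a Xk refl = left (suc k) (s≤s k<a) (there Xk) sl
...   | s , sr , sl , e , outer d m<d d<a Xd refl = ⊥-elim (no4 (contract-separated (separated F) {s} {X ⊕ b} (R-∈ {S = s} C sr) (L-∈ {S = X ⊕ b} C q))
        m<d d<a lt
        (⊖-∋ (<⇒≢ m<d) (⊕-∋ a (⊕-here X m)) , ⊕-∌ (<⇒≢ (<-trans m<a lt)) Xm)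
        (⊕-∋ b Xd , ⊖-here _ d)
        (⊖-∋ (>⇒≢ d<a) (⊕-here _ a) , ⊕-∌ (<⇒≢ lt) Xa)
        (⊕-here X b , ⊖-∌ d (⊕-∌ (>⇒≢ lt) (⊕-∌ (>⇒≢ (<-trans m<a lt)) Xb))))
-- The path passes through `X ⊕ a`. If it enters from X, the vertex with the first element added is
-- on the left; removal of another d would cross `X ⊕ m` for d after a, and `X ⊕ b` for d before a.
...   | s , sr , sl , e , upper refl with path-down F sr sl (subst (0 ℕ.<_) (sym (size-⊕ Xa)) (s≤s z≤n))
...     | d , d∈ , dr with ⊕-∋⁻ d∈
...       | inj₁ refl = left zero (s≤s z≤n) here (subst (_∈ᶜ R C) (⊕-⊖ Xa) dr)
...       | inj₂ Xd with <-cmp d a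
...         | tri≈ _ refl _ = ⊥-elim (∋∌ Xd Xa)
...         | tri> _ _ a<d = ⊥-elim (proj₂ (trade-crossing Xm Xa Xd (<⇒≢ m<a) (contract-separated (separated F) {X ⊕ a ⊖ d} {X ⊕ m} (R-∈ {S = X ⊕ a ⊖ d} C dr) (R-∈ {S = X ⊕ m} C r′))) m<a a<d)
...         | tri< d<a _ _ = ⊥-elim (proj₁ (trade-crossing Xb Xa Xd (>⇒≢ lt) (contract-separated (separated F) {X ⊕ a ⊖ d} {X ⊕ b} (R-∈ {S = X ⊕ a ⊖ d} C dr) (L-∈ {S = X ⊕ b} C q))) d<a lt)

-- Existence of lowering flips

⊖-comm : ∀ (S : Subset n) i j → S ⊖ i ⊖ j ≡ S ⊖ j ⊖ i
⊖-comm (x ∷ S) zero zero = refl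
⊖-comm (x ∷ S) zero (suc j) = refl
⊖-comm (x ∷ S) (suc i) zero = refl
⊖-comm (x ∷ S) (suc i) (suc j) = cong (x ∷_) (⊖-comm S i j)

⊴⇒sep : X ⊴ Y → Sep X Y
⊴⇒sep f = sep (λ _ b<c _ _ y x _ → <-asym b<c (f x y)) (λ a<b _ _ y x _ _ → <-asym a<b (f x y))
              (λ _ → ⊴⇒NoAlt3 f) (λ _ a<b _ y x _ → <-asym a<b (f x y))

insert : Subset n → Collection n → Collection n
insert Y C S with S ≟ˢ Y
... | yes _ = true
... | no _ = C S

insert-here : (Y : Subset n) (C : Collection n) → Y ∈ᶜ insert Y C
insert-here Y C with Y ≟ˢ Y
... | yes _ = refl
... | no ne = ⊥-elim (ne refl)

insert-there : (Y : Subset n) (C : Collection n) → S ≢ Y → insert Y C S ≡ C S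
insert-there {S = S} Y C ne with S ≟ˢ Y
... | yes e = ⊥-elim (ne e)
... | no _ = refl

insert-separated : {C : Collection n} → Separated C → (∀ {T} → T ∈ᶜ C → Sep Y T) → Separated (insert Y C)
insert-separated {Y = Y} sC h {A} {B} p q with A ≟ˢ Y | B ≟ˢ Y
... | yes refl | yes refl = Sep-refl
... | yes refl | no _ = h q
... | no _ | yes refl = Sep-sym (h p)
... | no _ | no _ = sC p q

#-insert : (C : Collection n) → C Y ≡ false → # (insert Y C) ≡ suc (# C)
#-insert {Y = Y} C e = weight-remove (λ _ → 1) {insert Y C} {C} Y (insert-here Y C) e λ S ne → sym (insert-there Y C ne)

-- One more separated set would exceed the bound N.
full-maximal : {C : Collection n} → Full C → (∀ {T} → T ∈ᶜ C → Sep Y T) → Y ∈ᶜ C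
full-maximal {Y = Y} {C} F h with C Y in eq
... | true = refl
... | false = ⊥-elim (ℕₚ.<⇒≱ (ℕₚ.≤-trans (s≤s (large F)) (ℕₚ.≤-reflexive (sym (#-insert C eq))))
    (#-≤-N {C = insert Y C} (insert-separated (separated F) h)))

latest : (P : Fin n → Bool) → (∃ λ M → P M ≡ true × (∀ {j} → M < j → P j ≡ false)) ⊎ (∀ j → P j ≡ false)
latest {zero} P = inj₂ λ ()
latest {suc n} P with latest (P ∘ suc)
... | inj₁ (M , p , f) = inj₁ (suc M , p , λ { {suc j} (s≤s lt) → f lt })
... | inj₂ f with P zero in eq
...   | true = inj₁ (zero , eq , λ { {suc j} _ → f j })
...   | false = inj₂ λ { zero → eq ; (suc j) → f j }

latest-from : (P : Fin n → Bool) {m : Fin n} → P m ≡ true →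
  ∃ λ M → P M ≡ true × (m ≡ M ⊎ m < M) × (∀ {j} → M < j → P j ≡ false)
latest-from P {m} p with latest P
... | inj₂ f = ⊥-elim (true≢false p (f m))
... | inj₁ (M , q , f) with <-cmp m M
...   | tri< lt _ _ = M , q , inj₂ lt , f
...   | tri≈ _ e _ = M , q , inj₁ e , f
...   | tri> _ _ gt = ⊥-elim (true≢false p (f gt))

-- In the notation W, i, j, k of a 3-flip, Z is Wij: the sets required are Wi, Wij, Wik and Wjk.
record Corner (C : Collection n) (Z : Subset n) : Set where
  constructor corner
  field
    {ci cj ck} : Fin n
    i<j : ci < cj
    j<k : cj < ck
    Zi : Z ∋ ci
    Zj : Z ∋ cj
    Zk : Z ∌ ck
    Z∈ : Z ∈ᶜ C
    Z-j : Z ⊖ cj ∈ᶜ C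
    Z-j+k : Z ⊖ cj ⊕ ck ∈ᶜ C
    Z-i+k : Z ⊖ ci ⊕ ck ∈ᶜ C

record LoweringFlip (C : Collection n) (h : ℕ) : Set where
  constructor flip
  field
    {base} : Subset n
    {fi fj fk} : Fin n
    i<j : fi < fj
    j<k : fj < fk
    ∌i : base ∌ fi
    ∌j : base ∌ fj
    ∌k : base ∌ fk
    level≡ : suc (suc ∣ base ∣) ≡ h
    +i : base ⊕ fi ∈ᶜ C
    +k : base ⊕ fk ∈ᶜ C
    +ij : base ⊕ fi ⊕ fj ∈ᶜ C
    +jk : base ⊕ fj ⊕ fk ∈ᶜ C
    +ik : base ⊕ fi ⊕ fk ∈ᶜ C

-- The sum of the positions of the elements, counted from 0: an element in position i lies in
-- exactly i proper tails.
rank : Subset n → ℕ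
rank [] = 0
rank (x ∷ S) = ∣ S ∣ + rank S

rank-⊕ : S ∌ i → rank (S ⊕ i) ≡ toℕ i + rank S
rank-⊕ here = refl
rank-⊕ {S = x ∷ S} {i = suc i} (there p) rewrite size-⊕ p | rank-⊕ p =
  cong suc (trans (sym (ℕₚ.+-assoc ∣ S ∣ _ _)) (trans (cong (_+ rank S) (ℕₚ.+-comm ∣ S ∣ _)) (ℕₚ.+-assoc (toℕ i) ∣ S ∣ (rank S))))

rank-⊖ : S ∋ i → toℕ i + rank (S ⊖ i) ≡ rank S
rank-⊖ {S = S} {i} p = trans (sym (rank-⊕ (⊖-here S i))) (cong rank (⊖-⊕ p))

rank-≤ : (S : Subset n) → rank S ≤ n ℕ.* n
rank-≤ [] = z≤n
rank-≤ {suc n} (x ∷ S) = ℕₚ.+-mono-≤ (ℕₚ.m≤n⇒m≤1+n (∣p∣≤n S)) (ℕₚ.≤-trans (rank-≤ S) (ℕₚ.*-monoʳ-≤ n (ℕₚ.n≤1+n n)))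

rank-replace : Z ∋ j → Z ∌ k → j < k → rank Z ℕ.< rank (Z ⊖ j ⊕ k)
rank-replace {Z = Z} {j} {k} Zj Zk lt = subst₂ ℕ._<_ (rank-⊖ Zj) (sym (rank-⊕ (⊖-∌ j Zk))) (ℕₚ.+-monoˡ-< (rank (Z ⊖ j)) lt)

module _ {C : Collection n} (F : Full C) where
  private
    sC = separated F

  -- Apply `horizontal` to the edge from Z to Z ⊖ c ⊕ M with M as large as possible; Z ⊖ k ∈ C excludes a
  -- further vertex to the left.
  rotate : Z ∈ᶜ C → Z ∋ k → Z ⊖ k ∈ᶜ C → Z ∋ c → c < k → Z ∌ l → c < l → Z ⊖ c ⊕ l ∈ᶜ C → C (Z ⊖ c) ≡ false →
    ∃ λ c′ → ∃ λ m′ → c < c′ × c′ < m′ × (c′ ≡ k ⊎ c′ < k) × Z ∋ c′ × Z ∌ m′ ×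
      Z ⊖ c′ ⊕ m′ ∈ᶜ C × Z ⊖ c ⊕ m′ ∈ᶜ C
  rotate {Z} {k} {c} {m} z Zk zk Zc c<k Zm c<m zcm zc∉
    with latest-from (λ m → C (Z ⊖ c ⊕ m) ∧ not (lookup Z m)) {m} (∧-intro zcm (cong not ([]=⇒lookup Zm)))
  ... | M , pM , m≤M , max = go (horizontal F (⊖-here Z c) (⊖-∌ c ZM) c<M (subst (_∈ᶜ C) (sym (⊖-⊕ Zc)) z) (proj₁ (∧-true pM)))
    where
    ZM : Z ∌ M
    ZM with mem? Z M
    ... | inj₂ q = q
    ... | inj₁ q = ⊥-elim (true≢false (proj₂ (∧-true {C (Z ⊖ c ⊕ M)} pM)) (cong not ([]=⇒lookup q)))
    c<M : c < M
    c<M = case m≤M of λ { (inj₁ refl) → c<m ; (inj₂ lt) → <-trans c<m lt }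
    go : Below C (Z ⊖ c) c M → _
    go (apex p) = ⊥-elim (true≢false p zc∉)
    go (left m″ lt ∌m″ p) = ⊥-elim (proj₂ (replace-crossing Zk Zc Zm″ (sC zk p)) lt c<k)
      where
      Zm″ = ⊖-∌⁻ (<⇒≢ lt) ∌m″
    go (right m″ lt ∌m″ p) = ⊥-elim (true≢false (∧-intro p (cong not ([]=⇒lookup (⊖-∌⁻ (>⇒≢ (<-trans c<M lt)) ∌m″)))) (max lt))
    go (mid c′ c<c′ c′<M ∋c′ p) = c′ , M , c<c′ , c′<M , le , Zc′ , ZM , zc′ , proj₁ (∧-true pM)
      where
      Zc′ = ⊖-∋⁻ ∋c′
      zc′ : Z ⊖ c′ ⊕ M ∈ᶜ C
      zc′ = subst (_∈ᶜ C) (trans (cong (λ U → U ⊕ M ⊖ c′) (⊖-⊕ Zc)) (sym (⊖-⊕-comm Z (∋-≢ Zc′ ZM)))) p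
      le : c′ ≡ k ⊎ c′ < k
      le with <-cmp c′ k
      ... | tri< lt _ _ = inj₂ lt
      ... | tri≈ _ e _ = inj₁ e
      ... | tri> _ _ gt = ⊥-elim (proj₁ (replace-crossing Zk Zc′ ZM (sC zk zc′)) gt c′<M)

  -- Each call of `rotate` moves c to a larger c′, which is at most k. The walk ends when Z ⊖ c′ is
  -- present, at k at the latest, and the last pair c, c′ forms the corner; `t` bounds the remaining
  -- distance.
  new-corner : ∀ t → toℕ k ≤ toℕ c + t → Z ∈ᶜ C → Z ∋ k → Z ⊖ k ∈ᶜ C → Z ∋ c → c < k → Z ∌ l → c < l →
    Z ⊖ c ⊕ l ∈ᶜ C → C (Z ⊖ c) ≡ false → Corner C Z
  new-corner {k = k} {c} zero le z Zk zk Zc c<k Zm c<m zcm zc∉ =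
    ⊥-elim (ℕₚ.<⇒≱ c<k (subst (toℕ k ≤_) (ℕₚ.+-identityʳ _) le))
  new-corner {k = k} {c} {Z} (suc t) le z Zk zk Zc c<k Zm c<m zcm zc∉ with rotate z Zk zk Zc c<k Zm c<m zcm zc∉
  ... | c′ , m′ , c<c′ , c′<m′ , le′ , Zc′ , Zm′ , p , q with C (Z ⊖ c′) in eq | le′
  ...   | true | _ = corner c<c′ c′<m′ Zc Zc′ Zm′ z eq p q
  ...   | false | inj₁ refl = ⊥-elim (true≢false zk eq)
  ...   | false | inj₂ c′<k = new-corner t
            (ℕₚ.≤-trans le (ℕₚ.≤-trans (ℕₚ.≤-reflexive (ℕₚ.+-suc _ t)) (ℕₚ.+-monoˡ-≤ t c<c′))) z Zk zk Zc′ c′<k Zm′ c′<m′ p eq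

  corner⇒flip : ∀ t → n ℕ.* n ℕ.< rank Z + t → Corner C Z → LoweringFlip C ∣ Z ∣
  corner⇒flip {Z} zero le _ = ⊥-elim (ℕₚ.<⇒≱ le (subst (_≤ n ℕ.* n) (sym (ℕₚ.+-identityʳ _)) (rank-≤ Z)))
  corner⇒flip {Z} (suc t) le (corner {i} {j} {k} i<j j<k Zi Zj Zk z zj zjk zik)
    with C (Z ⊖ j ⊕ k ⊖ i) in eq
  ... | true = flip i<j j<k (⊖-∌ j (⊖-here Z i)) (⊖-here _ j) (⊖-∌ j (⊖-∌ i Zk))
        (trans (cong suc (size-⊖ (⊖-∋ (>⇒≢ i<j) Zj))) (size-⊖ Zi))
        (subst (_∈ᶜ C) (sym ei) zj)
        (subst (_∈ᶜ C) (trans (sym (⊖-⊕-comm (Z ⊖ j) (<⇒≢ (<-trans i<j j<k)))) (cong (_⊕ k) (⊖-comm Z j i))) eq)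
        (subst (_∈ᶜ C) (sym (trans (cong (_⊕ j) ei) (⊖-⊕ Zj))) z)
        (subst (_∈ᶜ C) (sym (cong (_⊕ k) (⊖-⊕ (⊖-∋ (>⇒≢ i<j) Zj)))) zik)
        (subst (_∈ᶜ C) (sym (cong (_⊕ k) ei)) zjk)
    where
    ei : Z ⊖ i ⊖ j ⊕ i ≡ Z ⊖ j
    ei = trans (cong (_⊕ i) (⊖-comm Z i j)) (⊖-⊕ (⊖-∋ (<⇒≢ i<j) Zi))
  -- With Wk missing, Wik takes the place of Z in `new-corner`: removing k gives Wi, which is
  -- present, removing i gives the absent Wk, and Wjk is Wk with j added. The rank grows because k
  -- replaces j.
  ... | false = subst (LoweringFlip C) (trans (size-⊕ (⊖-∌ j Zk)) (size-⊖ Zj))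
        (corner⇒flip t (ℕₚ.<-≤-trans le (ℕₚ.≤-trans (ℕₚ.≤-reflexive (ℕₚ.+-suc (rank Z) t)) (ℕₚ.+-monoˡ-≤ t (rank-replace Zj Zk j<k))))
          (new-corner (toℕ k) (ℕₚ.m≤n+m _ _) zjk (⊕-here _ k) (subst (_∈ᶜ C) (sym (⊕-⊖ (⊖-∌ j Zk))) zj)
            (⊕-∋ k (⊖-∋ (<⇒≢ i<j) Zi)) (<-trans i<j j<k) (⊕-∌ (<⇒≢ j<k) (⊖-here Z j)) i<j
            (subst (_∈ᶜ C) (sym e) zik) eq))
    where
    e : Z ⊖ j ⊕ k ⊖ i ⊕ j ≡ Z ⊖ i ⊕ k
    e = trans (cong (_⊕ j) (trans (sym (⊖-⊕-comm (Z ⊖ j) (<⇒≢ (<-trans i<j j<k)))) (cong (_⊕ k) (⊖-comm Z j i))))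
        (trans (⊕-comm (Z ⊖ i ⊖ j) k j) (cong (_⊕ k) (⊖-⊕ (⊖-∋ (>⇒≢ i<j) Zj))))

-- Intervals and the start of the walk

Convex : Subset n → Set
Convex S = ∀ {a b c} → a < b → b < c → S ∋ a → S ∋ c → S ∋ b

convex-sep : Convex X → ∣ Y ∣ ≤ ∣ X ∣ → Sep X Y
convex-sep cx = noAlt3⇒sep λ a<b b<c p q r → ∋∌ (cx a<b b<c (proj₁ p) (proj₁ r)) (proj₂ q)

-- {t, …, t + h - 1}, cut off at n
seg : ℕ → ℕ → Subset n
seg {zero} t h = []
seg {suc n} (suc t) h = outside ∷ seg t h
seg {suc n} zero (suc h) = inside ∷ seg zero h
seg {suc n} zero zero = outside ∷ seg zero zero

seg-∋ : ∀ {t h} {i : Fin n} → t ≤ toℕ i → toℕ i ℕ.< t + h → seg t h ∋ i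
seg-∋ {t = zero} {suc h} {zero} p q = here
seg-∋ {t = zero} {suc h} {suc i} p (s≤s q) = there (seg-∋ z≤n q)
seg-∋ {t = suc t} {h} {suc i} (s≤s p) (s≤s q) = there (seg-∋ p q)

seg-∌ : ∀ {t h} {i : Fin n} → toℕ i ℕ.< t ⊎ t + h ≤ toℕ i → seg t h ∌ i
seg-∌ {t = suc t} {h} {zero} p = here
seg-∌ {t = suc t} {h} {suc i} (inj₁ (s≤s p)) = there (seg-∌ (inj₁ p))
seg-∌ {t = suc t} {h} {suc i} (inj₂ (s≤s p)) = there (seg-∌ {t = t} (inj₂ p))
seg-∌ {t = zero} {zero} {zero} p = here
seg-∌ {t = zero} {zero} {suc i} p = there (seg-∌ {t = zero} {zero} {i} (inj₂ z≤n))
seg-∌ {t = zero} {suc h} {suc i} (inj₂ (s≤s p)) = there (seg-∌ {t = zero} (inj₂ p))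

seg-∋⁻ : ∀ {t h} {i : Fin n} → seg t h ∋ i → t ≤ toℕ i × toℕ i ℕ.< t + h
seg-∋⁻ {t = t} {h} {i} p with ℕₚ.≤-<-connex t (toℕ i) | ℕₚ.≤-<-connex (t + h) (toℕ i)
... | inj₂ lt | _ = ⊥-elim (∋∌ p (seg-∌ (inj₁ lt)))
... | inj₁ le | inj₁ le′ = ⊥-elim (∋∌ p (seg-∌ {t = t} (inj₂ le′)))
... | inj₁ le | inj₂ lt = le , lt

seg-convex : ∀ {t h} → Convex {n} (seg t h)
seg-convex {t = t} a<b b<c p q = seg-∋ (ℕₚ.≤-trans (proj₁ (seg-∋⁻ {t = t} p)) (ℕₚ.<⇒≤ a<b)) (ℕₚ.<-trans b<c (proj₂ (seg-∋⁻ {t = t} q)))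

seg-size-≤ : ∀ t h → ∣ seg {n} t h ∣ ≤ h
seg-size-≤ {zero} t h = z≤n
seg-size-≤ {suc n} (suc t) h = seg-size-≤ {n} t h
seg-size-≤ {suc n} zero (suc h) = s≤s (seg-size-≤ {n} zero h)
seg-size-≤ {suc n} zero zero = seg-size-≤ {n} zero zero

seg-size : ∀ t h → t + h ≤ n → ∣ seg {n} t h ∣ ≡ h
seg-size {zero} zero zero le = refl
seg-size {suc n} (suc t) h (s≤s le) = seg-size {n} t h le
seg-size {suc n} zero (suc h) (s≤s le) = cong suc (seg-size {n} zero h le)
seg-size {suc n} zero zero le = seg-size {n} zero zero z≤n

seg-⊕-last : ∀ {t h} {i : Fin n} → toℕ i ≡ t + h → seg t h ⊕ i ≡ seg t (suc h)
seg-⊕-last {n} {t} {h} {i} e = ⊑-antisym f g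
  where
  f : seg t h ⊕ i ⊑ seg t (suc h)
  f {j} p with ⊕-∋⁻ p
  ... | inj₁ refl = seg-∋ (subst (t ≤_) (sym e) (ℕₚ.m≤m+n t h)) (ℕₚ.≤-reflexive (trans (cong suc e) (sym (ℕₚ.+-suc t h))))
  ... | inj₂ q = seg-∋ (proj₁ (seg-∋⁻ {t = t} q)) (ℕₚ.<-≤-trans (proj₂ (seg-∋⁻ {t = t} q)) (ℕₚ.+-monoʳ-≤ t (ℕₚ.n≤1+n h)))
  g : seg t (suc h) ⊑ seg t h ⊕ i
  g {j} p with seg-∋⁻ {t = t} p | j ≟ᶠ i
  ... | _ | yes refl = ⊕-here _ i
  ... | le , lt | no j≢i = ⊕-∋ i (seg-∋ le (ℕₚ.≤∧≢⇒< (ℕₚ.≤-pred (subst (toℕ j ℕ.<_) (ℕₚ.+-suc t h) lt)) λ e′ → j≢i (toℕ-injective (trans e′ (sym e)))))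

seg-⊖-first : ∀ {t h} {i : Fin n} → toℕ i ≡ t → seg t (suc h) ⊖ i ≡ seg (suc t) h
seg-⊖-first {n} {t} {h} {i} e = ⊑-antisym f g
  where
  f : seg t (suc h) ⊖ i ⊑ seg (suc t) h
  f {j} p with seg-∋⁻ {t = t} (⊖-∋⁻ p)
  ... | le , lt = seg-∋ (ℕₚ.≤∧≢⇒< le λ e′ → ∋-≢ p (⊖-here _ i) (toℕ-injective (trans (sym e′) (sym e)))) (subst (toℕ j ℕ.<_) (ℕₚ.+-suc t h) lt)
  g : seg (suc t) h ⊑ seg t (suc h) ⊖ i
  g {j} p with seg-∋⁻ {t = suc t} p
  ... | le , lt = ⊖-∋ (λ { refl → ℕₚ.<-irrefl (sym e) le }) (seg-∋ (ℕₚ.<⇒≤ le) (subst (toℕ j ℕ.<_) (sym (ℕₚ.+-suc t h)) lt))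

earliest : (P : Fin n → Bool) {m : Fin n} → P m ≡ true → ∃ λ M → P M ≡ true × (∀ {j} → j < M → P j ≡ false)
earliest {suc n} P {m} p with P zero in eq
... | true = zero , eq , λ ()
earliest {suc n} P {zero} p | false = ⊥-elim (true≢false p eq)
earliest {suc n} P {suc m} p | false with earliest (P ∘ suc) {m} p
... | M , q , f = suc M , q , λ { {zero} _ → eq ; {suc j} (s≤s lt) → f lt }

module _ {C : Collection n} (F : Full C) {h : ℕ} (above : ∀ {T} → T ∈ᶜ C → h ℕ.< ∣ T ∣ → Convex T) where

  -- A convex set is separated from every set that is not larger, and the larger members are convex
  -- themselves; so maximality of C applies.
  convex-∈ : Convex S → ∣ S ∣ ≡ h → S ∈ᶜ C
  convex-∈ {S} cS e = full-maximal F λ {T} T∈ → case ℕₚ.≤-<-connex ∣ T ∣ h of λ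
    { (inj₁ le) → convex-sep cS (ℕₚ.≤-trans le (ℕₚ.≤-reflexive (sym e)))
    ; (inj₂ lt) → Sep-sym (convex-sep (above T∈ lt) (ℕₚ.≤-trans (ℕₚ.≤-reflexive e) (ℕₚ.<⇒≤ lt))) }

  -- A prefix precedes every set in the order `⊴`.
  prefix-∈ : ∀ l → seg 0 l ∈ᶜ C
  prefix-∈ l = full-maximal F λ _ → ⊴⇒sep λ {i} {j} p q → ℕₚ.<-≤-trans (proj₂ (seg-∋⁻ {t = 0} (proj₁ p)))
    (case ℕₚ.≤-<-connex l (toℕ j) of λ { (inj₁ le) → le ; (inj₂ lt) → ⊥-elim (∋∌ (seg-∋ z≤n lt) (proj₂ q)) })

  -- Intervals of h - 1 elements are tested leftwards from the missing one. Prefixes are in C, so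
  -- somewhere a present interval is followed directly by a missing one. Their union Z and its shift
  -- by one to the right are intervals of size h, in C by `convex-∈`, and this is the input of
  -- `new-corner`.
  missing-corner : ∀ {l} t → h ≡ suc (suc l) → t + h ℕ.< n → C (seg (suc t) (suc l)) ≡ false →
    ∃ λ Z → ∣ Z ∣ ≡ h × Corner C Z
  missing-corner {l} t refl lt ∉ with C (seg t (suc l)) in eq
  missing-corner {l} zero refl lt ∉ | false = ⊥-elim (true≢false (prefix-∈ (suc l)) eq)
  missing-corner {l} (suc t) refl lt ∉ | false = missing-corner t refl (ℕₚ.<-trans (ℕₚ.n<1+n _) lt) eq
  missing-corner {l} t refl lt ∉ | true = seg t (2 + l) , size-Z ,
    new-corner F {k = κ} {γ} {l = μ} (toℕ κ) (ℕₚ.m≤n+m _ _) (convex-∈ (seg-convex {t = t}) size-Z)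
      (seg-∋ (subst (t ≤_) (sym κ≡) (ℕₚ.m≤m+n t (suc l))) (ℕₚ.≤-reflexive (trans (cong suc κ≡) (sym (ℕₚ.+-suc t (suc l))))))
      (subst (_∈ᶜ C) (sym Z-k) eq)
      (seg-∋ (ℕₚ.≤-reflexive (sym γ≡)) (subst (ℕ._< t + (2 + l)) (sym γ≡) (ℕₚ.m<m+n t (s≤s z≤n))))
      (subst₂ ℕ._<_ (sym γ≡) (sym κ≡) (ℕₚ.m<m+n t (s≤s z≤n)))
      (seg-∌ {t = t} (inj₂ (ℕₚ.≤-reflexive (sym μ≡))))
      (subst₂ ℕ._<_ (sym γ≡) (sym μ≡) (ℕₚ.m<m+n t (s≤s z≤n)))
      (subst (_∈ᶜ C) (sym (trans (cong (_⊕ μ) (seg-⊖-first {t = t} {suc l} γ≡)) (seg-⊕-last {t = suc t} (trans μ≡ (ℕₚ.+-suc t (suc l)))))) 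
        (convex-∈ (seg-convex {t = suc t}) (seg-size {n} (suc t) (2 + l) lt)))
      (subst (λ U → C U ≡ false) (sym (seg-⊖-first {t = t} {suc l} γ≡)) ∉)
    where
    κ<n : t + suc l ℕ.< n
    κ<n = ℕₚ.<-trans (ℕₚ.+-monoʳ-< t (ℕₚ.n<1+n (suc l))) lt
    γ<n : t ℕ.< n
    γ<n = ℕₚ.≤-<-trans (ℕₚ.m≤m+n t (suc l)) κ<n
    κ μ γ : Fin n
    κ = fromℕ< κ<n
    μ = fromℕ< lt
    γ = fromℕ< γ<n
    κ≡ = toℕ-fromℕ< κ<n
    μ≡ = toℕ-fromℕ< lt
    γ≡ = toℕ-fromℕ< γ<n
    size-Z = seg-size {n} t (2 + l) (ℕₚ.<⇒≤ lt)
    Z-k : seg t (2 + l) ⊖ κ ≡ seg t (suc l)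
    Z-k = trans (cong (_⊖ κ) (sym (seg-⊕-last {t = t} κ≡))) (⊕-⊖ (seg-∌ {t = t} (inj₂ (ℕₚ.≤-reflexive (sym κ≡)))))

  -- Let o and M be the least and greatest elements of Y. The interval of h - 1 elements after o
  -- ends before M and by counting contains some x outside Y. It cannot be in C, since the larger
  -- set Y would alternate with it at o, x, M; so `missing-corner` applies.
  lowering-flip : Y ∈ᶜ C → ∣ Y ∣ ≡ h → a < b → b < c → Y ∋ a → Y ∌ b → Y ∋ c → LoweringFlip C h
  lowering-flip {Y} {a} {b} {c} Y∈ e a<b b<c Ya Yb Yc
    with earliest (lookup Y) ([]=⇒lookup Ya) | latest-from (lookup Y) ([]=⇒lookup Yc)
  ... | o , o∈ , first | M , M∈ , c≤M , last = finish (cornered h refl)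
    where
    Yo = lookup⇒[]= o Y o∈
    YM = lookup⇒[]= M Y M∈
    far : toℕ o + h ≤ toℕ M
    far with ℕₚ.≤-<-connex (toℕ o + h) (toℕ M)
    ... | inj₁ le = le
    -- A set of h elements inside a window of h positions is the whole window, hence convex.
    ... | inj₂ lt = ⊥-elim (∋∌ (subst (_∋ b) (sym Y≡) (seg-convex {t = toℕ o} {h} a<b b<c (subst (_∋ a) Y≡ Ya) (subst (_∋ c) Y≡ Yc))) Yb)
      where
      Y⊑ : Y ⊑ seg (toℕ o) h
      Y⊑ {i} p with <-cmp i o | <-cmp M i
      ... | tri< i<o _ _ | _ = ⊥-elim (true≢false ([]=⇒lookup p) (first i<o))
      ... | _ | tri< M<i _ _ = ⊥-elim (true≢false ([]=⇒lookup p) (last M<i))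
      ... | tri≈ _ refl _ | tri≈ _ refl _ = seg-∋ ℕₚ.≤-refl lt
      ... | tri≈ _ refl _ | tri> _ _ i<M = seg-∋ ℕₚ.≤-refl (ℕₚ.<-trans i<M lt)
      ... | tri> _ _ o<i | tri≈ _ refl _ = seg-∋ (ℕₚ.<⇒≤ o<i) lt
      ... | tri> _ _ o<i | tri> _ _ i<M = seg-∋ (ℕₚ.<⇒≤ o<i) (ℕₚ.<-trans i<M lt)
      Y≡ : Y ≡ seg (toℕ o) h
      Y≡ = ⊑-size-≡ Y⊑ (subst (∣ seg {n} (toℕ o) h ∣ ≤_) (sym e) (seg-size-≤ {n} (toℕ o) h))
    finish : (∃ λ Z → ∣ Z ∣ ≡ h × Corner C Z) → LoweringFlip C h
    finish (Z , eZ , co) = subst (LoweringFlip C) eZ (corner⇒flip F (suc (n ℕ.* n)) (ℕₚ.m≤n+m _ (rank Z)) co)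
    cornered : ∀ h′ → h ≡ h′ → ∃ λ Z → ∣ Z ∣ ≡ h × Corner C Z
    cornered zero refl = case trans (size-⊖ Ya) e of λ ()
    cornered (suc h₁) refl with diff? (seg (suc (toℕ o)) h₁) Y
    ... | inj₂ J⊑Y = ⊥-elim (ℕₚ.<-irrefl refl (ℕₚ.≤-trans (ℕₚ.≤-reflexive (sym size+)) (ℕₚ.≤-trans (⊑-size (⊑-⊕ (⊑-⊕ J⊑Y Yo) YM)) (ℕₚ.≤-reflexive e))))
      where
      J∌o : seg (suc (toℕ o)) h₁ ∌ o
      J∌o = seg-∌ (inj₁ ℕₚ.≤-refl)
      J∌M : seg (suc (toℕ o)) h₁ ∌ M
      J∌M = seg-∌ {t = suc (toℕ o)} (inj₂ (subst (_≤ toℕ M) (ℕₚ.+-suc (toℕ o) h₁) far))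
      o<M : o < M
      o<M = ℕₚ.<-≤-trans (ℕₚ.m<m+n (toℕ o) (s≤s z≤n)) far
      size+ : ∣ seg (suc (toℕ o)) h₁ ⊕ o ⊕ M ∣ ≡ suc (suc h₁)
      size+ = trans (size-⊕ (⊕-∌ (>⇒≢ o<M) J∌M)) (cong suc (trans (size-⊕ J∌o)
        (cong suc (seg-size {n} (suc (toℕ o)) h₁ (ℕₚ.≤-trans (subst (_≤ toℕ M) (ℕₚ.+-suc (toℕ o) h₁) far) (ℕₚ.<⇒≤ (toℕ<n M)))))))
    ... | inj₁ (x , Jx , Yx) with C (seg (suc (toℕ o)) h₁) in eq
    ...   | true = ⊥-elim (no3 (separated F Y∈ eq) (subst (∣ seg {n} (suc (toℕ o)) h₁ ∣ ℕ.<_) (sym e) (s≤s (seg-size-≤ {n} (suc (toℕ o)) h₁)))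
              (proj₁ (seg-∋⁻ {t = suc (toℕ o)} Jx)) (ℕₚ.<-≤-trans (proj₂ (seg-∋⁻ {t = suc (toℕ o)} Jx)) (subst (_≤ toℕ M) (ℕₚ.+-suc (toℕ o) h₁) far))
              (Yo , seg-∌ (inj₁ ℕₚ.≤-refl)) (Jx , Yx) (YM , seg-∌ {t = suc (toℕ o)} (inj₂ (subst (_≤ toℕ M) (ℕₚ.+-suc (toℕ o) h₁) far))))
    cornered (suc zero) refl | inj₁ (x , Jx , Yx) | false =
      ⊥-elim (ℕₚ.<⇒≱ (proj₂ (seg-∋⁻ {t = suc (toℕ o)} Jx)) (subst (_≤ toℕ x) (sym (ℕₚ.+-identityʳ _)) (proj₁ (seg-∋⁻ {t = suc (toℕ o)} Jx))))
    cornered (suc (suc l)) refl | inj₁ (x , Jx , Yx) | false = missing-corner (toℕ o) refl (ℕₚ.≤-<-trans far (toℕ<n M)) eq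

-- The standard collection

-- Recognisers of 0*, 1*, 1*0*, 0*1*, 0*1*0*, 1*0*1* and 1*0*1*0*.
zeros ones initial terminal interval cointerval split : Subset n → Bool
zeros [] = true
zeros (b ∷ S) = not b ∧ zeros S
ones [] = true
ones (b ∷ S) = b ∧ ones S
initial [] = true
initial (true ∷ S) = initial S
initial (false ∷ S) = zeros S
terminal [] = true
terminal (true ∷ S) = ones S
terminal (false ∷ S) = terminal S
interval [] = true
interval (true ∷ S) = initial S
interval (false ∷ S) = interval S
cointerval [] = true
cointerval (true ∷ S) = cointerval S
cointerval (false ∷ S) = terminal S
split [] = true
split (true ∷ S) = split S
split (false ∷ S) = interval S

zeros-∌ : zeros S ≡ true → S ∋ i → ⊥
zeros-∌ {S = false ∷ S} z (there p) = zeros-∌ z p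

zeros⁺ : (∀ {i} → S ∋ i → ⊥) → zeros S ≡ true
zeros⁺ {S = []} f = refl
zeros⁺ {S = true ∷ S} f = ⊥-elim (f here)
zeros⁺ {S = false ∷ S} f = zeros⁺ (f ∘ there)

zeros⇒interval : zeros S ≡ true → interval S ≡ true
zeros⇒interval {S = []} z = refl
zeros⇒interval {S = false ∷ S} z = zeros⇒interval {S = S} z

size0⇒interval : (S : Subset n) → ∣ S ∣ ≡ 0 → interval S ≡ true
size0⇒interval [] e = refl
size0⇒interval (false ∷ S) e = size0⇒interval S e

initial⇒interval : initial S ≡ true → interval S ≡ true
initial⇒interval {S = []} p = refl
initial⇒interval {S = true ∷ S} p = p
initial⇒interval {S = false ∷ S} p = zeros⇒interval {S = S} p

initial⇒split : initial S ≡ true → split S ≡ true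
initial⇒split {S = []} p = refl
initial⇒split {S = true ∷ S} p = initial⇒split {S = S} p
initial⇒split {S = false ∷ S} p = zeros⇒interval {S = S} p

interval⇒split : interval S ≡ true → split S ≡ true
interval⇒split {S = []} p = refl
interval⇒split {S = true ∷ S} p = initial⇒split {S = S} p
interval⇒split {S = false ∷ S} p = p

ones⇒initial : ones S ≡ true → initial S ≡ true
ones⇒initial {S = []} p = refl
ones⇒initial {S = true ∷ S} p = ones⇒initial {S = S} p

terminal⇒interval : terminal S ≡ true → interval S ≡ true
terminal⇒interval {S = []} p = refl
terminal⇒interval {S = true ∷ S} p = ones⇒initial {S = S} p
terminal⇒interval {S = false ∷ S} p = terminal⇒interval {S = S} p

initial-down : initial S ≡ true → i < j → S ∋ j → S ∋ i
initial-down {S = true ∷ S} {zero} p lt q = here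
initial-down {S = true ∷ S} {suc i} {suc j} p (s≤s lt) (there q) = there (initial-down p lt q)
initial-down {S = false ∷ S} p lt (there q) = ⊥-elim (zeros-∌ p q)

initial⁺ : (∀ {i j} → i < j → S ∋ j → S ∋ i) → initial S ≡ true
initial⁺ {S = []} f = refl
initial⁺ {S = true ∷ S} f = initial⁺ λ lt p → case f (s≤s lt) (there p) of λ { (there q) → q }
initial⁺ {S = false ∷ S} f = zeros⁺ λ p → case f {zero} (s≤s z≤n) (there p) of λ ()

interval-convex : interval S ≡ true → Convex S
interval-convex {S = false ∷ S} p {suc _} {suc _} {suc _} (s≤s a<b) (s≤s b<c) (there u) (there v) = there (interval-convex p a<b b<c u v)
interval-convex {S = true ∷ S} p {_} {suc _} {suc _} _ (s≤s b<c) _ (there v) = there (initial-down p b<c v)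

convex-interval : Convex S → interval S ≡ true
convex-interval {S = []} f = refl
convex-interval {S = false ∷ S} f = convex-interval λ a<b b<c p q → case f (s≤s a<b) (s≤s b<c) (there p) (there q) of λ { (there r) → r }
convex-interval {S = true ∷ S} f = initial⁺ λ lt p → case f {zero} (s≤s z≤n) (s≤s lt) here (there p) of λ { (there r) → r }

ones-∋ : ones S ≡ true → ∀ i → S ∋ i
ones-∋ {S = true ∷ S} p zero = here
ones-∋ {S = true ∷ S} p (suc i) = there (ones-∋ p i)

terminal-down : terminal S ≡ true → i < j → S ∌ j → S ∌ i
terminal-down {S = true ∷ S} {i} p lt (there q) = ⊥-elim (∋∌ (ones-∋ p _) q)
terminal-down {S = false ∷ S} {zero} p lt q = here
terminal-down {S = false ∷ S} {suc i} {suc j} p (s≤s lt) (there q) = there (terminal-down p lt q)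

cointerval-coconvex : cointerval S ≡ true → a < b → b < c → S ∌ a → S ∌ c → S ∌ b
cointerval-coconvex {S = true ∷ S} {suc _} {suc _} {suc _} p (s≤s a<b) (s≤s b<c) (there u) (there v) = there (cointerval-coconvex p a<b b<c u v)
cointerval-coconvex {S = false ∷ S} {_} {suc _} {suc _} p _ (s≤s b<c) _ (there v) = there (terminal-down p b<c v)

interval-sep : interval X ≡ true → ∣ Y ∣ ≤ ∣ X ∣ → Sep X Y
interval-sep p = convex-sep (interval-convex p)

cointerval-sep : cointerval Y ≡ true → ∣ Y ∣ ≤ ∣ X ∣ → Sep X Y
cointerval-sep p = noAlt3⇒sep λ a<b b<c u v w → ∋∌ (proj₁ v) (cointerval-coconvex p a<b b<c (proj₂ u) (proj₂ w))

-- After common leading ones are stripped, one of the two sets lacks the next element, and what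
-- remains of it is an interval.
split-noAlt3 : split X ≡ true → split Y ≡ true → NoAlt3 X Y ⊎ NoAlt3 Y X
split-noAlt3 {X = []} {[]} _ _ = inj₁ λ { {()} }
split-noAlt3 {X = false ∷ X} p q = inj₁ λ a<b b<c u v w → ∋∌ (interval-convex {S = false ∷ X} p a<b b<c (proj₁ u) (proj₁ w)) (proj₂ v)
split-noAlt3 {X = true ∷ X} {false ∷ Y} p q = inj₂ λ a<b b<c u v w → ∋∌ (interval-convex {S = false ∷ Y} q a<b b<c (proj₁ u) (proj₁ w)) (proj₂ v)
split-noAlt3 {X = true ∷ X} {true ∷ Y} p q with split-noAlt3 {X = X} {Y} p q
... | inj₁ f = inj₁ λ { {suc _} {suc _} {suc _} (s≤s l) (s≤s l′) (there u , there u′) (there v , there v′) (there w , there w′) → f l l′ (u , u′) (v , v′) (w , w′) }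
... | inj₂ f = inj₂ λ { {suc _} {suc _} {suc _} (s≤s l) (s≤s l′) (there u , there u′) (there v , there v′) (there w , there w′) → f l l′ (u , u′) (v , v′) (w , w′) }

-- The standard full collection: intervals above level k, 𝓘𝓢 on level k, cointervals below.
J : ℕ → Collection n
J k S with ℕₚ.<-cmp ∣ S ∣ k
... | tri< _ _ _ = cointerval S
... | tri≈ _ _ _ = split S
... | tri> _ _ _ = interval S

J-below : ∀ {k} (S : Subset n) → ∣ S ∣ ℕ.< k → J k S ≡ cointerval S
J-below {k = k} S lt with ℕₚ.<-cmp ∣ S ∣ k
... | tri< _ _ _ = refl
... | tri≈ _ e _ = ⊥-elim (ℕₚ.<-irrefl e lt)
... | tri> _ _ gt = ⊥-elim (ℕₚ.<-asym lt gt)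

J-at : ∀ {k} (S : Subset n) → ∣ S ∣ ≡ k → J k S ≡ split S
J-at {k = k} S e with ℕₚ.<-cmp ∣ S ∣ k
... | tri< lt _ _ = ⊥-elim (ℕₚ.<-irrefl e lt)
... | tri≈ _ _ _ = refl
... | tri> _ _ gt = ⊥-elim (ℕₚ.<-irrefl (sym e) gt)

J-above : ∀ {k} (S : Subset n) → k ℕ.< ∣ S ∣ → J k S ≡ interval S
J-above {k = k} S gt with ℕₚ.<-cmp ∣ S ∣ k
... | tri< lt _ _ = ⊥-elim (ℕₚ.<-asym lt gt)
... | tri≈ _ e _ = ⊥-elim (ℕₚ.<-irrefl (sym e) gt)
... | tri> _ _ _ = refl

J-separated : ∀ k → Separated (J {n} k)
J-separated k {X} {Y} p q with ℕₚ.<-cmp ∣ X ∣ k | ℕₚ.<-cmp ∣ Y ∣ k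
... | tri< x _ _ | tri< y _ _ with ℕₚ.≤-total ∣ X ∣ ∣ Y ∣
...   | inj₁ le = Sep-sym (cointerval-sep p le)
...   | inj₂ le = cointerval-sep q le
J-separated k {X} {Y} p q | tri< x _ _ | tri≈ _ y _ = Sep-sym (cointerval-sep p (ℕₚ.≤-trans (ℕₚ.<⇒≤ x) (ℕₚ.≤-reflexive (sym y))))
J-separated k {X} {Y} p q | tri< x _ _ | tri> _ _ y = Sep-sym (cointerval-sep p (ℕₚ.<⇒≤ (ℕₚ.<-trans x y)))
J-separated k {X} {Y} p q | tri≈ _ x _ | tri< y _ _ = cointerval-sep q (ℕₚ.≤-trans (ℕₚ.<⇒≤ y) (ℕₚ.≤-reflexive (sym x)))
J-separated k {X} {Y} p q | tri≈ _ x _ | tri≈ _ y _ with split-noAlt3 {X = X} {Y} p q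
... | inj₁ f = noAlt3⇒sep f (ℕₚ.≤-reflexive (trans y (sym x)))
... | inj₂ f = Sep-sym (noAlt3⇒sep f (ℕₚ.≤-reflexive (trans x (sym y))))
J-separated k {X} {Y} p q | tri≈ _ x _ | tri> _ _ y = Sep-sym (interval-sep q (ℕₚ.≤-trans (ℕₚ.≤-reflexive x) (ℕₚ.<⇒≤ y)))
J-separated k {X} {Y} p q | tri> _ _ x | tri< y _ _ = interval-sep p (ℕₚ.<⇒≤ (ℕₚ.<-trans y x))
J-separated k {X} {Y} p q | tri> _ _ x | tri≈ _ y _ = interval-sep p (ℕₚ.≤-trans (ℕₚ.≤-reflexive y) (ℕₚ.<⇒≤ x))
J-separated k {X} {Y} p q | tri> _ _ x | tri> _ _ y with ℕₚ.≤-total ∣ X ∣ ∣ Y ∣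
... | inj₁ le = Sep-sym (interval-sep q le)
... | inj₂ le = interval-sep p le

private
  zeros-of : ∀ n → ∃ λ (S : Subset n) → zeros S ≡ true × ∣ S ∣ ≡ 0
  zeros-of zero = [] , refl , refl
  zeros-of (suc n) = let S , p , e = zeros-of n in outside ∷ S , p , e

  zeros⇒initial : zeros S ≡ true → initial S ≡ true
  zeros⇒initial {S = []} p = refl
  zeros⇒initial {S = false ∷ S} p = p

  initial-of : ∀ {g} → g ≤ n → ∃ λ (S : Subset n) → initial S ≡ true × ∣ S ∣ ≡ g
  initial-of {n} z≤n = let S , p , e = zeros-of n in S , zeros⇒initial {S = S} p , e
  initial-of (s≤s le) = let S , p , e = initial-of le in inside ∷ S , p , cong suc e

  ones-of : ∀ n → ∃ λ (S : Subset n) → ones S ≡ true × ∣ S ∣ ≡ n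
  ones-of zero = [] , refl , refl
  ones-of (suc n) = let S , p , e = ones-of n in inside ∷ S , p , cong suc e

  ones⇒terminal : ones S ≡ true → terminal S ≡ true
  ones⇒terminal {S = []} p = refl
  ones⇒terminal {S = true ∷ S} p = p

  terminal-of : ∀ {g} → g ≤ n → ∃ λ (S : Subset n) → terminal S ≡ true × ∣ S ∣ ≡ g
  terminal-of {n} {g} le with ℕₚ.m≤n⇒m<n∨m≡n le
  terminal-of {n} {g} le | inj₂ refl = let S , p , e = ones-of n in S , ones⇒terminal {S = S} p , e
  terminal-of {suc n} {g} le | inj₁ (s≤s lt) = let S , p , e = terminal-of lt in outside ∷ S , p , e

  terminal⇒cointerval : terminal S ≡ true → cointerval S ≡ true
  terminal⇒cointerval {S = []} p = refl
  terminal⇒cointerval {S = false ∷ S} p = p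
  terminal⇒cointerval {S = true ∷ S} p = terminal⇒cointerval {S = S} (ones⇒terminal {S = S} p)

-- Members of size at most k - 1 come from sets with the first element, larger ones from sets
-- without it; level k of `J k` thus supplies levels k - 1 and k.
J-contract : ∀ k → (∀ S → S ∈ᶜ J {n} (ℕ.pred k) → S ∈ᶜ contract (J k))
J-contract zero S p with ℕₚ.m≤n⇒m<n∨m≡n (z≤n {∣ S ∣})
... | inj₁ lt = L-∈ {S = S} (J 0) (trans (J-above (outside ∷ S) lt) (trans (sym (J-above S lt)) p))
... | inj₂ e = L-∈ {S = S} (J 0) (trans (J-at (outside ∷ S) (sym e)) (size0⇒interval S (sym e)))
J-contract (suc k) S p with ℕₚ.<-cmp ∣ S ∣ k
... | tri< lt _ _ = R-∈ {S = S} (J (suc k)) (trans (J-below (inside ∷ S) (s≤s lt)) p)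
... | tri≈ _ e _ = R-∈ {S = S} (J (suc k)) (trans (J-at (inside ∷ S) (cong suc e)) p)
... | tri> _ _ gt with ℕₚ.m≤n⇒m<n∨m≡n gt
...   | inj₁ lt = L-∈ {S = S} (J (suc k)) (trans (J-above (outside ∷ S) lt) p)
...   | inj₂ e = L-∈ {S = S} (J (suc k)) (trans (J-at (outside ∷ S) (sym e)) p)

-- The path of `J k` runs through the suffixes of sizes below k and the prefixes from size k on.
J-doubled : ∀ k {g} → g ≤ n → ∃ λ S → S ∈ᶜ doubled (J {suc n} k) × ∣ S ∣ ≡ g
J-doubled k {g} le with ℕₚ.≤-<-connex k g
... | inj₁ k≤g = let S , p , e = initial-of le in S , ∧-intro
        (trans (J-above (inside ∷ S) (s≤s (subst (k ≤_) (sym e) k≤g))) p)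
        (out S p (subst (k ≤_) (sym e) k≤g)) , e
  where
  out : ∀ S → initial S ≡ true → k ≤ ∣ S ∣ → (outside ∷ S) ∈ᶜ J k
  out S p k≤ with ℕₚ.m≤n⇒m<n∨m≡n k≤
  ... | inj₁ lt = trans (J-above (outside ∷ S) lt) (initial⇒interval {S = S} p)
  ... | inj₂ e = trans (J-at (outside ∷ S) (sym e)) (initial⇒interval {S = S} p)
... | inj₂ g<k = let S , p , e = terminal-of le in S , ∧-intro
        (inn S p (subst (ℕ._< k) (sym e) g<k))
        (trans (J-below (outside ∷ S) (subst (ℕ._< k) (sym e) g<k)) p) , e
  where
  inn : ∀ S → terminal S ≡ true → ∣ S ∣ ℕ.< k → (inside ∷ S) ∈ᶜ J k
  inn S p <k with ℕₚ.m≤n⇒m<n∨m≡n <k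
  ... | inj₁ lt = trans (J-below (inside ∷ S) lt) (terminal⇒cointerval {S = S} p)
  ... | inj₂ e = trans (J-at (inside ∷ S) e) (interval⇒split {S = S} (terminal⇒interval {S = S} p))

-- Both summands of the recursion for N are attained, by `J-contract` and `J-doubled`. This is the
-- source of fullness for the completion of a maximum collection.
J-large : ∀ n k → N n ≤ # (J {n} k)
J-large zero k with ℕₚ.<-cmp 0 k
... | tri< _ _ _ = s≤s z≤n
... | tri≈ _ _ _ = s≤s z≤n
... | tri> _ _ _ = s≤s z≤n
J-large (suc n) k = subst (N n + suc n ≤_) (sym (#-contract (J {suc n} k))) (ℕₚ.+-mono-≤
  (ℕₚ.≤-trans (J-large n (ℕ.pred k)) (#-mono {A = J {n} (ℕ.pred k)} (J-contract k)))
  (subst (suc n ≤_) (#-below-all (doubled (J {suc n} k))) (#-below-≥ (doubled (J {suc n} k)) (suc n) λ { (s≤s le) → J-doubled k le })))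

interval⇔ : interval S ≡ true ⇔ IsInterval S
interval⇔ {S = S} = mk⇔ to from
  where
  to : interval S ≡ true → IsInterval S
  to p with diff? S (seg 0 0)
  ... | inj₂ sub = inj₁ (⊑-antisym (λ q → ⊥-elim (∋∌ (sub q) (seg-∌ {t = 0} (inj₂ z≤n)))) λ q → ⊥-elim (∉⊥ q))
  ... | inj₁ (i , Si , _) with earliest (lookup S) ([]=⇒lookup Si)
  ...   | a , a∈ , first with latest-from (lookup S) a∈
  ...     | b , b∈ , a≤b , last = inj₂ (a , b , le a≤b , λ i → mk⇔ (λ q → bnd₁ q , bnd₂ q) λ { (l , l′) → inn l l′ })
    where
    le : ∀ {n} {a b : Fin n} → a ≡ b ⊎ a < b → toℕ a ≤ toℕ b
    le (inj₁ refl) = ℕₚ.≤-refl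
    le (inj₂ lt) = ℕₚ.<⇒≤ lt
    bnd₁ : ∀ {i} → S ∋ i → toℕ a ≤ toℕ i
    bnd₁ {i} q with ℕₚ.≤-<-connex (toℕ a) (toℕ i)
    ... | inj₁ l = l
    ... | inj₂ lt = ⊥-elim (true≢false ([]=⇒lookup q) (first lt))
    bnd₂ : ∀ {i} → S ∋ i → toℕ i ≤ toℕ b
    bnd₂ {i} q with ℕₚ.≤-<-connex (toℕ i) (toℕ b)
    ... | inj₁ l = l
    ... | inj₂ lt = ⊥-elim (true≢false ([]=⇒lookup q) (last lt))
    inn : ∀ {i} → toℕ a ≤ toℕ i → toℕ i ≤ toℕ b → S ∋ i
    inn {i} l l′ with a ≟ᶠ i | i ≟ᶠ b
    ... | yes refl | _ = lookup⇒[]= a S a∈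
    ... | no _ | yes refl = lookup⇒[]= b S b∈
    ... | no a≢i | no i≢b = interval-convex p (ℕₚ.≤∧≢⇒< l (a≢i ∘ toℕ-injective)) (ℕₚ.≤∧≢⇒< l′ (i≢b ∘ toℕ-injective))
          (lookup⇒[]= a S a∈) (lookup⇒[]= b S b∈)
  from : IsInterval S → interval S ≡ true
  from (inj₁ refl) = convex-interval {S = S} λ _ _ q _ → ⊥-elim (∉⊥ q)
  from (inj₂ (a , b , _ , f)) = convex-interval λ {i} {j} {k} i<j j<k u v → Equivalence.from (f j)
    (ℕₚ.≤-trans (proj₁ (Equivalence.to (f i) u)) (ℕₚ.<⇒≤ i<j) , ℕₚ.≤-trans (ℕₚ.<⇒≤ j<k) (proj₂ (Equivalence.to (f k) v)))

split⇒ : split S ≡ true → IsSsplit S ⊎ IsInterval S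
split⇒ {S = []} p = inj₂ (inj₁ refl)
split⇒ {S = false ∷ S} p = inj₂ (Equivalence.to (interval⇔ {S = false ∷ S}) p)
split⇒ {S = true ∷ S} p with split⇒ {S = S} p
... | inj₁ (a , b , c , b≤c , a<b , f) = inj₁ (suc a , suc b , suc c , s≤s b≤c , s≤s a<b , λ
        { zero → mk⇔ (λ _ → inj₁ z≤n) (λ _ → here)
        ; (suc i) → mk⇔ (λ { (there q) → case Equivalence.to (f i) q of λ
              { (inj₁ l) → inj₁ (s≤s l) ; (inj₂ (l , l′)) → inj₂ (s≤s l , s≤s l′) } })
            λ { (inj₁ (s≤s l)) → there (Equivalence.from (f i) (inj₁ l))
              ; (inj₂ (s≤s l , s≤s l′)) → there (Equivalence.from (f i) (inj₂ (l , l′))) } })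
... | inj₂ (inj₁ refl) = inj₂ (Equivalence.to (interval⇔ {S = true ∷ S}) (initial⁺ {S = S} λ _ q → ⊥-elim (∉⊥ q)))
... | inj₂ (inj₂ (zero , b , _ , f)) = inj₂ (Equivalence.to (interval⇔ {S = true ∷ S})
        (initial⁺ λ {i} {j} i<j q → Equivalence.from (f i) (z≤n , ℕₚ.≤-trans (ℕₚ.<⇒≤ i<j) (proj₂ (Equivalence.to (f j) q)))))
... | inj₂ (inj₂ (suc a , b , a≤b , f)) = inj₁ (zero , suc (suc a) , suc b , s≤s a≤b , s≤s (s≤s z≤n) , λ
        { zero → mk⇔ (λ _ → inj₁ z≤n) (λ _ → here)
        ; (suc i) → mk⇔ (λ { (there q) → let l , l′ = Equivalence.to (f i) q in inj₂ (s≤s l , s≤s l′) })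
            λ { (inj₁ ()) ; (inj₂ (s≤s l , s≤s l′)) → there (Equivalence.from (f i) (l , l′)) } })

⇒split : IsSsplit S → split S ≡ true
⇒split {S = false ∷ S} (a , b , c , _ , _ , f) = case Equivalence.from (f zero) (inj₁ z≤n) of λ ()
⇒split {S = true ∷ S} (zero , b , c , b≤c , a<b , f) = interval⇒split {S = S} (convex-interval λ {i} {j} {k} i<j j<k u v →
  case (Equivalence.to (f (suc i)) (there u) , Equivalence.to (f (suc k)) (there v)) of λ
    { (inj₂ (l , _) , inj₂ (_ , l′)) → case Equivalence.from (f (suc j)) (inj₂ (ℕₚ.≤-trans l (ℕₚ.<⇒≤ (s≤s i<j)) , ℕₚ.≤-trans (ℕₚ.<⇒≤ (s≤s j<k)) l′)) of λ
        { (there r) → r } })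
⇒split {S = true ∷ S} (suc a , suc b , suc c , s≤s b≤c , s≤s a<b , f) = ⇒split {S = S} (a , b , c , b≤c , a<b , λ i →
  mk⇔ (λ q → case Equivalence.to (f (suc i)) (there q) of λ
        { (inj₁ (s≤s l)) → inj₁ l ; (inj₂ (s≤s l , s≤s l′)) → inj₂ (l , l′) })
      λ { (inj₁ l) → case Equivalence.from (f (suc i)) (inj₁ (s≤s l)) of λ { (there r) → r }
        ; (inj₂ (l , l′)) → case Equivalence.from (f (suc i)) (inj₂ (s≤s l , s≤s l′)) of λ { (there r) → r } })

InIS⇔J : ∀ {k m} → k ≤ m → InIS k m S ⇔ (InΔ k m S × S ∈ᶜ J k)
InIS⇔J {S = S} {k} {m} k≤m = mk⇔ to from
  where
  to : InIS k m S → InΔ k m S × S ∈ᶜ J k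
  to (inj₁ (p , e)) = (ℕₚ.≤-reflexive (sym e) , ℕₚ.≤-trans (ℕₚ.≤-reflexive e) k≤m) , trans (J-at S e) (⇒split p)
  to (inj₂ (p , δ)) with ℕₚ.m≤n⇒m<n∨m≡n (proj₁ δ)
  ... | inj₁ lt = δ , trans (J-above S lt) (Equivalence.from interval⇔ p)
  ... | inj₂ e = δ , trans (J-at S (sym e)) (interval⇒split {S = S} (Equivalence.from interval⇔ p))
  from : InΔ k m S × S ∈ᶜ J k → InIS k m S
  from (δ , p) with ℕₚ.m≤n⇒m<n∨m≡n (proj₁ δ)
  ... | inj₁ lt = inj₂ (Equivalence.to interval⇔ (trans (sym (J-above S lt)) p) , δ)
  ... | inj₂ e with split⇒ {S = S} (trans (sym (J-at S (sym e))) p)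
  ...   | inj₁ q = inj₁ (q , sym e)
  ...   | inj₂ q = inj₂ (q , δ)

-- Flips preserve weak separation

-- Cyclic noncrossing of f ∖ g and g ∖ f: no r inside and s outside the span of p and q.

Only : (ℕ → Bool) → (ℕ → Bool) → ℕ → Set
Only f g t = f t ≡ true × g t ≡ false

NonCrossing : (ℕ → Bool) → (ℕ → Bool) → Set
NonCrossing f g = ∀ {p q r s} → Only f g p → Only f g q → Only g f r → Only g f s →
  p ℕ.< r → r ℕ.< q → s ℕ.< p ⊎ q ℕ.< s → ⊥

NonCrossing-sym : ∀ {f g} → NonCrossing f g → NonCrossing g f
NonCrossing-sym nc r s p q r<p p<s (inj₁ q<r) = nc q p r s q<r r<p (inj₂ p<s)
NonCrossing-sym nc r s p q r<p p<s (inj₂ s<q) = nc p q s r p<s s<q (inj₁ r<p)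

-- The six sets of a flip agree outside four positions. Describing them by their bits there lets one
-- argument serve both kinds of flip, the fourth position being padding in the case of a 3-flip.
record Agrees (x f : ℕ → Bool) (i j k l : ℕ) (bi bj bk bl : Bool) : Set where
  constructor agrees
  field
    at-i : f i ≡ bi
    at-j : f j ≡ bj
    at-k : f k ≡ bk
    at-l : f l ≡ bl
    off : ∀ {t} → t ≢ i → t ≢ j → t ≢ k → t ≢ l → f t ≡ x t
open Agrees

same : ∀ {x f g i j k l bi bj bk bl ci cj ck cl t} →
  Agrees x f i j k l bi bj bk bl → Agrees x g i j k l ci cj ck cl →
  bi ≡ ci ⊎ t ≢ i → bj ≡ cj ⊎ t ≢ j → bk ≡ ck ⊎ t ≢ k → bl ≡ cl ⊎ t ≢ l → f t ≡ g t
same {i = i} {j} {k} {l} {t = t} F G ei ej ek el with t ℕ.≟ i | t ℕ.≟ j | t ℕ.≟ k | t ℕ.≟ l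
... | yes refl | _ | _ | _ = case ei of λ { (inj₁ e) → trans (at-i F) (trans e (sym (at-i G))) ; (inj₂ ne) → ⊥-elim (ne refl) }
... | no _ | yes refl | _ | _ = case ej of λ { (inj₁ e) → trans (at-j F) (trans e (sym (at-j G))) ; (inj₂ ne) → ⊥-elim (ne refl) }
... | no _ | no _ | yes refl | _ = case ek of λ { (inj₁ e) → trans (at-k F) (trans e (sym (at-k G))) ; (inj₂ ne) → ⊥-elim (ne refl) }
... | no _ | no _ | no _ | yes refl = case el of λ { (inj₁ e) → trans (at-l F) (trans e (sym (at-l G))) ; (inj₂ ne) → ⊥-elim (ne refl) }
... | no a | no b | no c | no d = trans (off F a b c d) (sym (off G a b c d))

module _ {x U fij fjk fkl fil fik fjl : ℕ → Bool} {i j k l : ℕ}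
  (i<j : i ℕ.< j) (j<k : j ℕ.< k) (k<l : k ℕ.< l)
  (Aij : Agrees x fij i j k l true true false false) (Ajk : Agrees x fjk i j k l false true true false)
  (Akl : Agrees x fkl i j k l false false true true) (Ail : Agrees x fil i j k l true false false true)
  (Aik : Agrees x fik i j k l true false true false) (Ajl : Agrees x fjl i j k l false true false true)
  (nij : NonCrossing U fij) (njk : NonCrossing U fjk) (nkl : NonCrossing U fkl) (nil : NonCrossing U fil)
  (u∃ : ∃ (Only U fik)) (v∃ : ∃ (Only fik U))
  where
  private
    ∈≢ : ∀ {f : ℕ → Bool} {s t} → f s ≡ true → f t ≡ false → s ≢ t
    ∈≢ p q refl = true≢false p q
    ∉≢ : ∀ {f : ℕ → Bool} {s t} → f s ≡ false → f t ≡ true → s ≢ t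
    ∉≢ p q refl = true≢false q p
    i<k = ℕₚ.<-trans i<j j<k
    i<l = ℕₚ.<-trans i<k k<l
    j<l = ℕₚ.<-trans j<k k<l

    -- One of the chords ui, uk of U separates j from l, so it crosses a chord from v to j or to l,
    -- on whichever side v lies.
    like-ik : U i ≡ true → U j ≡ false → U k ≡ true → U l ≡ false → ⊥
    like-ik Ui Uj Uk Ul = go (ℕₚ.<-cmp u j) (ℕₚ.<-cmp u l)
      where
      u = proj₁ u∃
      v = proj₁ v∃
      Uu = proj₁ (proj₂ u∃)
      Uv = proj₂ (proj₂ v∃)
      u≢i : u ≢ i
      u≢i e = true≢false (at-i Aik) (subst (λ t → fik t ≡ false) e (proj₂ (proj₂ u∃)))
      u≢k : u ≢ k
      u≢k e = true≢false (at-k Aik) (subst (λ t → fik t ≡ false) e (proj₂ (proj₂ u∃)))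
      u≢j = ∈≢ {U} Uu Uj
      u≢l = ∈≢ {U} Uu Ul
      v≢i = ∉≢ {U} Uv Ui
      v≢k = ∉≢ {U} Uv Uk
      v≢j : v ≢ j
      v≢j e = true≢false (subst (λ t → fik t ≡ true) e (proj₁ (proj₂ v∃))) (at-j Aik)
      v≢l : v ≢ l
      v≢l e = true≢false (subst (λ t → fik t ≡ true) e (proj₁ (proj₂ v∃))) (at-l Aik)
      module _ {f bi bj bk bl} (A : Agrees x f i j k l bi bj bk bl) where
        eu : Only U f u
        eu = Uu , trans (same A Aik (inj₂ u≢i) (inj₂ u≢j) (inj₂ u≢k) (inj₂ u≢l)) (proj₂ (proj₂ u∃))
        ev : Only f U v
        ev = trans (same A Aik (inj₂ v≢i) (inj₂ v≢j) (inj₂ v≢k) (inj₂ v≢l)) (proj₁ (proj₂ v∃)) , Uv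
      where-v : ∀ {p q} → v ≢ p → v ≢ q → (p ℕ.< v × v ℕ.< q) ⊎ (v ℕ.< p ⊎ q ℕ.< v)
      where-v {p} {q} ne ne′ with ℕₚ.<-cmp v p | ℕₚ.<-cmp v q
      ... | tri≈ _ e _ | _ = ⊥-elim (ne e)
      ... | _ | tri≈ _ e _ = ⊥-elim (ne′ e)
      ... | tri< lt _ _ | _ = inj₂ (inj₁ lt)
      ... | _ | tri> _ _ gt = inj₂ (inj₂ gt)
      ... | tri> _ _ gt | tri< lt _ _ = inj₁ (gt , lt)
      v≢u = ∉≢ {U} Uv Uu
      go : _ → _ → ⊥
      go (tri≈ _ e _) _ = u≢j e
      go _ (tri≈ _ e _) = u≢l e
      go (tri< u<j _ _) _ with where-v v≢u v≢k
      ... | inj₁ (u<v , v<k) = nil (eu Ail) (Uk , at-k Ail) (ev Ail) (at-l Ail , Ul) u<v v<k (inj₂ k<l)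
      ... | inj₂ o = nij (eu Aij) (Uk , at-k Aij) (at-j Aij , Uj) (ev Aij) u<j j<k o
      go (tri> _ _ j<u) (tri< u<l _ _) with where-v v≢i v≢u
      ... | inj₁ (i<v , v<u) = nkl (Ui , at-i Akl) (eu Akl) (ev Akl) (at-l Akl , Ul) i<v v<u (inj₂ u<l)
      ... | inj₂ o = njk (Ui , at-i Ajk) (eu Ajk) (at-j Ajk , Uj) (ev Ajk) i<j j<u o
      go (tri> _ _ j<u) (tri> _ _ l<u) with where-v v≢k v≢u
      ... | inj₁ (k<v , v<u) = nij (Uk , at-k Aij) (eu Aij) (ev Aij) (at-j Aij , Uj) k<v v<u (inj₁ j<k)
      ... | inj₂ o = nil (Uk , at-k Ail) (eu Ail) (at-l Ail , Ul) (ev Ail) k<l l<u o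

    -- The chord ik of U is crossed by r and s. If U also contains j or l, one of the chords from
    -- that element to i or k still separates r from s. Its two ends are cyclic neighbours among i,
    -- j, k, l, and one of the four known functions vanishes at both.
    case-ik : U i ≡ true → U k ≡ true → ∀ {r s} → Only fjl U r → Only fjl U s → i ℕ.< r → r ℕ.< k → s ℕ.< i ⊎ k ℕ.< s → ⊥
    case-ik Ui Uk {r} {s} (gr , Ur) (gs , Us) i<r r<k o with U j in Uj | U l in Ul
    ... | false | false = like-ik Ui Uj Uk Ul
    ... | true | _ with ℕₚ.<-cmp r j
    ...   | tri≈ _ refl _ = true≢false Uj Ur
    ...   | tri< r<j _ _ = nkl (Ui , at-i Akl) (Uj , at-j Akl) (on r gr Ur) (on s gs Us) i<r r<j
              (case o of λ { (inj₁ s<i) → inj₁ s<i ; (inj₂ k<s) → inj₂ (ℕₚ.<-trans j<k k<s) })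
      where
      on : ∀ t → fjl t ≡ true → U t ≡ false → Only fkl U t
      on t g u = trans (same Akl Ajl (inj₁ refl) (inj₂ (∉≢ {U} u Uj)) (inj₂ (∉≢ {U} u Uk)) (inj₁ refl)) g , u
    ...   | tri> _ _ j<r = nil (Uj , at-j Ail) (Uk , at-k Ail) (on r gr Ur) (on s gs Us) j<r r<k
              (case o of λ { (inj₁ s<i) → inj₁ (ℕₚ.<-trans s<i i<j) ; (inj₂ k<s) → inj₂ k<s })
      where
      on : ∀ t → fjl t ≡ true → U t ≡ false → Only fil U t
      on t g u = trans (same Ail Ajl (inj₂ (∉≢ {U} u Ui)) (inj₂ (∉≢ {U} u Uj)) (inj₁ refl) (inj₁ refl)) g , u
    case-ik Ui Uk {r} {s} (gr , Ur) (gs , Us) i<r r<k o | false | true = go o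
      where
      on-jk : ∀ t → fjl t ≡ true → U t ≡ false → Only fjk U t
      on-jk t g u = trans (same Ajk Ajl (inj₁ refl) (inj₁ refl) (inj₂ (∉≢ {U} u Uk)) (inj₂ (∉≢ {U} u Ul))) g , u
      on-ij : ∀ t → fjl t ≡ true → U t ≡ false → Only fij U t
      on-ij t g u = trans (same Aij Ajl (inj₂ (∉≢ {U} u Ui)) (inj₁ refl) (inj₁ refl) (inj₂ (∉≢ {U} u Ul))) g , u
      go : s ℕ.< i ⊎ k ℕ.< s → ⊥
      go (inj₁ s<i) = njk (Ui , at-i Ajk) (Ul , at-l Ajk) (on-jk r gr Ur) (on-jk s gs Us) i<r (ℕₚ.<-trans r<k k<l) (inj₁ s<i)
      go (inj₂ k<s) with ℕₚ.<-cmp s l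
      ... | tri≈ _ refl _ = true≢false Ul Us
      ... | tri< s<l _ _ = nij (Uk , at-k Aij) (Ul , at-l Aij) (on-ij s gs Us) (on-ij r gr Ur) k<s s<l (inj₁ r<k)
      ... | tri> _ _ l<s = njk (Ui , at-i Ajk) (Ul , at-l Ajk) (on-jk r gr Ur) (on-jk s gs Us) i<r (ℕₚ.<-trans r<k k<l) (inj₂ l<s)

    -- The same argument with the roles exchanged: the crossed chord jl is outside U, and it is
    -- bypassed through k or i, whichever U omits.
    case-jl : U j ≡ false → U l ≡ false → ∀ {y z} → Only U fjl y → Only U fjl z → j ℕ.< y → y ℕ.< l → z ℕ.< j ⊎ l ℕ.< z → ⊥
    case-jl Uj Ul {y} {z} (Uy , gy) (Uz , gz) j<y y<l o with U k in Uk | U i in Ui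
    ... | true | true = like-ik Ui Uj Uk Ul
    ... | false | _ with ℕₚ.<-cmp y k
    ...   | tri≈ _ refl _ = true≢false Uy Uk
    ...   | tri< y<k _ _ = NonCrossing-sym njk (at-j Ajk , Uj) (at-k Ajk , Uk) (on y Uy gy) (on z Uz gz) j<y y<k
              (case o of λ { (inj₁ z<j) → inj₁ z<j ; (inj₂ l<z) → inj₂ (ℕₚ.<-trans k<l l<z) })
      where
      on : ∀ t → U t ≡ true → fjl t ≡ false → Only U fjk t
      on t u g = u , trans (same Ajk Ajl (inj₁ refl) (inj₁ refl) (inj₂ (∈≢ {U} u Uk)) (inj₂ (∈≢ {U} u Ul))) g
    ...   | tri> _ _ k<y = NonCrossing-sym nkl (at-k Akl , Uk) (at-l Akl , Ul) (on y Uy gy) (on z Uz gz) k<y y<l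
              (case o of λ { (inj₁ z<j) → inj₁ (ℕₚ.<-trans z<j j<k) ; (inj₂ l<z) → inj₂ l<z })
      where
      on : ∀ t → U t ≡ true → fjl t ≡ false → Only U fkl t
      on t u g = u , trans (same Akl Ajl (inj₁ refl) (inj₂ (∈≢ {U} u Uj)) (inj₂ (∈≢ {U} u Uk)) (inj₁ refl)) g
    case-jl Uj Ul {y} {z} (Uy , gy) (Uz , gz) j<y y<l o | true | false = go o
      where
      on-il : ∀ t → U t ≡ true → fjl t ≡ false → Only U fil t
      on-il t u g = u , trans (same Ail Ajl (inj₂ (∈≢ {U} u Ui)) (inj₂ (∈≢ {U} u Uj)) (inj₁ refl) (inj₁ refl)) g
      on-ij : ∀ t → U t ≡ true → fjl t ≡ false → Only U fij t
      on-ij t u g = u , trans (same Aij Ajl (inj₂ (∈≢ {U} u Ui)) (inj₁ refl) (inj₁ refl) (inj₂ (∈≢ {U} u Ul))) g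
      go : z ℕ.< j ⊎ l ℕ.< z → ⊥
      go (inj₂ l<z) = NonCrossing-sym nil (at-i Ail , Ui) (at-l Ail , Ul) (on-il y Uy gy) (on-il z Uz gz) (ℕₚ.<-trans i<j j<y) y<l (inj₂ l<z)
      go (inj₁ z<j) with ℕₚ.<-cmp z i
      ... | tri≈ _ refl _ = true≢false Uz Ui
      ... | tri< z<i _ _ = NonCrossing-sym nil (at-i Ail , Ui) (at-l Ail , Ul) (on-il y Uy gy) (on-il z Uz gz) (ℕₚ.<-trans i<j j<y) y<l (inj₁ z<i)
      ... | tri> _ _ i<z = NonCrossing-sym nij (at-i Aij , Ui) (at-j Aij , Uj) (on-ij z Uz gz) (on-ij y Uy gy) i<z z<j (inj₂ j<y)

    either : ∀ a b c → (a ≡ c ⊎ b ≡ c) ⊎ (a ≢ c × b ≢ c)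
    either a b c with a ℕ.≟ c | b ℕ.≟ c
    ... | yes e | _ = inj₁ (inj₁ e)
    ... | no _ | yes e = inj₁ (inj₂ e)
    ... | no ne | no ne′ = inj₂ (ne , ne′)

  -- A crossing of U with fjl that avoids both positions where fjl differs from one of the other
  -- four functions is a crossing with that function.
  flip-NonCrossing : NonCrossing U fjl
  flip-NonCrossing {p} {q} {r} {s} dp@(Up , gp) dq@(Uq , gq) dr@(gr , Ur) ds@(gs , Us) p<r r<q o = go (either p q i) (either p q k) (either r s j) (either r s l)
    where
    p≢j = ∉≢ {fjl} gp (at-j Ajl)
    p≢l = ∉≢ {fjl} gp (at-l Ajl)
    q≢j = ∉≢ {fjl} gq (at-j Ajl)
    q≢l = ∉≢ {fjl} gq (at-l Ajl)
    r≢i = ∈≢ {fjl} gr (at-i Ajl)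
    r≢k = ∈≢ {fjl} gr (at-k Ajl)
    s≢i = ∈≢ {fjl} gs (at-i Ajl)
    s≢k = ∈≢ {fjl} gs (at-k Ajl)
    ik : p ≡ i ⊎ q ≡ i → p ≡ k ⊎ q ≡ k → ⊥
    ik (inj₁ refl) (inj₂ refl) = case-ik Up Uq dr ds p<r r<q o
    ik (inj₁ refl) (inj₁ refl) = ℕₚ.<-irrefl refl i<k
    ik (inj₂ refl) (inj₂ refl) = ℕₚ.<-irrefl refl i<k
    ik (inj₂ refl) (inj₁ refl) = ℕₚ.<-asym i<k (ℕₚ.<-trans p<r r<q)
    jl : r ≡ j ⊎ s ≡ j → r ≡ l ⊎ s ≡ l → ⊥
    jl (inj₁ refl) (inj₂ refl) = case o of λ
      { (inj₁ l<p) → ℕₚ.<-asym (ℕₚ.<-trans l<p p<r) j<l ; (inj₂ q<l) → case-jl Ur Us dq dp r<q q<l (inj₁ p<r) }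
    jl (inj₂ refl) (inj₁ refl) = case o of λ
      { (inj₁ j<p) → case-jl Us Ur dp dq j<p p<r (inj₂ r<q) ; (inj₂ q<j) → ℕₚ.<-asym (ℕₚ.<-trans r<q q<j) j<l }
    jl (inj₁ refl) (inj₁ refl) = ℕₚ.<-irrefl refl j<l
    jl (inj₂ refl) (inj₂ refl) = ℕₚ.<-irrefl refl j<l
    go : _ → _ → _ → _ → ⊥
    go (inj₁ ei) (inj₁ ek) _ _ = ik ei ek
    go _ _ (inj₁ ej) (inj₁ el) = jl ej el
    go (inj₂ (p≢i , q≢i)) _ _ (inj₂ (r≢l , s≢l)) = nij
      (Up , trans (same Aij Ajl (inj₂ p≢i) (inj₁ refl) (inj₁ refl) (inj₂ p≢l)) gp)
      (Uq , trans (same Aij Ajl (inj₂ q≢i) (inj₁ refl) (inj₁ refl) (inj₂ q≢l)) gq)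
      (trans (same Aij Ajl (inj₂ r≢i) (inj₁ refl) (inj₁ refl) (inj₂ r≢l)) gr , Ur)
      (trans (same Aij Ajl (inj₂ s≢i) (inj₁ refl) (inj₁ refl) (inj₂ s≢l)) gs , Us) p<r r<q o
    go (inj₂ (p≢i , q≢i)) _ (inj₂ (r≢j , s≢j)) _ = nil
      (Up , trans (same Ail Ajl (inj₂ p≢i) (inj₂ p≢j) (inj₁ refl) (inj₁ refl)) gp)
      (Uq , trans (same Ail Ajl (inj₂ q≢i) (inj₂ q≢j) (inj₁ refl) (inj₁ refl)) gq)
      (trans (same Ail Ajl (inj₂ r≢i) (inj₂ r≢j) (inj₁ refl) (inj₁ refl)) gr , Ur)
      (trans (same Ail Ajl (inj₂ s≢i) (inj₂ s≢j) (inj₁ refl) (inj₁ refl)) gs , Us) p<r r<q o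
    go _ (inj₂ (p≢k , q≢k)) _ (inj₂ (r≢l , s≢l)) = njk
      (Up , trans (same Ajk Ajl (inj₁ refl) (inj₁ refl) (inj₂ p≢k) (inj₂ p≢l)) gp)
      (Uq , trans (same Ajk Ajl (inj₁ refl) (inj₁ refl) (inj₂ q≢k) (inj₂ q≢l)) gq)
      (trans (same Ajk Ajl (inj₁ refl) (inj₁ refl) (inj₂ r≢k) (inj₂ r≢l)) gr , Ur)
      (trans (same Ajk Ajl (inj₁ refl) (inj₁ refl) (inj₂ s≢k) (inj₂ s≢l)) gs , Us) p<r r<q o
    go _ (inj₂ (p≢k , q≢k)) (inj₂ (r≢j , s≢j)) _ = nkl
      (Up , trans (same Akl Ajl (inj₁ refl) (inj₂ p≢j) (inj₂ p≢k) (inj₁ refl)) gp)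
      (Uq , trans (same Akl Ajl (inj₁ refl) (inj₂ q≢j) (inj₂ q≢k) (inj₁ refl)) gq)
      (trans (same Akl Ajl (inj₁ refl) (inj₂ r≢j) (inj₂ r≢k) (inj₁ refl)) gr , Ur)
      (trans (same Akl Ajl (inj₁ refl) (inj₂ s≢j) (inj₂ s≢k) (inj₁ refl)) gs , Us) p<r r<q o

-- Positions from n on are padding: the smaller of two sets owns the extra padding elements, which
-- turns weak separation into noncrossing.

padded : ℕ → Subset n → ℕ → Bool
padded s [] t = s ≤ᵇ t
padded s (b ∷ S) zero = b
padded s (b ∷ S) (suc t) = padded s S t

pad : Subset n → ℕ → Bool
pad S = padded ∣ S ∣ S

padded-toℕ : ∀ s (S : Subset n) i → padded s S (toℕ i) ≡ lookup S i
padded-toℕ s (b ∷ S) zero = refl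
padded-toℕ s (b ∷ S) (suc i) = padded-toℕ s S i

padded-+ : ∀ s (S : Subset n) t → padded s S (n + t) ≡ (s ≤ᵇ t)
padded-+ s [] t = refl
padded-+ s (b ∷ S) t = padded-+ s S t

true-≤ᵇ : ∀ {a b} → a ≤ b → (a ≤ᵇ b) ≡ true
true-≤ᵇ p = Equivalence.to T-≡ (ℕₚ.≤⇒≤ᵇ p)

≤ᵇ-true : ∀ {a b} → (a ≤ᵇ b) ≡ true → a ≤ b
≤ᵇ-true {a} {b} p = ℕₚ.≤ᵇ⇒≤ a b (Equivalence.from T-≡ p)

false-≤ᵇ : ∀ {a b} → b ℕ.< a → (a ≤ᵇ b) ≡ false
false-≤ᵇ lt = ¬true⇒false λ p → ℕₚ.<⇒≱ lt (≤ᵇ-true p)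

≤ᵇ-false : ∀ {a b} → (a ≤ᵇ b) ≡ false → b ℕ.< a
≤ᵇ-false p = ℕₚ.≰⇒> λ le → true≢false (true-≤ᵇ le) p

position : ∀ n t → (∃ λ (i : Fin n) → toℕ i ≡ t) ⊎ (∃ λ s → t ≡ n + s)
position n t with ℕₚ.≤-<-connex n t
... | inj₁ le = inj₂ (t ℕ.∸ n , sym (ℕₚ.m+[n∸m]≡n le))
... | inj₂ lt = inj₁ (fromℕ< lt , toℕ-fromℕ< lt)

diff-only : Diff X Y i → Only (pad X) (pad Y) (toℕ i)
diff-only {X = X} {Y} {i} (p , q) = trans (padded-toℕ _ X i) ([]=⇒lookup p) , trans (padded-toℕ _ Y i) ([]=⇒lookup q)

only-diff : Only (pad X) (pad Y) (toℕ i) → Diff X Y i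
only-diff {X = X} {Y} {i} (p , q) = lookup⇒[]= i X (trans (sym (padded-toℕ _ X i)) p) , lookup⇒[]= i Y (trans (sym (padded-toℕ _ Y i)) q)

only-padding : ∀ (X Y : Subset n) {s} → Only (pad X) (pad Y) (n + s) → ∣ X ∣ ℕ.< ∣ Y ∣
only-padding X Y {s} (p , q) = ℕₚ.≤-<-trans (≤ᵇ-true (trans (sym (padded-+ _ X s)) p)) (≤ᵇ-false {∣ Y ∣} (trans (sym (padded-+ _ Y s)) q))

padding-only : ∀ (X Y : Subset n) → ∣ X ∣ ℕ.< ∣ Y ∣ → Only (pad X) (pad Y) (n + ∣ X ∣)
padding-only X Y lt = trans (padded-+ _ X ∣ X ∣) (true-≤ᵇ {∣ X ∣} ℕₚ.≤-refl) , trans (padded-+ _ Y ∣ X ∣) (false-≤ᵇ lt)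

private
  no-padding : ∀ {X Y : Subset n} {t} → ∣ Y ∣ ≤ ∣ X ∣ → Only (pad X) (pad Y) t → ∃ λ i → toℕ i ≡ t × Diff X Y i
  no-padding {n} {X} {Y} {t} le o with position n t
  ... | inj₁ (i , refl) = i , refl , only-diff o
  ... | inj₂ (s , refl) = ⊥-elim (ℕₚ.<⇒≱ (only-padding X Y o) le)

  early : ∀ {X Y : Subset n} {t} → t ℕ.< n → Only (pad X) (pad Y) t → ∃ λ i → toℕ i ≡ t × Diff X Y i
  early {n} {X} {Y} {t} lt o with position n t
  ... | inj₁ (i , refl) = i , refl , only-diff o
  ... | inj₂ (s , refl) = ⊥-elim (ℕₚ.<⇒≱ lt (ℕₚ.m≤m+n n s))

  -- If the last position is padding, it belongs to Y alone, so Y is the smaller set. No padding can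
  -- then belong to X alone; the other three positions are elements, and they form the pattern that
  -- `no3` forbids.
  pattern₄ : ∀ {X Y : Subset n} → Sep X Y → ∀ {p q r s} → p ℕ.< q → q ℕ.< r → r ℕ.< s →
    Only (pad X) (pad Y) p → Only (pad Y) (pad X) q → Only (pad X) (pad Y) r → Only (pad Y) (pad X) s → ⊥
  pattern₄ {n} {X} {Y} sp {p} {q} {r} {s} p<q q<r r<s op oq or os with position n s
  ... | inj₁ (l , refl) with early {X = X} {Y} (ℕₚ.<-trans p<q (ℕₚ.<-trans q<r (ℕₚ.<-trans r<s (toℕ<n l)))) op
                           | early {X = Y} {X} (ℕₚ.<-trans q<r (ℕₚ.<-trans r<s (toℕ<n l))) oq | early {X = X} {Y} (ℕₚ.<-trans r<s (toℕ<n l)) or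
  ...   | i , refl , di | j , refl , dj | k , refl , dk = no4 sp p<q q<r r<s di dj dk (only-diff os)
  pattern₄ {n} {X} {Y} sp {p} {q} {r} {s} p<q q<r r<s op oq or os | inj₂ (t , refl)
    with only-padding Y X os
  ... | lt with no-padding {X = X} {Y} (ℕₚ.<⇒≤ lt) or
  ...   | k , refl , dk with early {X = Y} {X} (ℕₚ.<-trans q<r (toℕ<n k)) oq | early {X = X} {Y} (ℕₚ.<-trans p<q (ℕₚ.<-trans q<r (toℕ<n k))) op
  ...     | j , refl , dj | i , refl , di = no3 sp lt p<q q<r di dj dk

sep⇒nonCrossing : Sep X Y → NonCrossing (pad X) (pad Y)
sep⇒nonCrossing sp op oq or os p<r r<q (inj₁ s<p) = pattern₄ (Sep-sym sp) s<p p<r r<q os op or oq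
sep⇒nonCrossing sp op oq or os p<r r<q (inj₂ q<s) = pattern₄ sp p<r r<q q<s op or oq os

nonCrossing⇒sep : NonCrossing (pad X) (pad Y) → Sep X Y
nonCrossing⇒sep {n} {X} {Y} nc = sep
  (λ a<b b<c c<d a b c d → nc (diff-only a) (diff-only c) (diff-only b) (diff-only d) a<b b<c (inj₂ c<d))
  (λ a<b b<c c<d a b c d → nc (diff-only b) (diff-only d) (diff-only c) (diff-only a) b<c c<d (inj₁ a<b))
  -- A padding position owned by the smaller set lies beyond all elements and completes the
  -- three-term pattern to a crossing.
  (λ lt {a} {b} {c} a<b b<c da db dc → nc (diff-only da) (diff-only dc) (diff-only db) (padding-only Y X lt) a<b b<c (inj₂ (beyond c)))
  (λ lt {a} {b} {c} a<b b<c da db dc → nc (diff-only db) (padding-only X Y lt) (diff-only dc) (diff-only da) b<c (beyond c) (inj₁ a<b))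
  where
  beyond : ∀ (c : Fin n) {s} → toℕ c ℕ.< n + s
  beyond c = ℕₚ.<-≤-trans (toℕ<n c) (ℕₚ.m≤m+n n _)

-- Padding compensates the difference in size, so neither of two distinct padded sets contains the
-- other. `flip-NonCrossing` needs such an element on each side.
balanced : U ≢ V → ∃ (Only (pad U) (pad V)) × ∃ (Only (pad V) (pad U))
balanced {U = U} {V} ne with ℕₚ.<-cmp ∣ U ∣ ∣ V ∣
... | tri< lt _ _ = (_ , padding-only U V lt) , (_ , diff-only (proj₂ (larger-diff U V lt)))
... | tri> _ _ gt = (_ , diff-only (proj₂ (larger-diff V U gt))) , (_ , padding-only V U gt)
... | tri≈ _ e _ with diff? U V
...   | inj₁ (_ , d) = (_ , diff-only d) , (_ , diff-only (proj₂ (exchange (ℕₚ.≤-reflexive e) d)))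
...   | inj₂ sub = ⊥-elim (ne (⊑-size-≡ sub (ℕₚ.≤-reflexive (sym e))))

NonCrossing-not : ∀ {f g} → NonCrossing f g → NonCrossing (not ∘ f) (not ∘ g)
NonCrossing-not {f} {g} nc {p} {q} {r} {s} op oq or os = NonCrossing-sym nc
  (un (f p) (g p) op) (un (f q) (g q) oq) (un (g r) (f r) or) (un (g s) (f s) os)
  where
  un : ∀ a b → not a ≡ true × not b ≡ false → b ≡ true × a ≡ false
  un false true _ = refl , refl

NonCrossing-not⁻ : ∀ {f g} → NonCrossing (not ∘ f) (not ∘ g) → NonCrossing f g
NonCrossing-not⁻ nc op oq or os = NonCrossing-sym nc (neg op) (neg oq) (neg or) (neg os)
  where
  neg : ∀ {a b} → a ≡ true × b ≡ false → not b ≡ true × not a ≡ false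
  neg (p , q) = cong not q , cong not p

Agrees-not : ∀ {x f i j k l bi bj bk bl} → Agrees x f i j k l bi bj bk bl →
  Agrees (not ∘ x) (not ∘ f) i j k l (not bi) (not bj) (not bk) (not bl)
Agrees-not (agrees a b c d off) = agrees (cong not a) (cong not b) (cong not c) (cong not d) λ p q r s → cong not (off p q r s)

module Square {x : ℕ → Bool} {Sij Sjk Skl Sil Sik Sjl : Subset n} {i j k l : ℕ}
  (i<j : i ℕ.< j) (j<k : j ℕ.< k) (k<l : k ℕ.< l)
  (Aij : Agrees x (pad Sij) i j k l true true false false) (Ajk : Agrees x (pad Sjk) i j k l false true true false)
  (Akl : Agrees x (pad Skl) i j k l false false true true) (Ail : Agrees x (pad Sil) i j k l true false false true)
  (Aik : Agrees x (pad Sik) i j k l true false true false) (Ajl : Agrees x (pad Sjl) i j k l false true false true)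
  {U : Subset n} (nij : Sep U Sij) (njk : Sep U Sjk) (nkl : Sep U Skl) (nil : Sep U Sil) where

  sep-jl : U ≢ Sik → Sep U Sjl
  sep-jl ne = nonCrossing⇒sep (flip-NonCrossing i<j j<k k<l Aij Ajk Akl Ail Aik Ajl
    (sep⇒nonCrossing nij) (sep⇒nonCrossing njk) (sep⇒nonCrossing nkl) (sep⇒nonCrossing nil)
    (proj₁ (balanced ne)) (proj₂ (balanced ne)))

  -- Complementation exchanges the two diagonals of the square.
  sep-ik : U ≢ Sjl → Sep U Sik
  sep-ik ne = nonCrossing⇒sep (NonCrossing-not⁻ (flip-NonCrossing i<j j<k k<l
    (Agrees-not Akl) (Agrees-not Ail) (Agrees-not Aij) (Agrees-not Ajk) (Agrees-not Ajl) (Agrees-not Aik)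
    (NonCrossing-not (sep⇒nonCrossing nkl)) (NonCrossing-not (sep⇒nonCrossing nil))
    (NonCrossing-not (sep⇒nonCrossing nij)) (NonCrossing-not (sep⇒nonCrossing njk))
    (let _ , p , q = proj₂ (balanced ne) in _ , cong not q , cong not p)
    (let _ , p , q = proj₁ (balanced ne) in _ , cong not q , cong not p)))

-- The squares of padded sets behind the two kinds of flip

record Sets (X S : Subset n) (i j k : Fin n) (bi bj bk : Bool) : Set where
  constructor sets
  field
    set-i : S [ i ]= bi
    set-j : S [ j ]= bj
    set-k : S [ k ]= bk
    unset : ∀ {t} → t ≢ i → t ≢ j → t ≢ k → lookup S t ≡ lookup X t
open Sets

lookup-⊕ : ∀ (S : Subset n) {i t} → t ≢ i → lookup (S ⊕ i) t ≡ lookup S t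
lookup-⊕ S {i} {t} ne = lookup∘updateAt′ t i ne S

module _ {X : Subset n} {i j k : Fin n} (i<j : i < j) (j<k : j < k) (Xi : X ∌ i) (Xj : X ∌ j) (Xk : X ∌ k) where
  private
    i<k = <-trans i<j j<k
    s₁ pos : ℕ
    s₁ = suc ∣ X ∣
    -- This padding position belongs to the sets with one element added to X, which have size `s₁`,
    -- but not to those with two; it plays the part of l.
    pos = n + s₁
    base : ℕ → Bool
    base = padded (suc s₁) X

    off-pos : ∀ {s} → s ≡ s₁ ⊎ s ≡ suc s₁ → ∀ {t} → t ≢ s₁ → (s ≤ᵇ t) ≡ (suc s₁ ≤ᵇ t)
    off-pos (inj₂ refl) ne = refl
    off-pos (inj₁ refl) {t} ne with ℕₚ.<-cmp s₁ t
    ... | tri< lt _ _ = trans (true-≤ᵇ {s₁} {t} (ℕₚ.<⇒≤ lt)) (sym (true-≤ᵇ lt))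
    ... | tri≈ _ e _ = ⊥-elim (ne (sym e))
    ... | tri> _ _ gt = trans (false-≤ᵇ {s₁} {t} gt) (sym (false-≤ᵇ {suc s₁} {t} (ℕₚ.m<n⇒m<1+n gt)))

    agree : ∀ {S : Subset n} {bi bj bk} → Sets X S i j k bi bj bk → (sz : ∣ S ∣ ≡ s₁ ⊎ ∣ S ∣ ≡ suc s₁) →
      Agrees base (pad S) (toℕ i) (toℕ j) (toℕ k) pos bi bj bk (∣ S ∣ ≤ᵇ s₁)
    agree {S} (sets si sj sk off) sz = agrees (trans (padded-toℕ _ S i) ([]=⇒lookup si)) (trans (padded-toℕ _ S j) ([]=⇒lookup sj))
      (trans (padded-toℕ _ S k) ([]=⇒lookup sk)) (padded-+ _ S s₁) h
      where
      h : ∀ {t} → t ≢ toℕ i → t ≢ toℕ j → t ≢ toℕ k → t ≢ pos → pad S t ≡ base t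
      h {t} ni nj nk nl with position n t
      ... | inj₁ (a , refl) = trans (padded-toℕ _ S a) (trans (off (ni ∘ cong toℕ) (nj ∘ cong toℕ) (nk ∘ cong toℕ)) (sym (padded-toℕ _ X a)))
      ... | inj₂ (s , refl) = trans (padded-+ _ S s) (trans (off-pos sz (nl ∘ cong (n +_))) (sym (padded-+ _ X s)))

    fit : ∀ {S : Subset n} {bi bj bk} b → Sets X S i j k bi bj bk → ∣ S ∣ ≡ (if b then s₁ else suc s₁) →
      Agrees base (pad S) (toℕ i) (toℕ j) (toℕ k) pos bi bj bk b
    fit {S} true σ e = subst (Agrees base (pad S) _ _ _ pos _ _ _) (trans (cong (_≤ᵇ s₁) e) (true-≤ᵇ {s₁} ℕₚ.≤-refl)) (agree σ (inj₁ e))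
    fit {S} false σ e = subst (Agrees base (pad S) _ _ _ pos _ _ _) (trans (cong (_≤ᵇ s₁) e) (false-≤ᵇ {suc s₁} ℕₚ.≤-refl)) (agree σ (inj₂ e))

    size₂ : ∀ {a b} → X ∌ a → X ∌ b → a < b → ∣ X ⊕ a ⊕ b ∣ ≡ suc s₁
    size₂ p q a<b = trans (size-⊕ (⊕-∌ (>⇒≢ a<b) q)) (cong suc (size-⊕ p))

  module Hexagon {U : Subset n} (ni : Sep U (X ⊕ i)) (nk : Sep U (X ⊕ k)) (nij : Sep U (X ⊕ i ⊕ j)) (njk : Sep U (X ⊕ j ⊕ k)) where
    open Square {x = base} {X ⊕ i ⊕ j} {X ⊕ j ⊕ k} {X ⊕ k} {X ⊕ i} {X ⊕ i ⊕ k} {X ⊕ j} i<j j<k (ℕₚ.<-≤-trans (toℕ<n k) (ℕₚ.m≤m+n n _))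
      (fit false (sets (⊕-∋ j (⊕-here X i)) (⊕-here _ j) (⊕-∌ (>⇒≢ j<k) (⊕-∌ (>⇒≢ i<k) Xk)) λ p q r → trans (lookup-⊕ (X ⊕ i) q) (lookup-⊕ X p)) (size₂ Xi Xj i<j))
      (fit false (sets (⊕-∌ (<⇒≢ i<k) (⊕-∌ (<⇒≢ i<j) Xi)) (⊕-∋ k (⊕-here X j)) (⊕-here _ k) λ p q r → trans (lookup-⊕ (X ⊕ j) r) (lookup-⊕ X q)) (size₂ Xj Xk j<k))
      (fit true (sets (⊕-∌ (<⇒≢ i<k) Xi) (⊕-∌ (<⇒≢ j<k) Xj) (⊕-here X k) λ p q r → lookup-⊕ X r) (size-⊕ Xk))
      (fit true (sets (⊕-here X i) (⊕-∌ (>⇒≢ i<j) Xj) (⊕-∌ (>⇒≢ i<k) Xk) λ p q r → lookup-⊕ X p) (size-⊕ Xi))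
      (fit false (sets (⊕-∋ k (⊕-here X i)) (⊕-∌ (<⇒≢ j<k) (⊕-∌ (>⇒≢ i<j) Xj)) (⊕-here _ k) λ p q r → trans (lookup-⊕ (X ⊕ i) r) (lookup-⊕ X p)) (size₂ Xi Xk i<k))
      (fit true (sets (⊕-∌ (<⇒≢ i<j) Xi) (⊕-here X j) (⊕-∌ (>⇒≢ j<k) Xk) λ p q r → lookup-⊕ X q) (size-⊕ Xj))
      {U} nij njk nk ni public

module _ {X : Subset n} {i j k l : Fin n} (i<j : i < j) (j<k : j < k) (k<l : k < l)
  (Xi : X ∌ i) (Xj : X ∌ j) (Xk : X ∌ k) (Xl : X ∌ l) where
  private
    i<k = <-trans i<j j<k
    j<l = <-trans j<k k<l
    i<l = <-trans i<k k<l
    base : ℕ → Bool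
    base = padded (suc (suc ∣ X ∣)) X

    agree : ∀ {a b bi bj bk bl} → X ∌ a → X ∌ b → a < b →
      (∀ {t} → t ≢ i → t ≢ j → t ≢ k → t ≢ l → t ≢ a × t ≢ b) →
      X ⊕ a ⊕ b [ i ]= bi → X ⊕ a ⊕ b [ j ]= bj → X ⊕ a ⊕ b [ k ]= bk → X ⊕ a ⊕ b [ l ]= bl →
      Agrees base (pad (X ⊕ a ⊕ b)) (toℕ i) (toℕ j) (toℕ k) (toℕ l) bi bj bk bl
    agree {a} {b} Xa Xb a<b ne pi pj pk pl = agrees (at pi) (at pj) (at pk) (at pl) h
      where
      A = X ⊕ a ⊕ b
      at : ∀ {t v} → A [ t ]= v → pad A (toℕ t) ≡ v
      at {t} p = trans (padded-toℕ _ A t) ([]=⇒lookup p)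
      h : ∀ {t} → t ≢ toℕ i → t ≢ toℕ j → t ≢ toℕ k → t ≢ toℕ l → pad A t ≡ base t
      h {t} ni nj nk nl with position n t
      ... | inj₁ (c , refl) = let na , nb = ne (ni ∘ cong toℕ) (nj ∘ cong toℕ) (nk ∘ cong toℕ) (nl ∘ cong toℕ) in
            trans (padded-toℕ _ A c) (trans (lookup-⊕ (X ⊕ a) nb) (trans (lookup-⊕ X na) (sym (padded-toℕ _ X c))))
      ... | inj₂ (s , refl) = trans (padded-+ _ A s) (trans (cong (_≤ᵇ s) (trans (size-⊕ (⊕-∌ (>⇒≢ a<b) Xb)) (cong suc (size-⊕ Xa)))) (sym (padded-+ _ X s)))

  module Octahedron {U : Subset n} (nij : Sep U (X ⊕ i ⊕ j)) (njk : Sep U (X ⊕ j ⊕ k))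
    (nkl : Sep U (X ⊕ k ⊕ l)) (nil : Sep U (X ⊕ i ⊕ l)) where
    open Square {x = base} {X ⊕ i ⊕ j} {X ⊕ j ⊕ k} {X ⊕ k ⊕ l} {X ⊕ i ⊕ l} {X ⊕ i ⊕ k} {X ⊕ j ⊕ l} i<j j<k k<l
      (agree Xi Xj i<j (λ p q r s → p , q) (⊕-∋ j (⊕-here X i)) (⊕-here _ j) (⊕-∌ (>⇒≢ j<k) (⊕-∌ (>⇒≢ i<k) Xk)) (⊕-∌ (>⇒≢ j<l) (⊕-∌ (>⇒≢ i<l) Xl)))
      (agree Xj Xk j<k (λ p q r s → q , r) (⊕-∌ (<⇒≢ i<k) (⊕-∌ (<⇒≢ i<j) Xi)) (⊕-∋ k (⊕-here X j)) (⊕-here _ k) (⊕-∌ (>⇒≢ k<l) (⊕-∌ (>⇒≢ j<l) Xl)))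
      (agree Xk Xl k<l (λ p q r s → r , s) (⊕-∌ (<⇒≢ i<l) (⊕-∌ (<⇒≢ i<k) Xi)) (⊕-∌ (<⇒≢ j<l) (⊕-∌ (<⇒≢ j<k) Xj)) (⊕-∋ l (⊕-here X k)) (⊕-here _ l))
      (agree Xi Xl i<l (λ p q r s → p , s) (⊕-∋ l (⊕-here X i)) (⊕-∌ (<⇒≢ j<l) (⊕-∌ (>⇒≢ i<j) Xj)) (⊕-∌ (<⇒≢ k<l) (⊕-∌ (>⇒≢ i<k) Xk)) (⊕-here _ l))
      (agree Xi Xk i<k (λ p q r s → p , r) (⊕-∋ k (⊕-here X i)) (⊕-∌ (<⇒≢ j<k) (⊕-∌ (>⇒≢ i<j) Xj)) (⊕-here _ k) (⊕-∌ (>⇒≢ k<l) (⊕-∌ (>⇒≢ i<l) Xl)))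
      (agree Xj Xl j<l (λ p q r s → q , s) (⊕-∌ (<⇒≢ i<l) (⊕-∌ (<⇒≢ i<j) Xi)) (⊕-∋ l (⊕-here X j)) (⊕-∌ (<⇒≢ k<l) (⊕-∌ (>⇒≢ j<k) Xk)) (⊕-here _ l))
      {U} nij njk nkl nil public

─⁺ : Diff X Y i → i ∈ X ─ Y
─⁺ (here , here) = here
─⁺ (there p , there q) = there (─⁺ (p , q))

─⁻ : i ∈ X ─ Y → Diff X Y i
─⁻ {X = _ ∷ _} {false ∷ _} here = here , here
─⁻ {X = _ ∷ _} {_ ∷ _} (there p) = let q , r = ─⁻ p in there q , there r

≺⇒⊴ : X ≺ Y → X ⊴ Y
≺⇒⊴ (_ , f) p q = f _ _ (─⁺ p) (─⁺ q)

⊴⇒≺ : ∃ (Diff Y X) → X ⊴ Y → X ≺ Y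
⊴⇒≺ (i , d) f = (i , ─⁺ d) , λ _ _ p q → f (─⁻ p) (─⁻ q)

-- The middle element would belong to `Y₁` or `Y₂`, each of which lies on one side of all elements
-- of X alone. The relation `≺` compares differences of its arguments, whence the extra
-- non-memberships.
▷⇒NoAlt3 : X ▷ Y → NoAlt3 X Y
▷⇒NoAlt3 {X = X} {Y} (Y₁ , Y₂ , e , _ , _ , _ , _ , (_ , f) , (_ , g)) a<b b<c p q r
  with x∈p∪q⁻ Y₁ Y₂ (subst (_ ∈_) (sym e) (─⁺ q))
... | inj₁ q₁ = <-asym a<b (f _ _ (─⁺ (q₁ , b∉)) (─⁺ (─⁺ p , a∉)))
  where
  b∉ = case mem? (X ─ Y) _ of λ { (inj₁ w) → ⊥-elim (∋∌ (proj₁ (─⁻ w)) (proj₂ q)) ; (inj₂ w) → w }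
  a∉ = case mem? Y₁ _ of λ { (inj₁ w) → ⊥-elim (∋∌ (proj₁ p) (proj₂ (─⁻ (subst (_ ∈_) e (x∈p∪q⁺ (inj₁ w)))))) ; (inj₂ w) → w }
... | inj₂ q₂ = <-asym b<c (g _ _ (─⁺ (─⁺ r , c∉)) (─⁺ (q₂ , b∉)))
  where
  b∉ = case mem? (X ─ Y) _ of λ { (inj₁ w) → ⊥-elim (∋∌ (proj₁ (─⁻ w)) (proj₂ q)) ; (inj₂ w) → w }
  c∉ = case mem? Y₂ _ of λ { (inj₁ w) → ⊥-elim (∋∌ (proj₁ r) (proj₂ (─⁻ (subst (_ ∈_) e (x∈p∪q⁺ {p = Y₁} (inj₂ w)))))) ; (inj₂ w) → w }

ws⇒sep : WeaklySeparated X Y → Sep X Y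
ws⇒sep (inj₁ p) = ⊴⇒sep (≺⇒⊴ p)
ws⇒sep (inj₂ (inj₁ p)) = Sep-sym (⊴⇒sep (≺⇒⊴ p))
ws⇒sep (inj₂ (inj₂ (inj₁ (p , le)))) = noAlt3⇒sep (▷⇒NoAlt3 p) le
ws⇒sep (inj₂ (inj₂ (inj₂ (p , le)))) = Sep-sym (noAlt3⇒sep (▷⇒NoAlt3 p) le)

record Extremes (X Y : Subset n) : Set where
  field
    {min max} : Fin n
    min-diff : Diff X Y min
    max-diff : Diff X Y max
    min-≤ : ∀ {i} → Diff X Y i → toℕ min ≤ toℕ i
    ≤-max : ∀ {i} → Diff X Y i → toℕ i ≤ toℕ max

extremes : ∃ (Diff X Y) → Extremes X Y
extremes {X = X} {Y} (i , d) with earliest (lookup (X ─ Y)) ([]=⇒lookup (─⁺ d)) | latest-from (lookup (X ─ Y)) ([]=⇒lookup (─⁺ d))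
... | a , a∈ , f | b , b∈ , _ , g = record
  { min-diff = ─⁻ (lookup⇒[]= a (X ─ Y) a∈) ; max-diff = ─⁻ (lookup⇒[]= b (X ─ Y) b∈)
  ; min-≤ = λ d → ℕₚ.≮⇒≥ λ lt → true≢false ([]=⇒lookup (─⁺ d)) (f lt)
  ; ≤-max = λ d → ℕₚ.≮⇒≥ λ lt → true≢false ([]=⇒lookup (─⁺ d)) (g lt) }

-- When the differences interleave, X ∖ Y splits at the least element of Y ∖ X.
surround : Sep X Y → (E : Extremes X Y) (F : Extremes Y X) → let open Extremes in
  min E < min F → min F < max E → Y ▷ X × ∣ X ∣ ≤ ∣ Y ∣
surround {n} {X} {Y} s E F lt lt′ = (X₁ , X₂ , un , di , (min E , x₁) , (max E , x₂) , (min F , ─⁺ (min-diff F)) ,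
    ⊴⇒≺ (min F , ─⁺ (min-diff F) , ∌X₁) (λ p q → ℕₚ.<-≤-trans (proj₂ (seg-∋⁻ {t = 0} {y₀} (proj₂ (x∈p∩q⁻ _ _ (proj₁ p))))) (min-≤ F (─⁻ (proj₁ q)))) ,
    ⊴⇒≺ (max E , x₂ , ∌Y) (λ p q → after-y (─⁻ (proj₁ p)) (proj₁ q))) ,
  ℕₚ.≮⇒≥ λ gt → no3 s gt lt lt′ (min-diff E) (min-diff F) (max-diff E)
  where
  open Extremes
  y₀ = toℕ (min F)
  X₁ = (X ─ Y) ∩ seg 0 y₀
  X₂ = (X ─ Y) ∩ seg y₀ n
  high : ∀ {i : Fin n} → y₀ ≤ toℕ i → seg y₀ n ∋ i
  high {i} le = seg-∋ le (ℕₚ.<-≤-trans (toℕ<n i) (ℕₚ.m≤n+m n y₀))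
  x₁ = x∈p∩q⁺ (─⁺ (min-diff E) , seg-∋ z≤n lt)
  x₂ = x∈p∩q⁺ (─⁺ (max-diff E) , high (ℕₚ.<⇒≤ lt′))
  un : X₁ ∪ X₂ ≡ X ─ Y
  un = ⊑-antisym (λ p → case x∈p∪q⁻ X₁ X₂ p of λ { (inj₁ q) → proj₁ (x∈p∩q⁻ _ _ q) ; (inj₂ q) → proj₁ (x∈p∩q⁻ _ _ q) })
    λ {i} p → case ℕₚ.≤-<-connex y₀ (toℕ i) of λ
      { (inj₁ le) → x∈p∪q⁺ {p = X₁} (inj₂ (x∈p∩q⁺ (p , high le))) ; (inj₂ lt) → x∈p∪q⁺ (inj₁ (x∈p∩q⁺ (p , seg-∋ z≤n lt))) }
  di : X₁ ∩ X₂ ≡ ∅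
  di = ⊑-antisym (λ p → let q , r = x∈p∩q⁻ X₁ X₂ p in
      ⊥-elim (ℕₚ.<⇒≱ (proj₂ (seg-∋⁻ {t = 0} {y₀} (proj₂ (x∈p∩q⁻ (X ─ Y) _ q)))) (proj₁ (seg-∋⁻ {t = y₀} {n} (proj₂ (x∈p∩q⁻ (X ─ Y) _ r))))))
    λ p → ⊥-elim (∉⊥ p)
  ∌X₁ : X₁ ∌ min F
  ∌X₁ = case mem? X₁ (min F) of λ { (inj₁ w) → ⊥-elim (∋∌ (proj₁ (─⁻ (proj₁ (x∈p∩q⁻ (X ─ Y) _ w)))) (proj₂ (min-diff F))) ; (inj₂ w) → w }
  ∌Y : Y ─ X ∌ max E
  ∌Y = case mem? (Y ─ X) (max E) of λ { (inj₁ w) → ⊥-elim (∋∌ (proj₁ (max-diff E)) (proj₂ (─⁻ w))) ; (inj₂ w) → w }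
  after-y : Diff Y X i → X₂ ∋ j → i < j
  after-y {i} {j} dy xj with ─⁻ (proj₁ (x∈p∩q⁻ (X ─ Y) _ xj)) | proj₁ (seg-∋⁻ {t = y₀} {n} (proj₂ (x∈p∩q⁻ (X ─ Y) _ xj))) | <-cmp i j
  ... | dx | le | tri< l _ _ = l
  ... | dx | le | tri≈ _ refl _ = ⊥-elim (∋∌ (proj₁ dx) (proj₂ dy))
  ... | dx | le | tri> _ _ gt = ⊥-elim (no4 s lt (ℕₚ.≤∧≢⇒< le λ e → ∋∌ (proj₁ dx) (subst (λ t → X ∌ t) (toℕ-injective e) (proj₂ (min-diff F))))
        gt (min-diff E) (min-diff F) dx dy)

-- With both differences nonempty, their extremes decide: if the ranges are disjoint, one of the
-- relations `≺` holds; otherwise the difference with the smaller minimum reaches beyond the minimum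
-- of the other, and `surround` applies.
sep⇒ws : X ≢ Y → Sep X Y → WeaklySeparated X Y
sep⇒ws {X = X} {Y} ne s with diff? X Y | diff? Y X
... | inj₂ f | inj₂ g = ⊥-elim (ne (⊑-antisym f g))
... | inj₂ f | inj₁ d = inj₁ (⊴⇒≺ d λ p _ → ⊥-elim (∋∌ (f (proj₁ p)) (proj₂ p)))
... | inj₁ d | inj₂ g = inj₂ (inj₁ (⊴⇒≺ d λ p _ → ⊥-elim (∋∌ (g (proj₁ p)) (proj₂ p))))
... | inj₁ d | inj₁ d′ = go (<-cmp (max E) (min F)) (<-cmp (max F) (min E)) (<-cmp (min E) (min F))
  where
  open Extremes
  E = extremes d
  F = extremes d′
  clash : ∀ {i} → Diff X Y i → Diff Y X i → ⊥
  clash p q = ∋∌ (proj₁ p) (proj₂ q)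
  go : _ → _ → _ → WeaklySeparated X Y
  go (tri≈ _ e _) _ _ = ⊥-elim (clash (max-diff E) (subst (Diff Y X) (sym e) (min-diff F)))
  go _ (tri≈ _ e _) _ = ⊥-elim (clash (min-diff E) (subst (Diff Y X) e (max-diff F)))
  go _ _ (tri≈ _ e _) = ⊥-elim (clash (min-diff E) (subst (Diff Y X) (sym e) (min-diff F)))
  go (tri< lt _ _) _ _ = inj₁ (⊴⇒≺ d′ λ p q → ℕₚ.≤-<-trans (≤-max E p) (ℕₚ.<-≤-trans lt (min-≤ F q)))
  go _ (tri< lt _ _) _ = inj₂ (inj₁ (⊴⇒≺ d λ p q → ℕₚ.≤-<-trans (≤-max F p) (ℕₚ.<-≤-trans lt (min-≤ E q))))
  go (tri> _ _ gt) (tri> _ _ gt′) (tri< lt _ _) = inj₂ (inj₂ (inj₂ (surround s E F lt gt)))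
  go (tri> _ _ gt) (tri> _ _ gt′) (tri> _ _ lt) = inj₂ (inj₂ (inj₁ (surround (Sep-sym s) F E lt gt′)))

ws⇒separated : {C : Collection n} → WSCollection C → Separated C
ws⇒separated w {X} {Y} p q with X ≟ˢ Y
... | yes refl = Sep-refl
... | no ne = ws⇒sep (w X Y p q ne)

separated⇒ws : {C : Collection n} → Separated C → WSCollection C
separated⇒ws s X Y p q ne = sep⇒ws ne (s p q)

-- Maximum collections and swaps

record Max (m′ m : ℕ) (C : Collection n) : Set where
  constructor maximum
  field
    within : InsideΔ m′ m C
    apart : Separated C
    most : ∀ (D : Collection n) → InsideΔ m′ m D → Separated D → # D ≤ # C
open Max public

MaxWS⇒Max : ∀ {m′ m} {C : Collection n} → MaxWS m′ m C → Max m′ m C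
MaxWS⇒Max {C = C} (w , s , b) = maximum w (ws⇒separated s) λ D wD sD →
  subst₂ _≤_ (card≡# D) (card≡# C) (b D wD (separated⇒ws {C = D} sD))

Max⇒MaxWS : ∀ {m′ m} {C : Collection n} → Max m′ m C → MaxWS m′ m C
Max⇒MaxWS {C = C} (maximum w s b) = w , separated⇒ws {C = C} s , λ D wD sD →
  subst₂ _≤_ (sym (card≡# D)) (sym (card≡# C)) (b D wD (ws⇒separated {C = D} sD))

-- A swap keeps the number of members, so only the new set `Z` has to be tested against the old
-- ones.
swap-max : ∀ {m′ m} {C D : Collection n} → Max m′ m C → Swap C D Y Z → InΔ m′ m Z →
  (∀ {U} → U ∈ᶜ C → U ≢ Y → Sep U Z) → Max m′ m D
swap-max {n} {Y} {Z} {m′} {m} {C} {D} M sw@(CY , CZ , DY , DZ , e) δ h = maximum inD sepD λ D′ w s →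
  subst (# D′ ≤_) (ℕₚ.+-cancelʳ-≡ 1 (# C) (# D) (weight-swap (λ _ → 1) sw)) (most M D′ w s)
  where
  old : ∀ {S} → S ∈ᶜ D → S ≢ Z → S ∈ᶜ C × S ≢ Y
  old {S} p S≢Z = trans (sym (e S S≢Y S≢Z)) p , S≢Y
    where
    S≢Y : S ≢ Y
    S≢Y refl = true≢false p DY
  inD : InsideΔ m′ m D
  inD S p with S ≟ˢ Z
  ... | yes refl = δ
  ... | no ne = within M S (proj₁ (old p ne))
  sepD : Separated D
  sepD {A} {B} p q with A ≟ˢ Z | B ≟ˢ Z
  ... | yes refl | yes refl = Sep-refl
  ... | yes refl | no ne = let b , ne′ = old q ne in Sep-sym (h b ne′)
  ... | no ne | yes refl = let a , ne′ = old p ne in h a ne′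
  ... | no ne | no ne′ = apart M (proj₁ (old p ne)) (proj₁ (old q ne′))

Swap-sym : ∀ {C D : Collection n} → Swap C D Y Z → Swap D C Z Y
Swap-sym (a , b , c , d , e) = d , c , b , a , λ S p q → sym (e S q p)

-- Lowering flips with Xij written X ⊕ i ⊕ j; the bounds lo and hi replace the six conditions InΔ.

record Low3 (m′ m : ℕ) (C D : Collection n) : Set where
  constructor low3
  field
    {base} : Subset n
    {i₁ i₂ i₃} : Fin n
    1<2 : i₁ < i₂
    2<3 : i₂ < i₃
    ∌₁ : base ∌ i₁
    ∌₂ : base ∌ i₂
    ∌₃ : base ∌ i₃
    lo : m′ ≤ suc ∣ base ∣
    hi : suc (suc ∣ base ∣) ≤ m
    +₁ : base ⊕ i₁ ∈ᶜ C
    +₃ : base ⊕ i₃ ∈ᶜ C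
    +₁₂ : base ⊕ i₁ ⊕ i₂ ∈ᶜ C
    +₂₃ : base ⊕ i₂ ⊕ i₃ ∈ᶜ C
    swap : Swap C D (base ⊕ i₁ ⊕ i₃) (base ⊕ i₂)

record Low4 (m′ m : ℕ) (P : ℕ → Set) (C D : Collection n) : Set where
  constructor low4
  field
    {base} : Subset n
    {i₁ i₂ i₃ i₄} : Fin n
    1<2 : i₁ < i₂
    2<3 : i₂ < i₃
    3<4 : i₃ < i₄
    ∌₁ : base ∌ i₁
    ∌₂ : base ∌ i₂
    ∌₃ : base ∌ i₃
    ∌₄ : base ∌ i₄
    lvl : P ∣ base ∣
    lo : m′ ≤ suc (suc ∣ base ∣)
    hi : suc (suc ∣ base ∣) ≤ m
    +₁₂ : base ⊕ i₁ ⊕ i₂ ∈ᶜ C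
    +₃₄ : base ⊕ i₃ ⊕ i₄ ∈ᶜ C
    +₁₄ : base ⊕ i₁ ⊕ i₄ ∈ᶜ C
    +₂₃ : base ⊕ i₂ ⊕ i₃ ∈ᶜ C
    swap : Swap C D (base ⊕ i₂ ⊕ i₄) (base ⊕ i₁ ⊕ i₃)

∪-⁅⁆ : (X : Subset n) (i : Fin n) → X ∪ ⁅ i ⁆ ≡ X ⊕ i
∪-⁅⁆ (x ∷ X) zero = cong₂ _∷_ (∨-zeroʳ x) (∪-identityʳ X)
∪-⁅⁆ (x ∷ X) (suc i) = cong₂ _∷_ (∨-identityʳ x) (∪-⁅⁆ X i)

∪-⁅⁆-⁅⁆ : (X : Subset n) (i j : Fin n) → X ∪ ⁅ i ⁆ ∪ ⁅ j ⁆ ≡ X ⊕ i ⊕ j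
∪-⁅⁆-⁅⁆ X i j = trans (sym (∪-assoc X ⁅ i ⁆ ⁅ j ⁆)) (trans (cong (_∪ ⁅ j ⁆) (∪-⁅⁆ X i)) (∪-⁅⁆ (X ⊕ i) j))

∉⇒∌ : i ∉ S → S ∌ i
∉⇒∌ {i = i} {S} p = case mem? S i of λ { (inj₁ q) → ⊥-elim (p q) ; (inj₂ q) → q }

∌⇒∉ : S ∌ i → i ∉ S
∌⇒∉ p q = ∋∌ q p

size-⊕⊕ : S ∌ i → S ∌ j → i < j → ∣ S ⊕ i ⊕ j ∣ ≡ suc (suc ∣ S ∣)
size-⊕⊕ Si Sj lt = trans (size-⊕ (⊕-∌ (>⇒≢ lt) Sj)) (cong suc (size-⊕ Si))

Lower3⇒Low3 : ∀ {m′ m} {C D : Collection n} → Lower3 m′ m C D → Low3 m′ m C D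
Lower3⇒Low3 (i , j , k , X , i<j , j<k , Xi , Xj , Xk , δi , δj , δk , δij , δjk , δik , ci , ck , cij , cjk , sw)
  rewrite ∪-⁅⁆ X i | ∪-⁅⁆ X j | ∪-⁅⁆ X k | ∪-⁅⁆ (X ⊕ i) j | ∪-⁅⁆ (X ⊕ j) k | ∪-⁅⁆ (X ⊕ i) k =
  low3 i<j j<k (∉⇒∌ Xi) (∉⇒∌ Xj) (∉⇒∌ Xk) (subst (_ ≤_) (size-⊕ (∉⇒∌ Xi)) (proj₁ δi))
    (subst (_≤ _) (size-⊕⊕ (∉⇒∌ Xi) (∉⇒∌ Xj) i<j) (proj₂ δij)) ci ck cij cjk sw

Low3⇒Lower3 : ∀ {m′ m} {C D : Collection n} → Low3 m′ m C D → Lower3 m′ m C D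
Low3⇒Lower3 {m′ = m′} {m} {C} {D} (low3 {X} {i} {j} {k} i<j j<k Xi Xj Xk lo hi ci ck cij cjk sw) =
  i , j , k , X , i<j , j<k , ∌⇒∉ Xi , ∌⇒∉ Xj , ∌⇒∉ Xk ,
  body (∪-⁅⁆ X i) (∪-⁅⁆ X j) (∪-⁅⁆ X k) (pair i j) (pair j k) (pair i k)
  where
  one : ∀ {t} → X ∌ t → InΔ m′ m (X ⊕ t)
  one p = subst (m′ ≤_) (sym (size-⊕ p)) lo , subst (_≤ m) (sym (size-⊕ p)) (ℕₚ.<⇒≤ hi)
  two : ∀ {s t} → X ∌ s → X ∌ t → s < t → InΔ m′ m (X ⊕ s ⊕ t)
  two p q lt = subst (m′ ≤_) (sym (size-⊕⊕ p q lt)) (ℕₚ.m≤n⇒m≤1+n lo) , subst (_≤ m) (sym (size-⊕⊕ p q lt)) hi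
  pair : ∀ s t → (X ∪ ⁅ s ⁆) ∪ ⁅ t ⁆ ≡ X ⊕ s ⊕ t
  pair s t = trans (cong (_∪ ⁅ t ⁆) (∪-⁅⁆ X s)) (∪-⁅⁆ (X ⊕ s) t)
  body : ∀ {A₁ A₂ A₃ A₁₂ A₂₃ A₁₃} → A₁ ≡ X ⊕ i → A₂ ≡ X ⊕ j → A₃ ≡ X ⊕ k → A₁₂ ≡ X ⊕ i ⊕ j → A₂₃ ≡ X ⊕ j ⊕ k → A₁₃ ≡ X ⊕ i ⊕ k →
    InΔ m′ m A₁ × InΔ m′ m A₂ × InΔ m′ m A₃ × InΔ m′ m A₁₂ × InΔ m′ m A₂₃ × InΔ m′ m A₁₃ ×
    A₁ ∈ᶜ C × A₃ ∈ᶜ C × A₁₂ ∈ᶜ C × A₂₃ ∈ᶜ C × Swap C D A₁₃ A₂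
  body refl refl refl refl refl refl =
    one Xi , one Xj , one Xk , two Xi Xj i<j , two Xj Xk j<k , two Xi Xk (<-trans i<j j<k) , ci , ck , cij , cjk , sw

Lower4⇒Low4 : ∀ {m′ m P} {C D : Collection n} → Lower4With m′ m P C D → Low4 m′ m P C D
Lower4⇒Low4 (i , j , k , l , X , i<j , j<k , k<l , Xi , Xj , Xk , Xl , lv , δij , _ , _ , _ , _ , _ , cij , ckl , cil , cjk , sw)
  rewrite ∪-⁅⁆-⁅⁆ X i j | ∪-⁅⁆-⁅⁆ X k l | ∪-⁅⁆-⁅⁆ X i l | ∪-⁅⁆-⁅⁆ X j k | ∪-⁅⁆-⁅⁆ X i k | ∪-⁅⁆-⁅⁆ X j l =
  low4 i<j j<k k<l (∉⇒∌ Xi) (∉⇒∌ Xj) (∉⇒∌ Xk) (∉⇒∌ Xl) lv (subst (_ ≤_) (size-⊕⊕ (∉⇒∌ Xi) (∉⇒∌ Xj) i<j) (proj₁ δij))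
    (subst (_≤ _) (size-⊕⊕ (∉⇒∌ Xi) (∉⇒∌ Xj) i<j) (proj₂ δij)) cij ckl cil cjk sw

Low4⇒Lower4 : ∀ {m′ m P} {C D : Collection n} → Low4 m′ m P C D → Lower4With m′ m P C D
Low4⇒Lower4 {m′ = m′} {m} {P} {C} {D} (low4 {X} {i} {j} {k} {l} i<j j<k k<l Xi Xj Xk Xl lv lo hi cij ckl cil cjk sw) =
  i , j , k , l , X , i<j , j<k , k<l , ∌⇒∉ Xi , ∌⇒∉ Xj , ∌⇒∉ Xk , ∌⇒∉ Xl , lv ,
  body (∪-⁅⁆-⁅⁆ X i j) (∪-⁅⁆-⁅⁆ X k l) (∪-⁅⁆-⁅⁆ X i l) (∪-⁅⁆-⁅⁆ X j k) (∪-⁅⁆-⁅⁆ X i k) (∪-⁅⁆-⁅⁆ X j l)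
  where
  two : ∀ {s t} → X ∌ s → X ∌ t → s < t → InΔ m′ m (X ⊕ s ⊕ t)
  two p q lt = subst (m′ ≤_) (sym (size-⊕⊕ p q lt)) lo , subst (_≤ m) (sym (size-⊕⊕ p q lt)) hi
  body : ∀ {A₁₂ A₃₄ A₁₄ A₂₃ A₁₃ A₂₄} → A₁₂ ≡ X ⊕ i ⊕ j → A₃₄ ≡ X ⊕ k ⊕ l → A₁₄ ≡ X ⊕ i ⊕ l → A₂₃ ≡ X ⊕ j ⊕ k →
    A₁₃ ≡ X ⊕ i ⊕ k → A₂₄ ≡ X ⊕ j ⊕ l →
    InΔ m′ m A₁₂ × InΔ m′ m A₃₄ × InΔ m′ m A₁₄ × InΔ m′ m A₂₃ × InΔ m′ m A₁₃ × InΔ m′ m A₂₄ ×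
    A₁₂ ∈ᶜ C × A₃₄ ∈ᶜ C × A₁₄ ∈ᶜ C × A₂₃ ∈ᶜ C × Swap C D A₂₄ A₁₃
  body refl refl refl refl refl refl =
    two Xi Xj i<j , two Xk Xl k<l , two Xi Xl (<-trans i<j (<-trans j<k k<l)) , two Xj Xk j<k ,
    two Xi Xk (<-trans i<j j<k) , two Xj Xl (<-trans j<k k<l) , cij , ckl , cil , cjk , sw

-- Descent to the standard collection

∋∌-≢ : ∀ {A B : Subset n} {t} → A ∋ t → B ∌ t → A ≢ B
∋∌-≢ p q refl = ∋∌ p q

kept : {C D : Collection n} → Swap C D Y Z → S ∈ᶜ C → S ≢ Y → S ≢ Z → S ∈ᶜ D
kept {S = S} (_ , _ , _ , _ , e) p ne ne′ = trans (e S ne ne′) p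

low3-max : {C D : Collection n} → Low3 m′ m C D → Max m′ m C → Max m′ m D
low3-max (low3 1<2 2<3 ∌₁ ∌₂ ∌₃ lo hi +₁ +₃ +₁₂ +₂₃ sw) M = swap-max M sw
  (subst (_ ≤_) (sym (size-⊕ ∌₂)) lo , subst (_≤ _) (sym (size-⊕ ∌₂)) (ℕₚ.<⇒≤ hi))
  λ u ne → Hexagon.sep-jl 1<2 2<3 ∌₁ ∌₂ ∌₃ (apart M u +₁) (apart M u +₃) (apart M u +₁₂) (apart M u +₂₃) ne

-- The flip lists its four witnesses as members of D; they differ from both exchanged sets and are
-- therefore in C as well.
raise3-max : {C D : Collection n} → Low3 m′ m D C → Max m′ m C → Max m′ m D
raise3-max (low3 {X} {i} {j} {k} 1<2 2<3 ∌₁ ∌₂ ∌₃ lo hi +₁ +₃ +₁₂ +₂₃ sw) M = swap-max M (Swap-sym sw)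
  (subst (_ ≤_) (sym (size-⊕⊕ ∌₁ ∌₃ 1<3)) (ℕₚ.m≤n⇒m≤1+n lo) , subst (_≤ _) (sym (size-⊕⊕ ∌₁ ∌₃ 1<3)) hi)
  λ u ne → Hexagon.sep-ik 1<2 2<3 ∌₁ ∌₂ ∌₃
    (apart M u (kept sw +₁ (≢-sym (∋∌-≢ (⊕-here _ k) (⊕-∌ (>⇒≢ 1<3) ∌₃))) (∋∌-≢ (⊕-here X i) (⊕-∌ (<⇒≢ 1<2) ∌₁))))
    (apart M u (kept sw +₃ (≢-sym (∋∌-≢ (⊕-∋ k (⊕-here X i)) (⊕-∌ (<⇒≢ 1<3) ∌₁))) (∋∌-≢ (⊕-here X k) (⊕-∌ (>⇒≢ 2<3) ∌₃))))
    (apart M u (kept sw +₁₂ (∋∌-≢ (⊕-here _ j) (⊕-∌ (<⇒≢ 2<3) (⊕-∌ (>⇒≢ 1<2) ∌₂))) (∋∌-≢ (⊕-∋ j (⊕-here X i)) (⊕-∌ (<⇒≢ 1<2) ∌₁))))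
    (apart M u (kept sw +₂₃ (∋∌-≢ (⊕-∋ k (⊕-here X j)) (⊕-∌ (<⇒≢ 2<3) (⊕-∌ (>⇒≢ 1<2) ∌₂))) (∋∌-≢ (⊕-here _ k) (⊕-∌ (>⇒≢ 2<3) ∌₃)))) ne
  where
  1<3 = <-trans 1<2 2<3

low4-max : ∀ {P} {C D : Collection n} → Low4 m′ m P C D → Max m′ m C → Max m′ m D
low4-max (low4 1<2 2<3 3<4 ∌₁ ∌₂ ∌₃ ∌₄ lv lo hi +₁₂ +₃₄ +₁₄ +₂₃ sw) M = swap-max M sw
  (subst (_ ≤_) (sym (size-⊕⊕ ∌₁ ∌₃ (<-trans 1<2 2<3))) lo , subst (_≤ _) (sym (size-⊕⊕ ∌₁ ∌₃ (<-trans 1<2 2<3))) hi)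
  λ u ne → Octahedron.sep-ik 1<2 2<3 3<4 ∌₁ ∌₂ ∌₃ ∌₄ (apart M u +₁₂) (apart M u +₂₃) (apart M u +₃₄) (apart M u +₁₄) ne

raise4-max : ∀ {P} {C D : Collection n} → Low4 m′ m P D C → Max m′ m C → Max m′ m D
raise4-max (low4 {X} {i} {j} {k} {l} 1<2 2<3 3<4 ∌₁ ∌₂ ∌₃ ∌₄ lv lo hi +₁₂ +₃₄ +₁₄ +₂₃ sw) M = swap-max M (Swap-sym sw)
  (subst (_ ≤_) (sym (size-⊕⊕ ∌₂ ∌₄ 2<4)) lo , subst (_≤ _) (sym (size-⊕⊕ ∌₂ ∌₄ 2<4)) hi)
  λ u ne → Octahedron.sep-jl 1<2 2<3 3<4 ∌₁ ∌₂ ∌₃ ∌₄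
    (apart M u (kept sw +₁₂ (∋∌-≢ (⊕-∋ j (⊕-here X i)) i∉jl) (∋∌-≢ (⊕-here _ j) j∉ik)))
    (apart M u (kept sw +₂₃ (∋∌-≢ (⊕-here _ k) k∉jl) (∋∌-≢ (⊕-∋ k (⊕-here X j)) j∉ik)))
    (apart M u (kept sw +₃₄ (∋∌-≢ (⊕-∋ l (⊕-here X k)) k∉jl) (∋∌-≢ (⊕-here _ l) l∉ik)))
    (apart M u (kept sw +₁₄ (∋∌-≢ (⊕-∋ l (⊕-here X i)) i∉jl) (∋∌-≢ (⊕-here _ l) l∉ik))) ne
  where
  2<4 = <-trans 2<3 3<4
  1<3 = <-trans 1<2 2<3
  i∉jl : X ⊕ j ⊕ l ∌ i
  i∉jl = ⊕-∌ (<⇒≢ (<-trans 1<2 2<4)) (⊕-∌ (<⇒≢ 1<2) ∌₁)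
  k∉jl : X ⊕ j ⊕ l ∌ k
  k∉jl = ⊕-∌ (<⇒≢ 3<4) (⊕-∌ (>⇒≢ 2<3) ∌₃)
  j∉ik : X ⊕ i ⊕ k ∌ j
  j∉ik = ⊕-∌ (<⇒≢ 2<3) (⊕-∌ (>⇒≢ 1<2) ∌₂)
  l∉ik : X ⊕ i ⊕ k ∌ l
  l∉ik = ⊕-∌ (>⇒≢ 3<4) (⊕-∌ (>⇒≢ (<-trans 1<3 3<4)) ∌₄)

-- Completion to a full collection and the single lowering step

exchanged : Subset n → Subset n → Collection n → Collection n
exchanged Y Z C = insert Z (remove Y C)

exchanged-swap : (C : Collection n) → Y ∈ᶜ C → C Z ≡ false → Swap C (exchanged Y Z C) Y Z
exchanged-swap {Y = Y} {Z} C p q = p , q ,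
  trans (insert-there Z (remove Y C) Y≢Z) (remove-here Y C) , insert-here Z (remove Y C) ,
  λ S ne ne′ → trans (insert-there Z (remove Y C) ne′) (remove-there Y C ne)
  where
  Y≢Z : Y ≢ Z
  Y≢Z refl = true≢false p q

inΔ : ℕ → ℕ → Collection n
inΔ m′ m S = (m′ ≤ᵇ ∣ S ∣) ∧ (∣ S ∣ ≤ᵇ m)

inΔ-true : InΔ m′ m S → inΔ m′ m S ≡ true
inΔ-true (p , q) = ∧-intro (true-≤ᵇ p) (true-≤ᵇ q)

true-inΔ : S ∈ᶜ inΔ m′ m → InΔ m′ m S
true-inΔ {S = S} {m′} p = let q , r = ∧-true {m′ ≤ᵇ ∣ S ∣} p in ≤ᵇ-true q , ≤ᵇ-true r

inΔ-false : inΔ m′ m S ≡ false → ∣ S ∣ ℕ.< m′ ⊎ m ℕ.< ∣ S ∣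
inΔ-false {m′} {m} {S = S} p with ℕₚ.≤-<-connex m′ ∣ S ∣ | ℕₚ.≤-<-connex ∣ S ∣ m
... | inj₂ lt | _ = inj₁ lt
... | _ | inj₂ lt = inj₂ lt
... | inj₁ a | inj₁ b = ⊥-elim (true≢false (inΔ-true {S = S} (a , b)) p)

complete : ℕ → ℕ → Collection n → Collection n
complete m′ m C S = if inΔ m′ m S then C S else J m′ S

remainder : ℕ → ℕ → Collection n
remainder m′ m S = J m′ S ∧ not (inΔ m′ m S)

standard : ℕ → ℕ → Collection n
standard m′ m S = J m′ S ∧ inΔ m′ m S

complete-in : (C : Collection n) → InΔ m′ m S → complete m′ m C S ≡ C S
complete-in {m′ = m′} {m} {S} C δ rewrite inΔ-true {m′} {m} {S = S} δ = refl

#-complete : {C : Collection n} → InsideΔ m′ m C → # (complete m′ m C) ≡ # C + # (remainder {n} m′ m)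
#-complete {n} {m′} {m} {C} w = trans (#-restrict (complete m′ m C) (inΔ m′ m)) (cong₂ _+_
  (weight-cong (λ _ → 1) e₁) (weight-cong (λ _ → 1) e₂))
  where
  e₁ : (λ S → complete m′ m C S ∧ inΔ m′ m S) ≐ C
  e₁ S with inΔ m′ m S in eq | C S in eqC
  ... | true | true = refl
  ... | true | false = refl
  ... | false | false with J m′ S
  ...   | true = refl
  ...   | false = refl
  e₁ S | false | true = ⊥-elim (true≢false (inΔ-true {S = S} (w S eqC)) eq)
  e₂ : (λ S → complete m′ m C S ∧ not (inΔ m′ m S)) ≐ remainder m′ m
  e₂ S with inΔ m′ m S | C S | J m′ S
  ... | true | true | true = refl
  ... | true | true | false = refl
  ... | true | false | true = refl
  ... | true | false | false = refl
  ... | false | _ | _ = refl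

#-J : ∀ m′ m → # (J {n} m′) ≡ # (standard {n} m′ m) + # (remainder {n} m′ m)
#-J {n} m′ m = #-restrict (J {n} m′) (inΔ m′ m)

standard-within : ∀ m′ m → InsideΔ {n} m′ m (standard m′ m)
standard-within m′ m S p = true-inΔ {S = S} (proj₂ (∧-true {J m′ S} p))

standard-separated : ∀ m′ m → Separated (standard {n} m′ m)
standard-separated m′ m {X} {Y} p q = J-separated m′ {X} {Y} (proj₁ (∧-true {J m′ X} p)) (proj₁ (∧-true {J m′ Y} q))

non-interval : interval S ≡ false → ∃ λ a → ∃ λ b → ∃ λ c → a < b × b < c × S ∋ a × S ∌ b × S ∋ c
non-interval {S = false ∷ S} p = let a , b , c , a<b , b<c , x , y , z = non-interval {S = S} p in
  suc a , suc b , suc c , s≤s a<b , s≤s b<c , there x , there y , there z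
non-interval {S = true ∷ S} p = let b , c , b<c , y , z = non-initial {S = S} p in
  zero , suc b , suc c , s≤s z≤n , s≤s b<c , here , there y , there z
  where
  non-zeros : ∀ {n} {S : Subset n} → zeros S ≡ false → ∃ λ c → S ∋ c
  non-zeros {S = true ∷ S} p = zero , here
  non-zeros {S = false ∷ S} p = let c , z = non-zeros {S = S} p in suc c , there z
  non-initial : ∀ {n} {S : Subset n} → initial S ≡ false → ∃ λ b → ∃ λ c → b < c × S ∌ b × S ∋ c
  non-initial {S = true ∷ S} p = let b , c , b<c , y , z = non-initial {S = S} p in suc b , suc c , s≤s b<c , there y , there z
  non-initial {S = false ∷ S} p = let c , z = non-zeros {S = S} p in zero , suc c , s≤s z≤n , here , there z

IntervalsAbove : Collection n → ℕ → Set
IntervalsAbove C h = ∀ {S} → S ∈ᶜ C → h ℕ.< ∣ S ∣ → interval S ≡ true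

module _ {m′ m : ℕ} (m′≤m : m′ ≤ m) where

  -- Sets added below Δ are cointervals, separated from everything not smaller; sets added above Δ
  -- are intervals, separated from everything not larger.
  inner-remainder-sep : {C : Collection n} → InsideΔ m′ m C → S ∈ᶜ C → inΔ m′ m T ≡ false → T ∈ᶜ J m′ → Sep S T
  inner-remainder-sep {S = X} {Y} w p e q with inΔ-false {S = Y} e
  ... | inj₁ lt = cointerval-sep (trans (sym (J-below Y lt)) q) (ℕₚ.≤-trans (ℕₚ.<⇒≤ lt) (proj₁ (w X p)))
  ... | inj₂ gt = Sep-sym (interval-sep (trans (sym (J-above Y (ℕₚ.≤-<-trans m′≤m gt))) q) (ℕₚ.≤-trans (proj₂ (w X p)) (ℕₚ.<⇒≤ gt)))

  complete-separated : {C : Collection n} → InsideΔ m′ m C → Separated C → Separated (complete m′ m C)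
  complete-separated {n} {C} w s {X} {Y} p q with inΔ m′ m X in eX | inΔ m′ m Y in eY
  ... | true | true = s p q
  ... | true | false = inner-remainder-sep w p eY q
  ... | false | true = Sep-sym (inner-remainder-sep w q eX p)
  ... | false | false = J-separated m′ {X} {Y} p q

  -- By maximality C has at least as many members as `standard m′ m`, and the same remainder
  -- completes both; for the standard part the result is `J m′`, which is full.
  complete-full : {C : Collection n} → Max m′ m C → Full (complete m′ m C)
  complete-full {n} {C} M = full (complete-separated (within M) (apart M)) (ℕₚ.≤-trans (J-large n m′)
    (subst₂ _≤_ (sym (#-J {n} m′ m)) (sym (#-complete (within M)))
      (ℕₚ.+-monoˡ-≤ (# (remainder {n} m′ m)) (most M (standard m′ m) (standard-within m′ m) (standard-separated m′ m)))))

  -- Any separated D in Δ is completed by the same remainder to at most N sets, and `J m′` has N of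
  -- them.
  standard-max : {C : Collection n} → C ≐ standard m′ m → Max m′ m C
  standard-max {n} {C} e = maximum (λ S p → standard-within m′ m S (trans (sym (e S)) p))
    (λ {X} {Y} p q → standard-separated m′ m {X} {Y} (trans (sym (e X)) p) (trans (sym (e Y)) q))
    λ D w s → subst (# D ≤_) (sym (weight-cong (λ _ → 1) e)) (ℕₚ.+-cancelʳ-≤ (# (remainder {n} m′ m)) (# D) _
      (subst₂ _≤_ (#-complete w) (#-J {n} m′ m) (ℕₚ.≤-trans (#-≤-N (complete-separated w s)) (J-large n m′))))

  top-level : (C : Collection n) → ∀ h → IntervalsAbove C h → IntervalsAbove C m′ ⊎
    (∃ λ Y → Y ∈ᶜ C × interval Y ≡ false × m′ ℕ.< ∣ Y ∣ × IntervalsAbove C ∣ Y ∣)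
  top-level C zero above = inj₁ λ {S} p lt → above p (ℕₚ.≤-<-trans z≤n lt)
  top-level C (suc h) above with ℕₚ.≤-<-connex (suc h) m′
  ... | inj₁ le = inj₁ λ p lt → above p (ℕₚ.≤-<-trans le lt)
  ... | inj₂ lt with find (λ S → C S ∧ ((∣ S ∣ ≡ᵇ suc h) ∧ not (interval S)))
  ...   | inj₁ (Y , p) = let q , r = ∧-true {C Y} p ; e , i = ∧-true {∣ Y ∣ ≡ᵇ suc h} r in
          inj₂ (Y , q , not-true i , subst (m′ ℕ.<_) (sym (≡ᵇ-true e)) lt , subst (IntervalsAbove C) (sym (≡ᵇ-true e)) above)
    where
    not-true : ∀ {b} → not b ≡ true → b ≡ false
    not-true {false} _ = refl
  ...   | inj₂ f = top-level C h above′
    where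
    above′ : IntervalsAbove C h
    above′ {S} p le with interval S in eq | ℕₚ.m≤n⇒m<n∨m≡n le
    ... | true | _ = refl
    ... | false | inj₁ lt = trans (sym eq) (above p lt)
    ... | false | inj₂ e = ⊥-elim (true≢false (∧-intro p (∧-intro (subst (λ t → (∣ S ∣ ≡ᵇ t) ≡ true) (sym e) (≡ᵇ-refl ∣ S ∣)) (cong not eq))) (f S))

  -- The flip is found in the full completion, on the highest level h with a non-interval. Its sets
  -- have sizes h - 1 and h, and m′ < h puts both levels in Δ, so the flip takes place inside C.
  lowering-step : (C : Collection n) → Max m′ m C → IntervalsAbove C m′ ⊎
    (∃ λ D → Low3 m′ m C D × weight ∣_∣ D ℕ.< weight ∣_∣ C)
  lowering-step {n} C M with top-level C n (λ {S} _ lt → ⊥-elim (ℕₚ.<⇒≱ lt (∣p∣≤n S)))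
  ... | inj₁ above = inj₁ above
  ... | inj₂ (Y , Y∈ , ni , m′<Y , above) with non-interval {S = Y} ni
  ...   | a , b , c , a<b , b<c , Ya , Yb , Yc
    with lowering-flip (complete-full M) above′ (trans (complete-in {S = Y} C δY) Y∈) refl a<b b<c Ya Yb Yc
    where
    δY = within M Y Y∈
    above′ : ∀ {T} → T ∈ᶜ complete m′ m C → ∣ Y ∣ ℕ.< ∣ T ∣ → Convex T
    above′ {T} p lt with inΔ m′ m T in eq
    ... | true = interval-convex (above p lt)
    ... | false with inΔ-false {S = T} eq
    ...   | inj₁ lt′ = ⊥-elim (ℕₚ.<-asym (ℕₚ.<-trans m′<Y lt) lt′)
    ...   | inj₂ gt = interval-convex (trans (sym (J-above T (ℕₚ.<-trans m′<Y lt))) p)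
  ...     | flip {W} {i} {j} {k} i<j j<k Wi Wj Wk lv wi wk wij wjk wik =
    inj₂ (exchanged (W ⊕ i ⊕ k) (W ⊕ j) C , low3 i<j j<k Wi Wj Wk lo hi
      (one Wi wi) (one Wk wk) (two Wi Wj i<j wij) (two Wj Wk j<k wjk) sw , drop)
    where
    i<k = <-trans i<j j<k
    lo : m′ ≤ suc ∣ W ∣
    lo = ℕₚ.≤-pred (subst (m′ ℕ.<_) (sym lv) m′<Y)
    hi : suc (suc ∣ W ∣) ≤ m
    hi = subst (_≤ m) (sym lv) (proj₂ (within M Y Y∈))
    one : ∀ {t} → W ∌ t → W ⊕ t ∈ᶜ complete m′ m C → W ⊕ t ∈ᶜ C
    one {t} Wt p = trans (sym (complete-in {S = W ⊕ t} C (subst (m′ ≤_) (sym (size-⊕ Wt)) lo , subst (_≤ m) (sym (size-⊕ Wt)) (ℕₚ.<⇒≤ hi)))) p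
    two : ∀ {s t} → W ∌ s → W ∌ t → s < t → W ⊕ s ⊕ t ∈ᶜ complete m′ m C → W ⊕ s ⊕ t ∈ᶜ C
    two {s} {t} Ws Wt lt p = trans (sym (complete-in {S = W ⊕ s ⊕ t} C
      (subst (m′ ≤_) (sym (size-⊕⊕ Ws Wt lt)) (ℕₚ.m≤n⇒m≤1+n lo) , subst (_≤ m) (sym (size-⊕⊕ Ws Wt lt)) hi))) p
    smaller : ∣ W ⊕ j ∣ ℕ.< ∣ W ⊕ i ⊕ k ∣
    smaller = ℕₚ.≤-reflexive (trans (cong suc (size-⊕ Wj)) (sym (size-⊕⊕ Wi Wk i<k)))
    sw : Swap C (exchanged (W ⊕ i ⊕ k) (W ⊕ j) C) (W ⊕ i ⊕ k) (W ⊕ j)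
    -- The set `W ⊕ j` is absent, since the larger `W ⊕ i ⊕ k` alternates with it at i, j, k.
    sw = exchanged-swap C (two Wi Wk i<k wik) (¬true⇒false λ wj → no3 (apart M (two Wi Wk i<k wik) wj) smaller i<j j<k
      (⊕-∋ k (⊕-here W i) , ⊕-∌ (<⇒≢ i<j) Wi) (⊕-here W j , ⊕-∌ (<⇒≢ j<k) (⊕-∌ (>⇒≢ i<j) Wj)) (⊕-here _ k , ⊕-∌ (>⇒≢ j<k) Wk))
    drop : weight ∣_∣ (exchanged (W ⊕ i ⊕ k) (W ⊕ j) C) ℕ.< weight ∣_∣ C
    drop = ℕₚ.+-cancelʳ-< (∣ W ⊕ j ∣) _ _ (subst (weight ∣_∣ (exchanged (W ⊕ i ⊕ k) (W ⊕ j) C) + ∣ W ⊕ j ∣ ℕ.<_) (sym (weight-swap ∣_∣ sw))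
      (ℕₚ.+-monoʳ-< (weight ∣_∣ (exchanged (W ⊕ i ⊕ k) (W ⊕ j) C)) smaller))

  lower-to-intervals : ∀ t (C : Collection n) → weight ∣_∣ C ℕ.< t → Max m′ m C →
    ∃ λ D → Star (Low3 m′ m) C D × Max m′ m D × IntervalsAbove D m′
  lower-to-intervals (suc t) C (s≤s le) M with lowering-step C M
  ... | inj₁ above = C , ε , M , above
  ... | inj₂ (D , f , lt) = let E , fs , ME , above = lower-to-intervals t D (ℕₚ.<-≤-trans lt le) (low3-max f M) in E , f ◅ fs , ME , above

-- Lifting collections and flips to a single level

-- Inverse to `contract` for collections on the single level k (`lift-contract`): the prescribed
-- size decides whether the first element is present.
lift : ℕ → Collection n → Collection (suc n)
lift k D (b ∷ T) = D T ∧ (∣ b ∷ T ∣ ≡ᵇ k)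

false-≡ᵇ : ∀ {a b} → a ≢ b → (a ≡ᵇ b) ≡ false
false-≡ᵇ ne = ¬true⇒false (ne ∘ ≡ᵇ-true)

lift-∈ : ∀ {k} b (D : Collection n) → T ∈ᶜ D → ∣ b ∷ T ∣ ≡ k → (b ∷ T) ∈ᶜ lift k D
lift-∈ {T = T} b D p refl = ∧-intro p (≡ᵇ-refl ∣ b ∷ T ∣)

lift-∈⁻ : ∀ k b (D : Collection n) → (b ∷ T) ∈ᶜ lift k D → T ∈ᶜ D × ∣ b ∷ T ∣ ≡ k
lift-∈⁻ {T = T} k b D p = let q , e = ∧-true {D T} p in q , ≡ᵇ-true e

head-unique : ∀ {k} b b′ (T : Subset n) → ∣ b ∷ T ∣ ≡ k → ∣ b′ ∷ T ∣ ≡ k → b ≡ b′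
head-unique true true T _ _ = refl
head-unique false false T _ _ = refl
head-unique true false T p q = ⊥-elim (ℕₚ.1+n≢n (trans p (sym q)))
head-unique false true T p q = ⊥-elim (ℕₚ.1+n≢n (trans q (sym p)))

lift-swap : ∀ {k b b′} {A B : Collection n} → Swap A B Y Z → ∣ b ∷ Y ∣ ≡ k → ∣ b′ ∷ Z ∣ ≡ k →
  Swap (lift k A) (lift k B) (b ∷ Y) (b′ ∷ Z)
lift-swap {n} {Y} {Z} {k} {b} {b′} {A} {B} (AY , AZ , BY , BZ , e) sY sZ =
  lift-∈ b A AY sY , cong (_∧ (∣ b′ ∷ Z ∣ ≡ᵇ k)) AZ , cong (_∧ (∣ b ∷ Y ∣ ≡ᵇ k)) BY , lift-∈ b′ B BZ sZ , rest
  where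
  wrong : ∀ {c} {T : Subset n} → ∣ c ∷ T ∣ ≢ k → lift k B (c ∷ T) ≡ lift k A (c ∷ T)
  wrong {c} {T} ne rewrite false-≡ᵇ ne with A T | B T
  ... | true | true = refl
  ... | true | false = refl
  ... | false | true = refl
  ... | false | false = refl
  rest : ∀ S → S ≢ b ∷ Y → S ≢ b′ ∷ Z → lift k B S ≡ lift k A S
  rest (c ∷ T) ne ne′ with T ≟ˢ Y | T ≟ˢ Z
  -- Here T is exchanged, but under a first element that gives it the wrong size, so neither lift
  -- contains it.
  ... | yes refl | _ = wrong {c} λ s → ne (cong (_∷ T) (head-unique c b T s sY))
  ... | no _ | yes refl = wrong {c} λ s → ne′ (cong (_∷ T) (head-unique c b′ T s sZ))
  ... | no p | no q = cong (_∧ (∣ c ∷ T ∣ ≡ᵇ k)) (e T p q)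

AtLevel : ℕ → ℕ → Set
AtLevel k x = suc (suc x) ≡ k

-- A 3-flip between levels k and k + 1 is a 4-flip involving the new first element.
lift-low3 : ∀ {k} {A B : Collection n} → Low3 k (suc k) A B →
  Low4 (suc k) (suc k) (AtLevel (suc k)) (lift (suc k) A) (lift (suc k) B)
lift-low3 {k = k} {A} {B} (low3 {X} {i} {j} {l} 1<2 2<3 ∌₁ ∌₂ ∌₃ lo hi +₁ +₃ +₁₂ +₂₃ sw) =
  low4 {base = outside ∷ X} {zero} {suc i} {suc j} {suc l} (s≤s z≤n) (s≤s 1<2) (s≤s 2<3) here (there ∌₁) (there ∌₂) (there ∌₃)
    e (ℕₚ.≤-reflexive (sym e)) (ℕₚ.≤-reflexive e)
    (lift-∈ inside A +₁ (one ∌₁)) (lift-∈ outside A +₂₃ (trans (size-⊕⊕ ∌₂ ∌₃ 2<3) e)) (lift-∈ inside A +₃ (one ∌₃))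
    (lift-∈ outside A +₁₂ (trans (size-⊕⊕ ∌₁ ∌₂ 1<2) e)) (lift-swap {b = outside} {inside} sw (trans (size-⊕⊕ ∌₁ ∌₃ (<-trans 1<2 2<3)) e) (one ∌₂))
  where
  e : suc (suc ∣ X ∣) ≡ suc k
  e = ℕₚ.≤-antisym hi (s≤s lo)
  one : ∀ {t} → X ∌ t → suc ∣ X ⊕ t ∣ ≡ suc k
  one p = trans (cong suc (size-⊕ p)) e

lift-low4 : ∀ {k m} {A B : Collection n} → Low4 k m (AtLevel k) A B →
  Low4 (suc k) (suc k) (AtLevel (suc k)) (lift (suc k) A) (lift (suc k) B)
lift-low4 {k = k} {A = A} {B} (low4 {X} 1<2 2<3 3<4 ∌₁ ∌₂ ∌₃ ∌₄ refl lo hi +₁₂ +₃₄ +₁₄ +₂₃ sw) =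
  low4 {base = inside ∷ X} (s≤s 1<2) (s≤s 2<3) (s≤s 3<4) (there ∌₁) (there ∌₂) (there ∌₃) (there ∌₄) refl ℕₚ.≤-refl ℕₚ.≤-refl
    (lift-∈ inside A +₁₂ (two ∌₁ ∌₂ 1<2)) (lift-∈ inside A +₃₄ (two ∌₃ ∌₄ 3<4)) (lift-∈ inside A +₁₄ (two ∌₁ ∌₄ (<-trans 1<2 (<-trans 2<3 3<4))))
    (lift-∈ inside A +₂₃ (two ∌₂ ∌₃ 2<3)) (lift-swap {b = inside} {inside} sw (two ∌₂ ∌₄ (<-trans 2<3 3<4)) (two ∌₁ ∌₃ (<-trans 1<2 2<3)))
  where
  two : ∀ {s t} → X ∌ s → X ∌ t → s < t → suc ∣ X ⊕ s ⊕ t ∣ ≡ suc (suc (suc ∣ X ∣))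
  two p q lt = cong suc (size-⊕⊕ p q lt)

off-level : ℕ → Collection n → Collection n
off-level k D S = D S ∧ not (∣ S ∣ ≡ᵇ k)

with-level : ℕ → Collection n → Collection n → Collection n
with-level k D E S = E S ∨ off-level k D S

off-level-false : ∀ {k} (D : Collection n) → ∣ S ∣ ≡ k → off-level k D S ≡ false
off-level-false {S = S} D refl rewrite ≡ᵇ-refl ∣ S ∣ with D S
... | true = refl
... | false = refl

off-level-≢ : ∀ {k} (D : Collection n) → S ∈ᶜ off-level k D → S ∈ᶜ D × ∣ S ∣ ≢ k
off-level-≢ {S = S} D p = proj₁ (∧-true {D S} p) , λ e → true≢false p (off-level-false {S = S} D e)

with-level-low4 : ∀ {k m} (D : Collection n) {A B : Collection n} → k ≤ m → Low4 k k (AtLevel k) A B →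
  Low4 k m (AtLevel k) (with-level k D A) (with-level k D B)
with-level-low4 {k = k} {m} D {A} {B} k≤m (low4 {X} {i₁} {i₂} {i₃} {i₄} 1<2 2<3 3<4 ∌₁ ∌₂ ∌₃ ∌₄ lv lo hi +₁₂ +₃₄ +₁₄ +₂₃ (AY , AZ , BY , BZ , e)) =
  low4 1<2 2<3 3<4 ∌₁ ∌₂ ∌₃ ∌₄ lv lo (ℕₚ.≤-trans hi k≤m) (∨-introˡ _ +₁₂) (∨-introˡ _ +₃₄) (∨-introˡ _ +₁₄) (∨-introˡ _ +₂₃)
    (∨-introˡ _ AY , absent A AZ sZ , absent B BY sY , ∨-introˡ _ BZ , λ S p q → cong (_∨ off-level k D S) (e S p q))
  where
  sY = trans (size-⊕⊕ ∌₂ ∌₄ (<-trans 2<3 3<4)) lv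
  sZ = trans (size-⊕⊕ ∌₁ ∌₃ (<-trans 1<2 2<3)) lv
  absent : ∀ A {S} → A S ≡ false → ∣ S ∣ ≡ k → with-level k D A S ≡ false
  absent A {S} p s rewrite p = off-level-false {S = S} D s

with-level-≐ : ∀ k (D : Collection n) → with-level k D (level D k) ≐ D
with-level-≐ k D S with D S | ∣ S ∣ ≡ᵇ k
... | true | true = refl
... | true | false = refl
... | false | _ = refl

low4-resp : ∀ {P} {A A′ B : Collection n} → A ≐ A′ → Low4 m′ m P A B → Low4 m′ m P A′ B
low4-resp e (low4 1<2 2<3 3<4 ∌₁ ∌₂ ∌₃ ∌₄ lv lo hi +₁₂ +₃₄ +₁₄ +₂₃ (a , b , c , d , f)) =
  low4 1<2 2<3 3<4 ∌₁ ∌₂ ∌₃ ∌₄ lv lo hi (to +₁₂) (to +₃₄) (to +₁₄) (to +₂₃)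
    (to a , trans (sym (e _)) b , c , d , λ S p q → trans (f S p q) (e S))
  where
  to : ∀ {S} → _ → _
  to {S} p = trans (sym (e S)) p

-- Collections are functions compared pointwise, so a sequence of flips has to be moved to an equal
-- source explicitly. The first flip absorbs the change; an empty sequence passes it on to the
-- target.
low4s-resp : ∀ {P} {A A′ B : Collection n} → A ≐ A′ → Star (Low4 m′ m P) A B → ∃ λ B′ → B ≐ B′ × Star (Low4 m′ m P) A′ B′
low4s-resp {A′ = A′} e ε = A′ , e , ε
low4s-resp {B = B} e (f ◅ fs) = B , (λ _ → refl) , low4-resp e f ◅ fs

low4s-max : ∀ {P} {A B : Collection n} → Star (Low4 m′ m P) A B → Max m′ m A → Max m′ m B
low4s-max ε M = M
low4s-max (f ◅ fs) M = low4s-max fs (low4-max f M)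

Sep-cons : ∀ b → Sep Y Z → Sep (b ∷ Y) (b ∷ Z)
Sep-cons {Y = Y} {Z} b s = sep (four s) (four (Sep-sym s)) (λ lt → three s (sz {A = Z} {Y} b lt)) (λ lt → three (Sep-sym s) (sz {A = Y} {Z} b lt))
  where
  sz : ∀ {n} {A B : Subset n} b → ∣ b ∷ A ∣ ℕ.< ∣ b ∷ B ∣ → ∣ A ∣ ℕ.< ∣ B ∣
  sz true (s≤s lt) = lt
  sz false lt = lt
  un : ∀ {n} {A B : Subset n} {b i} → Diff (b ∷ A) (b ∷ B) i → ∃ λ j → suc j ≡ i × Diff A B j
  un {i = zero} (here , ())
  un {i = suc j} (there p , there q) = j , refl , p , q
  four : ∀ {n} {A B : Subset n} {b} → Sep A B → NoAlt4 (b ∷ A) (b ∷ B)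
  four s p q r x y z w with un x | un y | un z | un w
  ... | _ , refl , x′ | _ , refl , y′ | _ , refl , z′ | _ , refl , w′ = no4 s (ℕₚ.≤-pred p) (ℕₚ.≤-pred q) (ℕₚ.≤-pred r) x′ y′ z′ w′
  three : ∀ {n} {A B : Subset n} {b} → Sep A B → ∣ B ∣ ℕ.< ∣ A ∣ → NoAlt3 (b ∷ A) (b ∷ B)
  three s lt p q x y z with un x | un y | un z
  ... | _ , refl , x′ | _ , refl , y′ | _ , refl , z′ = no3 s lt (ℕₚ.≤-pred p) (ℕₚ.≤-pred q) x′ y′ z′

-- The extended sets have equal size, so only four-term patterns count. One that starts at the first
-- element continues with a pattern Z, Y, Z, forbidden because Z is larger than Y.
Sep-extend : Sep Y Z → ∣ Z ∣ ≡ suc ∣ Y ∣ → Sep (inside ∷ Y) (outside ∷ Z)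
Sep-extend {Y = Y} {Z} s e = sep f g (λ lt → ⊥-elim (ℕₚ.<-irrefl e lt)) (λ lt → ⊥-elim (ℕₚ.<-irrefl (sym e) lt))
  where
  f : NoAlt4 (inside ∷ Y) (outside ∷ Z)
  f {zero} {suc b} {suc c} {suc d} _ (s≤s q) (s≤s r) _ (there y , there y′) (there z , there z′) (there w , there w′) =
    no3′ s (ℕₚ.≤-reflexive (sym e)) q r (y , y′) (z , z′) (w , w′)
  f {suc a} {suc b} {suc c} {suc d} (s≤s p) (s≤s q) (s≤s r) (there x , there x′) (there y , there y′) (there z , there z′) (there w , there w′) =
    no4 s p q r (x , x′) (y , y′) (z , z′) (w , w′)
  g : NoAlt4 (outside ∷ Z) (inside ∷ Y)
  g {suc a} {suc b} {suc c} {suc d} (s≤s p) (s≤s q) (s≤s r) (there x , there x′) (there y , there y′) (there z , there z′) (there w , there w′) =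
    no4′ s p q r (x , x′) (y , y′) (z , z′) (w , w′)

lift-separated : ∀ {k} {D : Collection n} → Separated D → Separated (lift k D)
lift-separated {k = k} {D} s {true ∷ A} {true ∷ B} p q = Sep-cons true (s (proj₁ (lift-∈⁻ {T = A} k true D p)) (proj₁ (lift-∈⁻ {T = B} k true D q)))
lift-separated {k = k} {D} s {false ∷ A} {false ∷ B} p q = Sep-cons false (s (proj₁ (lift-∈⁻ {T = A} k false D p)) (proj₁ (lift-∈⁻ {T = B} k false D q)))
lift-separated {k = k} {D} s {true ∷ A} {false ∷ B} p q = let a , e = lift-∈⁻ {T = A} k true D p ; b , e′ = lift-∈⁻ {T = B} k false D q in
  Sep-extend (s a b) (trans e′ (sym e))
lift-separated {k = k} {D} s {false ∷ A} {true ∷ B} p q = let a , e = lift-∈⁻ {T = A} k false D p ; b , e′ = lift-∈⁻ {T = B} k true D q in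
  Sep-sym (Sep-extend (s b a) (trans e (sym e′)))

#-lift : ∀ {k} (D : Collection n) → InsideΔ k (suc k) D → # (lift (suc k) D) ≡ # D
#-lift {k = k} D w = sym (trans (#-restrict D (λ T → ∣ T ∣ ≡ᵇ k)) (cong (# (level D k) +_) (weight-cong (λ _ → 1) e)))
  where
  e : off-level k D ≐ level D (suc k)
  e S with D S in eq
  ... | false = refl
  ... | true with ℕₚ.m≤n⇒m<n∨m≡n (proj₁ (w S eq))
  ...   | inj₁ lt = let s = ℕₚ.≤-antisym (proj₂ (w S eq)) lt in
          trans (cong not (false-≡ᵇ (λ e → ℕₚ.<-irrefl (sym e) lt))) (sym (subst (λ t → (∣ S ∣ ≡ᵇ t) ≡ true) s (≡ᵇ-refl ∣ S ∣)))
  ...   | inj₂ s = trans (cong not (subst (λ t → (∣ S ∣ ≡ᵇ t) ≡ true) (sym s) (≡ᵇ-refl ∣ S ∣)))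
          (sym (false-≡ᵇ λ e → ℕₚ.1+n≢n (trans (sym e) (sym s))))

module _ {k : ℕ} {G : Collection (suc n)} (M : Max (suc k) (suc k) G) where
  private
    size : ∀ {S} → S ∈ᶜ G → ∣ S ∣ ≡ suc k
    size {S} p = ℕₚ.≤-antisym (proj₂ (within M S p)) (proj₁ (within M S p))

  -- Every competitor on levels k and k + 1 lifts to one on level k + 1 of the same cardinality. On
  -- a single level no set occurs both with and without the first element, so contraction of G loses
  -- nothing.
  contract-max : Max k (suc k) (contract G)
  contract-max = maximum w (contract-separated (apart M)) λ D wD sD →
    subst₂ _≤_ (#-lift D wD) #G (most M (lift (suc k) D) (λ { (b ∷ T) p → let e = proj₂ (lift-∈⁻ {T = T} (suc k) b D p) in
      ℕₚ.≤-reflexive (sym e) , ℕₚ.≤-reflexive e }) (lift-separated sD))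
    where
    w : InsideΔ k (suc k) (contract G)
    w T p with side {S = T} G p
    ... | inj₁ r = let e = ℕₚ.suc-injective (size {inside ∷ T} r) in ℕₚ.≤-reflexive (sym e) , ℕₚ.m≤n⇒m≤1+n (ℕₚ.≤-reflexive e)
    ... | inj₂ l = let e = size {outside ∷ T} l in ℕₚ.<⇒≤ (ℕₚ.≤-reflexive (sym e)) , ℕₚ.≤-reflexive e
    #G : # G ≡ # (contract G)
    #G = trans (#-contract G) (trans (cong (# (contract G) +_) (#-none {C = doubled G} λ T → ¬true⇒false λ p →
      let r , l = ∧-true {R G T} p in ℕₚ.1+n≢n (trans (size {inside ∷ T} r) (sym (size {outside ∷ T} l))))) (ℕₚ.+-identityʳ _))

  lift-contract : lift (suc k) (contract G) ≐ G
  lift-contract (b ∷ T) = ≡true⇔ (λ p → let q , e = lift-∈⁻ {T = T} (suc k) b (contract G) p in to b e (side {S = T} G q))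
    λ p → lift-∈ {T = T} b (contract G) (from b p) (size {b ∷ T} p)
    where
    to : ∀ b → ∣ b ∷ T ∣ ≡ suc k → T ∈ᶜ R G ⊎ T ∈ᶜ L G → (b ∷ T) ∈ᶜ G
    to b e (inj₁ r) = subst (λ b → (b ∷ T) ∈ᶜ G) (head-unique true b T (size {inside ∷ T} r) e) r
    to b e (inj₂ l) = subst (λ b → (b ∷ T) ∈ᶜ G) (head-unique false b T (size {outside ∷ T} l) e) l
    from : ∀ b → (b ∷ T) ∈ᶜ G → T ∈ᶜ contract G
    from true p = R-∈ {S = T} G p
    from false p = L-∈ {S = T} G p

-- A competitor for the level is separated from the intervals above and can replace that level in D;
-- maximality of D then bounds it.
level-max : (m′≤m : m′ ≤ m) {D : Collection n} → Max m′ m D → IntervalsAbove D m′ → Max m′ m′ (level D m′)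
level-max {m′} {m} {n} m′≤m {D} M above = maximum
  (λ S p → let e = ≡ᵇ-true (proj₂ (∧-true {D S} p)) in ℕₚ.≤-reflexive (sym e) , ℕₚ.≤-reflexive e)
  (λ {X} {Y} p q → apart M (proj₁ (∧-true {D X} p)) (proj₁ (∧-true {D Y} q)))
  λ E wE sE → ℕₚ.+-cancelʳ-≤ (# (off-level m′ D)) (# E) _
    (subst₂ _≤_ (sym (count E wE)) (#-restrict D (λ S → ∣ S ∣ ≡ᵇ m′)) (most M (with-level m′ D E) (inside′ E wE) (apart′ E wE sE)))
  where
  high : ∀ {S} → S ∈ᶜ off-level m′ D → m′ ℕ.< ∣ S ∣ × S ∈ᶜ D
  high {S} p = let q , ne = off-level-≢ {S = S} D p in ℕₚ.≤∧≢⇒< (proj₁ (within M S q)) (λ e → ne (sym e)) , q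
  count : ∀ E → InsideΔ m′ m′ E → # E + # (off-level m′ D) ≡ # (with-level m′ D E)
  count E w = trans (#-∨-∧ E (off-level m′ D)) (trans (cong (# (with-level m′ D E) +_) (#-none {C = λ S → E S ∧ off-level m′ D S}
    λ S → ¬true⇒false λ p → let a , b = ∧-true {E S} p in ℕₚ.<⇒≱ (proj₁ (high {S} b)) (proj₂ (w S a)))) (ℕₚ.+-identityʳ _))
  inside′ : ∀ E → InsideΔ m′ m′ E → InsideΔ m′ m (with-level m′ D E)
  inside′ E w S p with ∨-true {E S} p
  ... | inj₁ q = proj₁ (w S q) , ℕₚ.≤-trans (proj₂ (w S q)) m′≤m
  ... | inj₂ q = within M S (proj₂ (high {S} q))
  cross : ∀ E → InsideΔ m′ m′ E → ∀ {X Y} → X ∈ᶜ E → Y ∈ᶜ off-level m′ D → Sep X Y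
  cross E w {X} {Y} p q = let lt , r = high {Y} q in Sep-sym (interval-sep (above r lt) (ℕₚ.<⇒≤ (ℕₚ.≤-<-trans (proj₂ (w X p)) lt)))
  apart′ : ∀ E → InsideΔ m′ m′ E → Separated E → Separated (with-level m′ D E)
  apart′ E w s {X} {Y} p q with ∨-true {E X} p | ∨-true {E Y} q
  ... | inj₁ a | inj₁ b = s a b
  ... | inj₁ a | inj₂ b = cross E w a b
  ... | inj₂ a | inj₁ b = Sep-sym (cross E w b a)
  ... | inj₂ a | inj₂ b = apart M (proj₂ (high {X} a)) (proj₂ (high {Y} b))

-- In the end a set with the first element continues as a split set, by the recursive call, and one
-- without it as an interval, by the 3-flips; both are split. The recursion acts on the lower level
-- of the contraction and keeps the upper one.
lower-slice : ∀ n k (G : Collection n) → Max k k G →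
  ∃ λ E → Star (Low4 k k (AtLevel k)) G E × Max k k E × (∀ {S} → S ∈ᶜ E → split S ≡ true)
lower-slice zero k G M = G , ε , M , λ { {[]} _ → refl }
lower-slice (suc n) zero G M = G , ε , M , λ {S} p → interval⇒split {S = S} (size0⇒interval S (ℕₚ.≤-antisym (proj₂ (within M S p)) z≤n))
lower-slice (suc n) (suc k) G M
  with lower-to-intervals (ℕₚ.n≤1+n k) (suc (weight ∣_∣ (contract G))) (contract G) ℕₚ.≤-refl (contract-max M)
... | D , fs , MD , above with lower-slice n k (level D k) (level-max (ℕₚ.n≤1+n k) MD above)
...   | E , gs , ME , splits
  with low4s-resp (λ { (b ∷ T) → cong (_∧ (∣ b ∷ T ∣ ≡ᵇ suc k)) (with-level-≐ k D T) })
         (gmap (λ A → lift (suc k) (with-level k D A)) (λ f → lift-low4 (with-level-low4 D (ℕₚ.n≤1+n k) f)) gs)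
...     | E₁ , e₁ , gs₁ with low4s-resp (lift-contract M) (gmap (lift (suc k)) lift-low3 fs ◅◅ gs₁)
...       | E₂ , e₂ , gs₂ = E₂ , gs₂ , low4s-max gs₂ M , λ { {b ∷ T} p →
              let q , e = lift-∈⁻ {T = T} (suc k) b (with-level k D E) (trans (e₁ (b ∷ T)) (trans (e₂ (b ∷ T)) p)) in
              final-split b T e (∨-true {E T} q) }
  where
  final-split : ∀ b T → ∣ b ∷ T ∣ ≡ suc k → T ∈ᶜ E ⊎ T ∈ᶜ off-level k D → split (b ∷ T) ≡ true
  final-split b T e (inj₁ p) with head-unique true b T (cong suc (ℕₚ.≤-antisym (proj₂ (within ME T p)) (proj₁ (within ME T p)))) e
  ... | refl = splits p
  final-split b T e (inj₂ p) with off-level-≢ {S = T} D p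
  ... | q , ne with ℕₚ.≤∧≢⇒< (proj₁ (within MD T q)) (λ e → ne (sym e))
  ...   | lt with head-unique false b T (ℕₚ.≤-antisym (proj₂ (within MD T q)) lt) e
  ...     | refl = above q lt

⊆-#-≐ : {A B : Collection n} → (∀ S → S ∈ᶜ A → S ∈ᶜ B) → # B ≤ # A → A ≐ B
⊆-#-≐ {A = A} {B} sub le S = ≡true⇔ (sub S) missing
  where
  missing : S ∈ᶜ B → S ∈ᶜ A
  missing p with A S in eq
  ... | true = refl
  ... | false = ⊥-elim (ℕₚ.<⇒≱ (ℕₚ.≤-trans (s≤s (#-mono sub′))
      (ℕₚ.≤-reflexive (sym (weight-remove (λ _ → 1) {B} {remove S B} S p (remove-here S B) λ _ → remove-there S B)))) le)
    where
    sub′ : ∀ T → T ∈ᶜ A → T ∈ᶜ remove S B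
    sub′ T q = trans (remove-there S B λ { refl → true≢false q eq }) (sub T q)

-- Reaching the standard collection

standard⇒IsIS : {C : Collection n} → m′ ≤ m → C ≐ standard m′ m → IsIS m′ m C
standard⇒IsIS {m′ = m′} {m} {C} m′≤m e S = mk⇔
  (λ p → let j , δ = ∧-true {J m′ S} (trans (sym (e S)) p) in Equivalence.from (InIS⇔J m′≤m) (true-inΔ {S = S} δ , j))
  (λ p → let δ , j = Equivalence.to (InIS⇔J m′≤m) p in trans (e S) (∧-intro j (inΔ-true {S = S} δ)))

IsIS⇒standard : {C : Collection n} → m′ ≤ m → IsIS m′ m C → C ≐ standard m′ m
IsIS⇒standard {m′ = m′} {m} {C} m′≤m is S = ≡true⇔
  (λ p → let δ , j = Equivalence.to (InIS⇔J m′≤m) (Equivalence.to (is S) p) in ∧-intro j (inΔ-true {S = S} δ))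
  (λ p → let j , δ = ∧-true {J m′ S} p in Equivalence.from (is S) (Equivalence.from (InIS⇔J m′≤m) (true-inΔ {S = S} δ , j)))

-- The flips leave intervals above level m′ and split sets on it, all of them standard. The result
-- is still maximum, so it has at least as many members as `standard m′ m` and equals it.
lower-to-standard : m′ ≤ m → (C : Collection n) → Max m′ m C →
  ∃ λ D → Star (Low3 m′ m) C D × ∃ λ E → Star (Low4 m′ m (AtLevel m′)) D E × E ≐ standard m′ m
lower-to-standard {m′} {m} {n} m′≤m C M
  with lower-to-intervals m′≤m (suc (weight ∣_∣ C)) C ℕₚ.≤-refl M
... | D , fs , MD , above with lower-slice n m′ (level D m′) (level-max m′≤m MD above)
...   | E , gs , ME , splits with low4s-resp (with-level-≐ m′ D) (gmap (with-level m′ D) (with-level-low4 D m′≤m) gs)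
...     | E′ , e , hs = D , fs , E′ , hs , ⊆-#-≐ sub (most ME′ (standard m′ m) (standard-within m′ m) (standard-separated m′ m))
  where
  ME′ = low4s-max hs MD
  in-J : ∀ S → S ∈ᶜ E ⊎ S ∈ᶜ off-level m′ D → S ∈ᶜ J m′
  in-J S (inj₁ p) = trans (J-at S (ℕₚ.≤-antisym (proj₂ (within ME S p)) (proj₁ (within ME S p)))) (splits p)
  in-J S (inj₂ p) = let q , ne = off-level-≢ {S = S} D p ; lt = ℕₚ.≤∧≢⇒< (proj₁ (within MD S q)) (≢-sym ne) in
    trans (J-above S lt) (above q lt)
  sub : ∀ S → S ∈ᶜ E′ → S ∈ᶜ standard m′ m
  sub S p = ∧-intro (in-J S (∨-true {E S} (trans (e S) p))) (inΔ-true {S = S} (within ME′ S p))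

flip-max : {C D : Collection n} → Flip m′ m C D → Max m′ m C → Max m′ m D
flip-max (inj₁ f) = low3-max (Lower3⇒Low3 f)
flip-max (inj₂ (inj₁ f)) = raise3-max (Lower3⇒Low3 f)
flip-max (inj₂ (inj₂ (inj₁ f))) = low4-max (Lower4⇒Low4 f)
flip-max (inj₂ (inj₂ (inj₂ f))) = raise4-max (Lower4⇒Low4 f)

flips-max : {C D : Collection n} → Star (Flip m′ m) C D → Max m′ m C → Max m′ m D
flips-max ε M = M
flips-max (f ◅ fs) M = flips-max fs (flip-max f M)

theorem11p4 : (n m' m : ℕ) → m' ≤ m → m ≤ n →
    ((C : Collection n) → MaxWS m' m C →
    Σ (Collection n) λ D → Star (Lower3 m' m) C D ×
    Σ (Collection n) λ E → Star (Lower4Level m' m) D E × IsIS m' m E)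
    × ((C : Collection n) → InB m' m C ⇔ MaxWS m' m C)
theorem11p4 n m' m m'≤m _ = lowered , λ C → mk⇔ (to C) (from C)
  where
  lowered : (C : Collection n) → MaxWS m' m C → Σ (Collection n) λ D → Star (Lower3 m' m) C D ×
    Σ (Collection n) λ E → Star (Lower4Level m' m) D E × IsIS m' m E
  lowered C M = let D , fs , E , gs , e = lower-to-standard m'≤m C (MaxWS⇒Max M) in
    D , map* Low3⇒Lower3 fs , E , map* Low4⇒Lower4 gs , standard⇒IsIS m'≤m e
  to : ∀ C → InB m' m C → MaxWS m' m C
  to C (C₀ , is , fs) = Max⇒MaxWS (flips-max fs (standard-max m'≤m (IsIS⇒standard m'≤m is)))
  from : ∀ C → MaxWS m' m C → InB m' m C
  from C M = let D , fs , E , gs , is = lowered C M in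
    -- Read backwards, the descent leads from the standard collection to C by raising flips; the
    -- level condition of each 4-flip becomes the trivial one of `Lower4`.
    E , is , reverse* (λ (i , j , k , l , X , a , b , c , d , e , f , g , _ , r) → inj₂ (inj₂ (inj₂ (i , j , k , l , X , a , b , c , d , e , f , g , _ , r)))) gs
      ◅◅ reverse* (inj₂ ∘ inj₁) fs
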